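{- Let $p$ be a prime, $n\geq 1$, $\zeta=\zeta_{p^n}$ a primitive $p^n$th root of unity, $T=\mathbb{Z}_{(p)}[\zeta]$ and $t=1-\zeta$. Consider the cyclotomic Dedekind embedding \[ \delta_{p^n}\colon T\otimes_{\mathbb{Z}_{(p)}}T\longrightarrow \prod_{i\in(\mathbb{Z}/p^n)^\ast}T,\qquad \zeta^k\otimes\zeta^l\longmapsto(\zeta^{k+il})_{i\in(\mathbb{Z}/p^n)^\ast}\quad (k,l\in[0,(p-1)p^{n-1}-1]), \] a $T$-linear injective map between free $T$-modules of rank $(p-1)p^{n-1}$ (with $T$ acting on the left tensor factor and componentwise on the product). Let $j\in[0,p^n-1]$ with $p\nmid j$, let $N(j):=\#\{i\in[0,j]: p\nmid i\}$, and write $j=\sum_{s\geq 0}a_sp^s$ with $a_s\in[0,p-1]$. Then the $N(j)$th $T$-linear elementary divisor of $\delta_{p^n}$ has $t$-adic valuation \[ -1+\sum_{s\geq 0}\bigl(a_s(s+1)-a_{s+1}(s+2)\bigr)p^s . \]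
   Context: For an injective $T$-linear map $f\colon M\to N$ between free modules of the same finite rank $r$ over a discrete valuation ring $T$ with uniformizer $t$, there are $T$-bases of $M$ and $N$ in which $f$ is diagonal with entries $t^{e_0},\dots,t^{e_{r-1}}$ (times units), $e_0\le e_1\le\dots\le e_{r-1}$; the $k$th elementary divisor is $t^{e_{k-1}}$, whose valuation is $e_{k-1}$. $\mathbb{Z}_{(p)}$ denotes the localization of $\mathbb{Z}$ at the prime ideal $(p)$. -}

module Defs where

open import Algebra.Apartness.Bundles using (HeytingField; HeytingCommutativeRing)
open import Algebra.Bundles using (CommutativeRing; AbelianGroup)
open import Algebra.Definitions using (Invertible)
open import Algebra.Module.Bundles using (LeftModule)
open import Algebra.Module.Morphism.Structures using (module LeftModuleMorphisms)
open import Algebra.Morphism.Structures using (module RingMorphisms)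
import Algebra.Properties.AbelianGroup as AbelianGroupProperties
import Algebra.Properties.CommutativeMonoid.Sum as Sum
import Algebra.Properties.Ring as RingProperties
import Algebra.Properties.Semiring.Exp as Exp
import Algebra.Properties.Semiring.Mult as Mult
open import Data.Fin.Base as Fin using (Fin; toℕ)
open import Data.Integer.Base as ℤ using (ℤ; +_; -[1+_]; _⊖_)
import Data.Integer.Properties as ℤ
open import Data.List.Base using (length; filter; upTo)
open import Data.Nat.Base as ℕ using (ℕ; zero; suc; _∸_; _≤_; _<_)
open import Data.Nat.Coprimality using (Coprime)
open import Data.Nat.Divisibility using (_∣_; _∤_; _∣?_; ∣1⇒≡1)
open import Data.Nat.Primality using (Prime; prime⇒irreducible; euclidsLemma; ¬prime[1])
import Data.Nat.Properties as ℕ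
open import Data.Product.Base using (Σ; ∃; ∃₂; _,_; _×_; proj₁; proj₂)
open import Data.Sum.Base using (inj₁; inj₂)
open import Function.Base using (_∘_)
open import Level using (Level; _⊔_) renaming (suc to lsuc)
import Relation.Binary.Reasoning.Setoid as SetoidReasoning
open import Relation.Binary.PropositionalEquality.Core as ≡ using (_≡_)
open import Relation.Nullary using (¬_; ¬?)
open import Relation.Unary using (Pred)

private
  variable
    a b c ℓ ℓ₁ ℓ₂ ℓ₃ m₁ m₂ : Level

module _ (R : CommutativeRing c ℓ) where
  open CommutativeRing R

  record IsSubring (P : Pred Carrier ℓ₁) : Set (c ⊔ ℓ₁) where
    field
      0-closed : P 0#
      1-closed : P 1#
      +-closed : ∀ {x y} → P x → P y → P (x + y)
      *-closed : ∀ {x y} → P x → P y → P (x * y)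
      neg-closed : ∀ {x} → P x → P (- x)

  subring : {P : Pred Carrier ℓ₁} → IsSubring P → CommutativeRing (c ⊔ ℓ₁) ℓ
  subring {P = P} S = record
    { Carrier = Σ Carrier P
    ; _≈_ = λ x y → proj₁ x ≈ proj₁ y
    ; _+_ = λ (x , x∈) (y , y∈) → x + y , +-closed x∈ y∈
    ; _*_ = λ (x , x∈) (y , y∈) → x * y , *-closed x∈ y∈
    ; -_ = λ (x , x∈) → - x , neg-closed x∈
    ; 0# = 0# , 0-closed
    ; 1# = 1# , 1-closed
    ; isCommutativeRing = record
      { isRing = record
        { +-isAbelianGroup = record
          { isGroup = record
            { isMonoid = record
              { isSemigroup = record
                { isMagma = record
                  { isEquivalence = record { refl = refl ; sym = sym ; trans = trans }
                  ; ∙-cong = +-cong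
                  }
                ; assoc = λ _ _ _ → +-assoc _ _ _
                }
              ; identity = (λ _ → +-identityˡ _) , (λ _ → +-identityʳ _)
              }
            ; inverse = (λ _ → -‿inverseˡ _) , (λ _ → -‿inverseʳ _)
            ; ⁻¹-cong = -‿cong
            }
          ; comm = λ _ _ → +-comm _ _
          }
        ; *-cong = *-cong
        ; *-assoc = λ _ _ _ → *-assoc _ _ _
        ; *-identity = (λ _ → *-identityˡ _) , (λ _ → *-identityʳ _)
        ; distrib = (λ _ _ _ → distribˡ _ _ _) , (λ _ _ _ → distribʳ _ _ _)
        }
      ; *-comm = λ _ _ → *-comm _ _
      }
    }
    where open IsSubring S

module IntegerMultiples (R : CommutativeRing c ℓ) where
  open CommutativeRing R
  open Mult semiring using (×1-homo-*) renaming (_×_ to _·_; ×-homo-+ to ·-homo-+)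
  open RingProperties ring
  open SetoidReasoning setoid

  fromℤ : ℤ → Carrier
  fromℤ (+ n)    = n · 1#
  fromℤ -[1+ n ] = - (suc n · 1#)

  private
    cancel : ∀ x y z → (x + y) - (x + z) ≈ y - z
    cancel x y z = begin
      (x + y) - (x + z)        ≈⟨ +-congˡ (-‿+-comm x z) ⟨
      (x + y) + (- x + - z)    ≈⟨ +-congʳ (+-comm x y) ⟩
      (y + x) + (- x + - z)    ≈⟨ +-assoc _ _ _ ⟩
      y + (x + (- x + - z))    ≈⟨ +-congˡ (+-assoc _ _ _) ⟨
      y + ((x + - x) + - z)    ≈⟨ +-congˡ (+-congʳ (-‿inverseʳ x)) ⟩
      y + (0# + - z)           ≈⟨ +-congˡ (+-identityˡ _) ⟩
      y - z                    ∎

  fromℤ-⊖ : ∀ m n → fromℤ (m ⊖ n) ≈ m · 1# - n · 1#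
  fromℤ-⊖ zero    zero    = sym (-‿inverseʳ 0#)
  fromℤ-⊖ zero    (suc n) = sym (+-identityˡ _)
  fromℤ-⊖ (suc m) zero    = sym (trans (+-congˡ -0#≈0#) (+-identityʳ _))
  fromℤ-⊖ (suc m) (suc n) = begin
    fromℤ (suc m ⊖ suc n)    ≡⟨ ≡.cong fromℤ (ℤ.[1+m]⊖[1+n]≡m⊖n m n) ⟩
    fromℤ (m ⊖ n)            ≈⟨ fromℤ-⊖ m n ⟩
    m · 1# - n · 1#          ≈⟨ cancel 1# _ _ ⟨
    suc m · 1# - suc n · 1#  ∎

  fromℤ-neg : ∀ i → fromℤ (ℤ.- i) ≈ - fromℤ i
  fromℤ-neg (+ zero)   = sym -0#≈0#
  fromℤ-neg (+ suc n)  = refl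
  fromℤ-neg -[1+ n ]   = sym (-‿involutive _)

  fromℤ-+ : ∀ i j → fromℤ (i ℤ.+ j) ≈ fromℤ i + fromℤ j
  fromℤ-+ (+ m)    (+ n)    = ·-homo-+ 1# m n
  fromℤ-+ (+ m)    -[1+ n ] = fromℤ-⊖ m (suc n)
  fromℤ-+ -[1+ m ] (+ n)    = trans (fromℤ-⊖ n (suc m)) (+-comm _ _)
  fromℤ-+ -[1+ m ] -[1+ n ] = begin
    - (suc (suc (m ℕ.+ n)) · 1#)        ≡⟨ ≡.cong (λ k → - (suc k · 1#)) (ℕ.+-suc m n) ⟨
    - ((suc m ℕ.+ suc n) · 1#)          ≈⟨ -‿cong (·-homo-+ 1# (suc m) (suc n)) ⟩
    - (suc m · 1# + suc n · 1#)         ≈⟨ -‿+-comm _ _ ⟨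
    - (suc m · 1#) + - (suc n · 1#)     ∎

  private
    fromℤ-*⁺ : ∀ m j → fromℤ (+ m ℤ.* j) ≈ (m · 1#) * fromℤ j
    fromℤ-*⁺ zero    j = sym (zeroˡ _)
    fromℤ-*⁺ (suc m) j = begin
      fromℤ (+ suc m ℤ.* j)                  ≡⟨ ≡.cong fromℤ (ℤ.suc-* (+ m) j) ⟩
      fromℤ (j ℤ.+ + m ℤ.* j)                ≈⟨ fromℤ-+ j (+ m ℤ.* j) ⟩
      fromℤ j + fromℤ (+ m ℤ.* j)            ≈⟨ +-cong (sym (*-identityˡ _)) (fromℤ-*⁺ m j) ⟩
      1# * fromℤ j + (m · 1#) * fromℤ j      ≈⟨ distribʳ _ _ _ ⟨
      (suc m · 1#) * fromℤ j                 ∎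

  fromℤ-* : ∀ i j → fromℤ (i ℤ.* j) ≈ fromℤ i * fromℤ j
  fromℤ-* (+ m)    j = fromℤ-*⁺ m j
  fromℤ-* -[1+ m ] j = begin
    fromℤ (-[1+ m ] ℤ.* j)          ≡⟨ ≡.cong fromℤ (ℤ.neg-distribˡ-* (+ suc m) j) ⟨
    fromℤ (ℤ.- (+ suc m ℤ.* j))     ≈⟨ fromℤ-neg (+ suc m ℤ.* j) ⟩
    - fromℤ (+ suc m ℤ.* j)         ≈⟨ -‿cong (fromℤ-*⁺ (suc m) j) ⟩
    - ((suc m · 1#) * fromℤ j)      ≈⟨ -‿distribˡ-* _ _ ⟩
    - (suc m · 1#) * fromℤ j        ∎

module _ (R : CommutativeRing c ℓ) where
  open CommutativeRing R
  open Mult semiring using (×-comm-*; ×-assoc-*; ×-assocˡ; ×-congʳ; ×-homo-1) renaming (_×_ to _·_)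
  open RingProperties ring
  open IntegerMultiples R
  open SetoidReasoning setoid

  -- x is a fraction i / s with i ∈ ℤ and s ∈ ℕ prime to p. When R is a
  -- field of characteristic 0, such s are invertible in R, and these x form
  -- the copy of the localization of ℤ at (p) inside R.
  Localized : ℕ → Pred Carrier ℓ
  Localized p x = ∃₂ λ (i : ℤ) (s : ℕ) → p ∤ s × (s · x ≈ fromℤ i)

  -- The smallest subring of R containing ℤ₍ₚ₎ and z.
  data Adjoin (p : ℕ) (z : Carrier) : Pred Carrier (c ⊔ ℓ) where
    base : ∀ {x} → Localized p x → Adjoin p z x
    gen  : Adjoin p z z
    add  : ∀ {x y} → Adjoin p z x → Adjoin p z y → Adjoin p z (x + y)
    mul  : ∀ {x y} → Adjoin p z x → Adjoin p z y → Adjoin p z (x * y)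
    neg  : ∀ {x} → Adjoin p z x → Adjoin p z (- x)
    resp : ∀ {x y} → x ≈ y → Adjoin p z x → Adjoin p z y

  private
    ·-distrib-+ : ∀ n x y → n · (x + y) ≈ n · x + n · y
    ·-distrib-+ n x y = begin
      n · (x + y)                  ≈⟨ ×-congʳ n (*-identityˡ _) ⟨
      n · (1# * (x + y))           ≈⟨ ×-assoc-* n 1# _ ⟨
      (n · 1#) * (x + y)           ≈⟨ distribˡ _ _ _ ⟩
      (n · 1#) * x + (n · 1#) * y  ≈⟨ +-cong (lem x) (lem y) ⟩
      n · x + n · y                ∎
      where
      lem : ∀ z → (n · 1#) * z ≈ n · z
      lem z = trans (×-assoc-* n 1# z) (×-congʳ n (*-identityˡ z))

    ·-fromℤ : ∀ n i → n · fromℤ i ≈ fromℤ (+ n ℤ.* i)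
    ·-fromℤ n i = begin
      n · fromℤ i          ≈⟨ ×-congʳ n (*-identityˡ _) ⟨
      n · (1# * fromℤ i)   ≈⟨ ×-assoc-* n 1# _ ⟨
      (n · 1#) * fromℤ i   ≈⟨ fromℤ-* (+ n) i ⟨
      fromℤ (+ n ℤ.* i)    ∎

    ·-neg : ∀ n x → n · (- x) ≈ - (n · x)
    ·-neg n x = begin
      n · (- x)             ≈⟨ ×-congʳ n (-1*x≈-x x) ⟨
      n · (- 1# * x)        ≈⟨ ×-comm-* n (- 1#) x ⟨
      - 1# * (n · x)        ≈⟨ -1*x≈-x _ ⟩
      - (n · x)             ∎

  module _ {p : ℕ} (p-prime : Prime p) where
    private
      p∤1 : p ∤ 1
      p∤1 p∣1 = ¬prime[1] (≡.subst Prime (∣1⇒≡1 p∣1) p-prime)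

      p∤* : ∀ {s s′} → p ∤ s → p ∤ s′ → p ∤ s ℕ.* s′
      p∤* {s} {s′} p∤s p∤s′ p∣ with euclidsLemma s s′ p-prime p∣
      ... | inj₁ p∣s  = p∤s p∣s
      ... | inj₂ p∣s′ = p∤s′ p∣s′

    Localized-isSubring : IsSubring R (Localized p)
    Localized-isSubring = record
      { 0-closed = + 0 , 1 , p∤1 , +-identityʳ 0#
      ; 1-closed = + 1 , 1 , p∤1 , refl
      ; +-closed = λ {x} {y} (i , s , p∤s , sx≈i) (i′ , s′ , p∤s′ , sy≈i′) →
          + s′ ℤ.* i ℤ.+ + s ℤ.* i′ , s ℕ.* s′ , p∤* p∤s p∤s′ , (begin
            (s ℕ.* s′) · (x + y)                       ≈⟨ ·-distrib-+ (s ℕ.* s′) x y ⟩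
            (s ℕ.* s′) · x + (s ℕ.* s′) · y            ≡⟨ ≡.cong (λ k → k · x + (s ℕ.* s′) · y) (ℕ.*-comm s s′) ⟩
            (s′ ℕ.* s) · x + (s ℕ.* s′) · y            ≈⟨ +-cong (×-assocˡ x s′ s) (×-assocˡ y s s′) ⟨
            s′ · (s · x) + s · (s′ · y)                ≈⟨ +-cong (×-congʳ s′ sx≈i) (×-congʳ s sy≈i′) ⟩
            s′ · fromℤ i + s · fromℤ i′                ≈⟨ +-cong (·-fromℤ s′ i) (·-fromℤ s i′) ⟩
            fromℤ (+ s′ ℤ.* i) + fromℤ (+ s ℤ.* i′)    ≈⟨ fromℤ-+ (+ s′ ℤ.* i) (+ s ℤ.* i′) ⟨
            fromℤ (+ s′ ℤ.* i ℤ.+ + s ℤ.* i′)          ∎)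
      ; *-closed = λ {x} {y} (i , s , p∤s , sx≈i) (i′ , s′ , p∤s′ , sy≈i′) →
          i ℤ.* i′ , s ℕ.* s′ , p∤* p∤s p∤s′ , (begin
            (s ℕ.* s′) · (x * y)      ≈⟨ ×-assocˡ (x * y) s s′ ⟨
            s · (s′ · (x * y))        ≈⟨ ×-congʳ s (×-comm-* s′ x y) ⟨
            s · (x * (s′ · y))        ≈⟨ ×-assoc-* s x _ ⟨
            (s · x) * (s′ · y)        ≈⟨ *-cong sx≈i sy≈i′ ⟩
            fromℤ i * fromℤ i′        ≈⟨ fromℤ-* i i′ ⟨
            fromℤ (i ℤ.* i′)          ∎)
      ; neg-closed = λ {x} (i , s , p∤s , sx≈i) →
          ℤ.- i , s , p∤s , (begin
            s · (- x)       ≈⟨ ·-neg s x ⟩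
            - (s · x)       ≈⟨ -‿cong sx≈i ⟩
            - fromℤ i       ≈⟨ fromℤ-neg i ⟨
            fromℤ (ℤ.- i)   ∎)
      }

    Adjoin-isSubring : ∀ z → IsSubring R (Adjoin p z)
    Adjoin-isSubring z = record
      { 0-closed = base 0-closed
      ; 1-closed = base 1-closed
      ; +-closed = add
      ; *-closed = mul
      ; neg-closed = neg
      }
      where open IsSubring Localized-isSubring

-- S ⊗_R S for an R-algebra ι : R → S, as an S-module via the left factor.
module TensorSquare
  (R : CommutativeRing a ℓ₁) (S : CommutativeRing b ℓ₂)
  (ι : CommutativeRing.Carrier R → CommutativeRing.Carrier S)
  (ι-homo : RingMorphisms.IsRingHomomorphism (CommutativeRing.rawRing R) (CommutativeRing.rawRing S) ι)
  where

  private
    module R = CommutativeRing R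
  open CommutativeRing S

  infix  8 _⊗_
  infix  7 ⊖_
  infixl 6 _⊕_
  infix  4 _≋_

  data Tensor : Set b where
    _⊗_ : Carrier → Carrier → Tensor
    _⊕_ : Tensor → Tensor → Tensor
    ⊖_  : Tensor → Tensor
    𝟎   : Tensor

  -- The abelian group generated by the pure tensors, subject to biadditivity
  -- and R-balancedness.
  data _≋_ : Tensor → Tensor → Set (a ⊔ b ⊔ ℓ₂) where
    ≋-refl  : ∀ {u} → u ≋ u
    ≋-sym   : ∀ {u v} → u ≋ v → v ≋ u
    ≋-trans : ∀ {u v w} → u ≋ v → v ≋ w → u ≋ w

    ⊕-cong      : ∀ {u u′ v v′} → u ≋ u′ → v ≋ v′ → u ⊕ v ≋ u′ ⊕ v′
    ⊖-cong      : ∀ {u u′} → u ≋ u′ → ⊖ u ≋ ⊖ u′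
    ⊕-assoc     : ∀ u v w → (u ⊕ v) ⊕ w ≋ u ⊕ (v ⊕ w)
    ⊕-comm      : ∀ u v → u ⊕ v ≋ v ⊕ u
    ⊕-identityˡ : ∀ u → 𝟎 ⊕ u ≋ u
    ⊕-inverseˡ  : ∀ u → (⊖ u) ⊕ u ≋ 𝟎

    ⊗-cong     : ∀ {x x′ y y′} → x ≈ x′ → y ≈ y′ → x ⊗ y ≋ x′ ⊗ y′
    ⊗-distribʳ : ∀ x x′ y → (x + x′) ⊗ y ≋ x ⊗ y ⊕ x′ ⊗ y
    ⊗-distribˡ : ∀ x y y′ → x ⊗ (y + y′) ≋ x ⊗ y ⊕ x ⊗ y′
    ⊗-balanced : ∀ r x y → (ι r * x) ⊗ y ≋ x ⊗ (ι r * y)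

  infixr 7 _▷_

  _▷_ : Carrier → Tensor → Tensor
  s ▷ (x ⊗ y) = (s * x) ⊗ y
  s ▷ (u ⊕ v) = s ▷ u ⊕ s ▷ v
  s ▷ (⊖ u)   = ⊖ (s ▷ u)
  s ▷ 𝟎       = 𝟎

  ⊕-abelianGroup : AbelianGroup b (a ⊔ b ⊔ ℓ₂)
  ⊕-abelianGroup = record
    { _≈_ = _≋_
    ; _∙_ = _⊕_
    ; ε = 𝟎
    ; _⁻¹ = ⊖_
    ; isAbelianGroup = record
      { isGroup = record
        { isMonoid = record
          { isSemigroup = record
            { isMagma = record
              { isEquivalence = record { refl = ≋-refl ; sym = ≋-sym ; trans = ≋-trans }
              ; ∙-cong = ⊕-cong
              }
            ; assoc = ⊕-assoc
            }
          ; identity = ⊕-identityˡ , λ u → ≋-trans (⊕-comm _ _) (⊕-identityˡ u)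
          }
        ; inverse = ⊕-inverseˡ , λ u → ≋-trans (⊕-comm _ _) (⊕-inverseˡ u)
        ; ⁻¹-cong = ⊖-cong
        }
      ; comm = ⊕-comm
      }
    }

  private
    module G = AbelianGroup ⊕-abelianGroup
    open AbelianGroupProperties ⊕-abelianGroup
      using (identityʳ-unique; ⁻¹-∙-comm; ε⁻¹≈ε)
    open SetoidReasoning G.setoid

    ▷-congʳ : ∀ s {u v} → u ≋ v → s ▷ u ≋ s ▷ v
    ▷-congʳ s ≋-refl = ≋-refl
    ▷-congʳ s (≋-sym p) = ≋-sym (▷-congʳ s p)
    ▷-congʳ s (≋-trans p q) = ≋-trans (▷-congʳ s p) (▷-congʳ s q)
    ▷-congʳ s (⊕-cong p q) = ⊕-cong (▷-congʳ s p) (▷-congʳ s q)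
    ▷-congʳ s (⊖-cong p) = ⊖-cong (▷-congʳ s p)
    ▷-congʳ s (⊕-assoc u v w) = ⊕-assoc _ _ _
    ▷-congʳ s (⊕-comm u v) = ⊕-comm _ _
    ▷-congʳ s (⊕-identityˡ u) = ⊕-identityˡ _
    ▷-congʳ s (⊕-inverseˡ u) = ⊕-inverseˡ _
    ▷-congʳ s (⊗-cong p q) = ⊗-cong (*-congˡ p) q
    ▷-congʳ s (⊗-distribʳ x x′ y) = ≋-trans (⊗-cong (distribˡ s x x′) refl) (⊗-distribʳ _ _ _)
    ▷-congʳ s (⊗-distribˡ x y y′) = ⊗-distribˡ _ _ _
    ▷-congʳ s (⊗-balanced r x y) = begin
      (s * (ι r * x)) ⊗ y    ≈⟨ ⊗-cong (trans (sym (*-assoc _ _ _)) (trans (*-congʳ (*-comm _ _)) (*-assoc _ _ _))) refl ⟩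
      (ι r * (s * x)) ⊗ y    ≈⟨ ⊗-balanced r (s * x) y ⟩
      (s * x) ⊗ (ι r * y)    ∎

    ▷-congˡ : ∀ {s s′} → s ≈ s′ → ∀ u → s ▷ u ≋ s′ ▷ u
    ▷-congˡ p (x ⊗ y) = ⊗-cong (*-congʳ p) refl
    ▷-congˡ p (u ⊕ v) = ⊕-cong (▷-congˡ p u) (▷-congˡ p v)
    ▷-congˡ p (⊖ u)   = ⊖-cong (▷-congˡ p u)
    ▷-congˡ p 𝟎       = ≋-refl

    0⊗ : ∀ y → 0# ⊗ y ≋ 𝟎
    0⊗ y = identityʳ-unique _ _ (≋-sym (≋-trans (⊗-cong (sym (+-identityˡ 0#)) refl) (⊗-distribʳ 0# 0# y)))

    ▷-zeroˡ : ∀ u → 0# ▷ u ≋ 𝟎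
    ▷-zeroˡ (x ⊗ y) = ≋-trans (⊗-cong (zeroˡ x) refl) (0⊗ y)
    ▷-zeroˡ (u ⊕ v) = ≋-trans (⊕-cong (▷-zeroˡ u) (▷-zeroˡ v)) (⊕-identityˡ 𝟎)
    ▷-zeroˡ (⊖ u)   = ≋-trans (⊖-cong (▷-zeroˡ u)) ε⁻¹≈ε
    ▷-zeroˡ 𝟎       = ≋-refl

    interchange : ∀ u v w z → (u ⊕ v) ⊕ (w ⊕ z) ≋ (u ⊕ w) ⊕ (v ⊕ z)
    interchange u v w z = begin
      (u ⊕ v) ⊕ (w ⊕ z)   ≈⟨ ⊕-assoc u v (w ⊕ z) ⟩
      u ⊕ (v ⊕ (w ⊕ z))   ≈⟨ ⊕-cong ≋-refl (⊕-assoc v w z) ⟨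
      u ⊕ ((v ⊕ w) ⊕ z)   ≈⟨ ⊕-cong ≋-refl (⊕-cong (⊕-comm v w) ≋-refl) ⟩
      u ⊕ ((w ⊕ v) ⊕ z)   ≈⟨ ⊕-cong ≋-refl (⊕-assoc w v z) ⟩
      u ⊕ (w ⊕ (v ⊕ z))   ≈⟨ ⊕-assoc u w (v ⊕ z) ⟨
      (u ⊕ w) ⊕ (v ⊕ z)   ∎

    ▷-distribʳ : ∀ u s s′ → (s + s′) ▷ u ≋ s ▷ u ⊕ s′ ▷ u
    ▷-distribʳ (x ⊗ y) s s′ = ≋-trans (⊗-cong (distribʳ x s s′) refl) (⊗-distribʳ _ _ _)
    ▷-distribʳ (u ⊕ v) s s′ = ≋-trans (⊕-cong (▷-distribʳ u s s′) (▷-distribʳ v s s′)) (interchange _ _ _ _)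
    ▷-distribʳ (⊖ u)   s s′ = ≋-trans (⊖-cong (▷-distribʳ u s s′)) (≋-sym (⁻¹-∙-comm _ _))
    ▷-distribʳ 𝟎       s s′ = ≋-sym (⊕-identityˡ 𝟎)

    ▷-identityˡ : ∀ u → 1# ▷ u ≋ u
    ▷-identityˡ (x ⊗ y) = ⊗-cong (*-identityˡ x) refl
    ▷-identityˡ (u ⊕ v) = ⊕-cong (▷-identityˡ u) (▷-identityˡ v)
    ▷-identityˡ (⊖ u)   = ⊖-cong (▷-identityˡ u)
    ▷-identityˡ 𝟎       = ≋-refl

    ▷-assoc : ∀ s s′ u → (s * s′) ▷ u ≋ s ▷ (s′ ▷ u)
    ▷-assoc s s′ (x ⊗ y) = ⊗-cong (*-assoc s s′ x) refl
    ▷-assoc s s′ (u ⊕ v) = ⊕-cong (▷-assoc s s′ u) (▷-assoc s s′ v)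
    ▷-assoc s s′ (⊖ u)   = ⊖-cong (▷-assoc s s′ u)
    ▷-assoc s s′ 𝟎       = ≋-refl

  leftModule : LeftModule ring b (a ⊔ b ⊔ ℓ₂)
  leftModule = record
    { _≈ᴹ_ = _≋_
    ; _+ᴹ_ = _⊕_
    ; _*ₗ_ = _▷_
    ; 0ᴹ = 𝟎
    ; -ᴹ_ = ⊖_
    ; isLeftModule = record
      { isLeftSemimodule = record
        { +ᴹ-isCommutativeMonoid = G.isCommutativeMonoid
        ; isPreleftSemimodule = record
          { *ₗ-cong = λ {s} {s′} {u} p q → ≋-trans (▷-congˡ p u) (▷-congʳ s′ q)
          ; *ₗ-zeroˡ = ▷-zeroˡ
          ; *ₗ-distribʳ = ▷-distribʳ
          ; *ₗ-identityˡ = ▷-identityˡ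
          ; *ₗ-assoc = ▷-assoc
          ; *ₗ-zeroʳ = λ _ → ≋-refl
          ; *ₗ-distribˡ = λ _ _ _ → ≋-refl
          }
        }
      ; -ᴹ‿cong = ⊖-cong
      ; -ᴹ‿inverse = G.inverse
      }
    }

powerModule : (S : CommutativeRing a ℓ₁) (I : Set b) →
              LeftModule (CommutativeRing.ring S) (a ⊔ b) (b ⊔ ℓ₁)
powerModule S I = record
  { Carrierᴹ = I → Carrier
  ; _≈ᴹ_ = λ f g → ∀ i → f i ≈ g i
  ; _+ᴹ_ = λ f g i → f i + g i
  ; _*ₗ_ = λ s f i → s * f i
  ; 0ᴹ = λ _ → 0#
  ; -ᴹ_ = λ f i → - f i
  ; isLeftModule = record
    { isLeftSemimodule = record
      { +ᴹ-isCommutativeMonoid = record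
        { isMonoid = record
          { isSemigroup = record
            { isMagma = record
              { isEquivalence = record
                { refl = λ _ → refl
                ; sym = λ p i → sym (p i)
                ; trans = λ p q i → trans (p i) (q i)
                }
              ; ∙-cong = λ p q i → +-cong (p i) (q i)
              }
            ; assoc = λ _ _ _ _ → +-assoc _ _ _
            }
          ; identity = (λ _ _ → +-identityˡ _) , (λ _ _ → +-identityʳ _)
          }
        ; comm = λ _ _ _ → +-comm _ _
        }
      ; isPreleftSemimodule = record
        { *ₗ-cong = λ p q i → *-cong p (q i)
        ; *ₗ-zeroˡ = λ _ _ → zeroˡ _
        ; *ₗ-distribʳ = λ _ _ _ _ → distribʳ _ _ _
        ; *ₗ-identityˡ = λ _ _ → *-identityˡ _
        ; *ₗ-assoc = λ _ _ _ _ → *-assoc _ _ _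
        ; *ₗ-zeroʳ = λ _ _ → zeroʳ _
        ; *ₗ-distribˡ = λ _ _ _ _ → distribˡ _ _ _
        }
      }
    ; -ᴹ‿cong = λ p i → -‿cong (p i)
    ; -ᴹ‿inverse = (λ _ _ → -‿inverseˡ _) , (λ _ _ → -‿inverseʳ _)
    }
  }
  where open CommutativeRing S

module _ (S : CommutativeRing a ℓ₁) where
  open CommutativeRing S using (Carrier; _≈_; _*_; 0#; 1#; ring; semiring)
  open Exp semiring using (_^_)

  record IsBasis (M : LeftModule ring m₁ ℓ) {r : ℕ} (v : Fin r → LeftModule.Carrierᴹ M)
                 : Set (a ⊔ ℓ₁ ⊔ m₁ ⊔ ℓ) where
    open LeftModule M
    open Sum +ᴹ-commutativeMonoid using (sum)
    field
      spanning    : ∀ x → ∃ λ (q : Fin r → Carrier) → x ≈ᴹ sum (λ i → q i *ₗ v i)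
      independent : ∀ (q : Fin r → Carrier) → sum (λ i → q i *ₗ v i) ≈ᴹ 0ᴹ → ∀ i → q i ≈ 0#

  -- The (k+1)-st elementary divisor of f with respect to the uniformizer t
  -- is t ^ e k.
  record HasElementaryDivisors
    (t : Carrier) (M : LeftModule ring m₁ ℓ₂) (N : LeftModule ring m₂ ℓ₃)
    (f : LeftModule.Carrierᴹ M → LeftModule.Carrierᴹ N)
    {r : ℕ} (e : Fin r → ℕ) : Set (a ⊔ ℓ₁ ⊔ m₁ ⊔ ℓ₂ ⊔ m₂ ⊔ ℓ₃) where
    open LeftModule N using (_≈ᴹ_; _*ₗ_)
    field
      monotone      : ∀ {k l} → k Fin.≤ l → e k ≤ e l
      source        : Fin r → LeftModule.Carrierᴹ M
      source-basis  : IsBasis M source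
      target        : Fin r → LeftModule.Carrierᴹ N
      target-basis  : IsBasis N target
      unit          : Fin r → Carrier
      unit-inv      : ∀ k → Invertible _≈_ 1# _*_ (unit k)
      diagonal      : ∀ k → f (source k) ≈ᴹ (unit k * t ^ e k) *ₗ target k

-- Nonzeroness is expressed by apartness, so that positive integers are
-- invertible.
CharZero : HeytingField c ℓ₁ ℓ₂ → Set ℓ₂
CharZero K = ∀ n → (suc n · 1#) # 0#
  where
  open HeytingField K using (1#; _#_; 0#; heytingCommutativeRing)
  open CommutativeRing (HeytingCommutativeRing.commutativeRing heytingCommutativeRing) using (semiring)
  open Mult semiring using () renaming (_×_ to _·_)

module _ (R : CommutativeRing c ℓ) where
  open CommutativeRing R
  open Exp semiring using (_^_)

  record IsPrimitiveRoot (N : ℕ) (z : Carrier) : Set ℓ where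
    field
      root      : z ^ N ≈ 1#
      minimal   : ∀ k → 0 < k → k < N → ¬ (z ^ k ≈ 1#)

-- (ℤ/N)*, with irrelevant coprimality proof so that an element is determined
-- by its representative in [0 , N - 1].
record UnitsMod (N : ℕ) : Set where
  field
    rep      : Fin N
    .coprime : Coprime (toℕ rep) N

module Cyclotomic (K : HeytingField c ℓ₁ ℓ₂) {p : ℕ} (p-prime : Prime p) (n : ℕ)
                  (ζ : HeytingField.Carrier K) where

  field-ring : CommutativeRing c ℓ₁
  field-ring = HeytingCommutativeRing.commutativeRing (HeytingField.heytingCommutativeRing K)

  ℤ₍ₚ₎ : CommutativeRing (c ⊔ ℓ₁) ℓ₁
  ℤ₍ₚ₎ = subring field-ring (Localized-isSubring field-ring p-prime)

  T : CommutativeRing (c ⊔ ℓ₁) ℓ₁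
  T = subring field-ring (Adjoin-isSubring field-ring p-prime ζ)

  open CommutativeRing T public using () renaming (Carrier to ∣T∣)
  open CommutativeRing T using (1#; _-_; semiring; ring; rawRing; refl)
  open Exp semiring using (_^_)

  inclusion : CommutativeRing.Carrier ℤ₍ₚ₎ → ∣T∣
  inclusion (x , x∈) = x , base x∈

  inclusion-homo : RingMorphisms.IsRingHomomorphism (CommutativeRing.rawRing ℤ₍ₚ₎) rawRing inclusion
  inclusion-homo = record
    { isSemiringHomomorphism = record
      { isNearSemiringHomomorphism = record
        { +-isMonoidHomomorphism = record
          { isMagmaHomomorphism = record
            { isRelHomomorphism = record { cong = λ p → p }
            ; homo = λ _ _ → CommutativeRing.refl field-ring
            }
          ; ε-homo = CommutativeRing.refl field-ring
          }
        ; *-homo = λ _ _ → CommutativeRing.refl field-ring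
        }
      ; 1#-homo = CommutativeRing.refl field-ring
      }
    ; -‿homo = λ _ → CommutativeRing.refl field-ring
    }

  ζᵀ : ∣T∣
  ζᵀ = ζ , gen

  t : ∣T∣
  t = 1# - ζᵀ

  rank : ℕ
  rank = (p ∸ 1) ℕ.* p ℕ.^ (n ∸ 1)

  module T⊗T = TensorSquare ℤ₍ₚ₎ T inclusion inclusion-homo

  Source : LeftModule ring _ _
  Source = T⊗T.leftModule

  Target : LeftModule ring _ _
  Target = powerModule T (UnitsMod (p ℕ.^ n))

  open LeftModule Source using () renaming (Carrierᴹ to ∣Source∣)
  open LeftModule Target using (_≈ᴹ_) renaming (Carrierᴹ to ∣Target∣)
  open LeftModuleMorphisms (LeftModule.rawLeftModule Source) (LeftModule.rawLeftModule Target)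
    public using (IsLeftModuleHomomorphism; IsLeftModuleMonomorphism)

  -- The conditions pin δ down, since the ζᵏ ⊗ ζˡ generate T ⊗ T.
  record IsDedekindMap (δ : ∣Source∣ → ∣Target∣) : Set (c ⊔ ℓ₁) where
    field
      linear : IsLeftModuleHomomorphism δ
      on-ζ   : ∀ k l → k < rank → l < rank →
               δ ((ζᵀ ^ k) T⊗T.⊗ (ζᵀ ^ l)) ≈ᴹ
               (λ i → ζᵀ ^ (k ℕ.+ toℕ (UnitsMod.rep i) ℕ.* l))

  ElementaryDivisorExponents : (∣Source∣ → ∣Target∣) → (Fin rank → ℕ) → Set (c ⊔ ℓ₁)
  ElementaryDivisorExponents δ e = HasElementaryDivisors T t Source Target δ e

N : ℕ → ℕ → ℕ
N p j = length (filter (λ i → ¬? (p ∣? i)) (upTo (suc j)))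

-- A base-p expansion j = Σ_{s < L} a s * pˢ, where a vanishes from L on.
record IsExpansion (p j L : ℕ) (a : ℕ → ℕ) : Set where
  open Sum ℕ.+-0-commutativeMonoid using (sum)
  field
    digit  : ∀ s → a s < p
    finite : ∀ s → L ≤ s → a s ≡ 0
    value  : j ≡ sum {L} (λ s → a (toℕ s) ℕ.* p ℕ.^ toℕ s)

-- The terms with s ≥ L vanish when a vanishes from L on.
valuation : (p L : ℕ) → (ℕ → ℕ) → ℤ
valuation p L a = -[1+ 0 ] ℤ.+ sum {L} (term ∘ toℕ)
  where
  open Sum ℤ.+-0-commutativeMonoid using (sum)
  term : ℕ → ℤ
  term s = (+ (a s ℕ.* (s ℕ.+ 1)) ℤ.- + (a (suc s) ℕ.* (s ℕ.+ 2))) ℤ.* + (p ℕ.^ s)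

{-# OPTIONS --safe #-}

-- Put t = 1 - ζ, let i₀ < i₁ < … be the positive integers prime to p, and let Θ
-- be multiplication by 1 ⊗ ζ on T ⊗ T. The Newton basis g₀ = 1 ⊗ 1,
-- gₖ₊₁ = (Θ - ζ^iₖ) gₖ is unitriangular over the basis 1 ⊗ ζˡ, and δ sends gₖ to
-- the vector with entry ∏_{l < k} (ζ^iₘ - ζ^iₗ) at iₘ, which vanishes for m < k.
-- As ζʲ - ζⁱ is a unit times t^(p^v) with v = v_p(j - i), the valuation of that
-- entry is governed by the numbers of i < iₖ with i ≡ iₘ mod p^s, and these are
-- smallest for m = k, where they equal ⌊iₖ / p^s⌋. Hence δ gₖ is divisible by
-- t^eₖ with eₖ its valuation at iₖ, the quotients form a triangular basis of the
-- target, and eₖ turns into the asserted digit sum by telescoping.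
--
-- The arithmetic of T rests on Nakayama's lemma over ℤ₍ₚ₎: it makes every 1 + p y a
-- unit, so that T is local with maximal ideal tT, because t^(p^n) ∈ pT. This gives
-- uniqueness of the elementary divisors. It also shows that an integer divisible
-- by t is divisible by p; since p is a unit times t^rank, an infinite descent
-- makes 1, t, …, t^(rank - 1) independent over ℤ₍ₚ₎. Therefore ζ ↦ ζⁱ extends to a
-- well-defined map on T, and δ exists.
module Submission where

open import Defs
open import Algebra.Apartness.Bundles using (HeytingField; HeytingCommutativeRing)
open import Algebra.Bundles using (CommutativeRing; Ring)
open import Algebra.Definitions using (Invertible)
open import Algebra.Module.Bundles using (LeftModule)
import Algebra.Module.Construct.DirectProduct as DirectProduct
import Algebra.Module.Construct.TensorUnit as TensorUnit
open import Algebra.Module.Morphism.Structures using (module LeftModuleMorphisms)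
import Algebra.Properties.AbelianGroup as AbelianGroupProperties
import Algebra.Properties.CommutativeMonoid.Sum as Sum
import Algebra.Properties.CommutativeSemiring.Binomial as Binomial
import Algebra.Properties.Ring as RingProperties
import Algebra.Properties.Semiring.Exp as Exp
import Algebra.Properties.Semiring.Mult as Mult
import Algebra.Properties.Semiring.Mult.TCOptimised as TCMult
import Algebra.Properties.Semiring.Sum as SemiringSum
import Algebra.Solver.CommutativeMonoid as MonoidSolver
import Algebra.Solver.Ring as RingSolver
open import Algebra.Solver.Ring.AlmostCommutativeRing using (fromCommutativeRing; _-Raw-AlmostCommutative⟶_)
open import Data.Bool.Base using (if_then_else_)
open import Data.Empty using (⊥-elim; ⊥-elim-irr)
open import Data.Fin.Base as Fin using (Fin; zero; suc; toℕ; inject₁; fromℕ; fromℕ<; punchIn; lower₁)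
import Data.Fin.Properties as Fin
open import Data.Integer.Base as ℤ using (ℤ; +_; -[1+_]; ∣_∣)
import Data.Integer.DivMod as ℤ
import Data.Integer.Divisibility.Signed as ℤ
import Data.Integer.Properties as ℤ
open import Data.Integer.Tactic.RingSolver using (solve-∀)
open import Data.List.Base using (length; filter; upTo; [_]; _++_)
import Data.List.Properties as List
open import Data.Maybe.Base using (Maybe; just; nothing)
open import Data.Nat.Base as ℕ using (ℕ; zero; suc; z≤n; s≤s; _∸_)
open import Data.Nat.Combinatorics using (_C_; nCn≡1; nC1≡n; nCk+nC[k+1]≡[n+1]C[k+1])
open import Data.Nat.Coprimality using (Coprime; coprime-Bézout; coprime-divisor)
open import Data.Nat.Divisibility as ℕ using (divides; ∣⇒≤; _∤_)
open import Data.Nat.GCD using (module Bézout)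
open import Data.Nat.Primality using (Prime; euclidsLemma; ¬prime[0]; ¬prime[1]; prime⇒irreducible)
import Data.Nat.Properties as ℕ
open import Data.Product.Base using (∃; _,_; _×_; proj₁; proj₂; ∃₂; Σ)
open import Data.Sum.Base using (inj₁; inj₂; _⊎_)
open import Data.Vec.Functional using (insertAt)
open import Data.Vec.Functional.Properties using (insertAt-lookup; insertAt-punchIn)
open import Function.Base using (_∘_)
open import Level using (Level; _⊔_)
open import Relation.Binary.Definitions using (tri<; tri≈; tri>)
open import Relation.Binary.PropositionalEquality as ≡ using (_≡_; _≢_)
import Relation.Binary.Reasoning.Setoid as SetoidReasoning
open import Relation.Nullary using (¬_; yes; no; does; ¬?)
open import Relation.Nullary.Decidable using (dec-true; dec-false)
open import Relation.Unary using (Pred)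

-- Equality in K need not be decidable, and T is given by derivations of membership, so inverses and
-- conjugates cannot be read off in K. An inverse found in K must still be shown to lie in T, which
-- is why Nakayama enters. Case distinctions in T go through the residue of an element, a natural
-- number modulo p. A conjugate is at first only a relation, the graph spanned by the pairs (ζ^l,
-- ξ^l), and its single-valuedness is what the independence is needed for. That independence, in
-- effect the irreducibility of the cyclotomic polynomial, is thus a result and not an input. The
-- combinatorics rests on writing p^v as 1 plus the sum of p^s - p^(s - 1) over 1 ≤ s ≤ v. Summed
-- over all i < iₖ, this turns the exponent into k plus the sum over s ≥ 1 of (p^s - p^(s - 1)) ⌊iₖ
-- / p^s⌋. Minimality at m = k is the superadditivity of floors, and k + 1 = j - ⌊j / p⌋ for j = iₖ
-- is the origin of the constant -1 in the formula.

private
  variable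
    ℓ ℓ₁ ℓ₂ ℓ₃ ℓᵃ ℓᵇ ℓᶜ m₁ m₂ : Level

-- Divisibility and powers of 1 - x in commutative rings

-- The absorption identity, by Pascal's rule. At n + 1 = p it shows that p divides k + 1 times the
-- binomial coefficient, and p cannot divide k + 1 < p.
k*nCk : ∀ n k → suc k ℕ.* (suc n C suc k) ≡ suc n ℕ.* (n C k)
k*nCk zero    zero    = ≡.refl
k*nCk zero    (suc k) = ℕ.*-zeroʳ (suc (suc k))
k*nCk (suc n) zero    = ≡.trans (ℕ.+-identityʳ _) (≡.trans (nC1≡n (2 ℕ.+ n)) (≡.sym (ℕ.*-identityʳ (2 ℕ.+ n))))
k*nCk (suc n) (suc k) = begin
  suc (suc k) ℕ.* (suc (suc n) C suc (suc k))
    ≡⟨ ≡.cong (suc (suc k) ℕ.*_) (nCk+nC[k+1]≡[n+1]C[k+1] (suc n) (suc k)) ⟨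
  suc (suc k) ℕ.* (A ℕ.+ B)
    ≡⟨ ℕ.*-distribˡ-+ (suc (suc k)) A B ⟩
  A ℕ.+ suc k ℕ.* A ℕ.+ suc (suc k) ℕ.* B
    ≡⟨ ≡.cong₂ (λ x y → A ℕ.+ x ℕ.+ y) (k*nCk n k) (k*nCk n (suc k)) ⟩
  A ℕ.+ suc n ℕ.* (n C k) ℕ.+ suc n ℕ.* (n C suc k)
    ≡⟨ ℕ.+-assoc A _ _ ⟩
  A ℕ.+ (suc n ℕ.* (n C k) ℕ.+ suc n ℕ.* (n C suc k))
    ≡⟨ ≡.cong (A ℕ.+_) (ℕ.*-distribˡ-+ (suc n) (n C k) (n C suc k)) ⟨
  A ℕ.+ suc n ℕ.* (n C k ℕ.+ n C suc k)
    ≡⟨ ≡.cong (λ x → A ℕ.+ suc n ℕ.* x) (nCk+nC[k+1]≡[n+1]C[k+1] n k) ⟩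
  suc (suc n) ℕ.* A ∎
  where
  open ≡.≡-Reasoning
  A = suc n C suc k
  B = suc n C suc (suc k)

p∣pCk : ∀ {p} → Prime p → ∀ k → suc k ℕ.< p → p ℕ.∣ (p C suc k)
p∣pCk {suc n} p-prime k k<p with euclidsLemma (suc k) (suc n C suc k) p-prime
                                  (divides (n C k) (≡.trans (k*nCk n k) (ℕ.*-comm (suc n) (n C k))))
... | inj₁ p∣k = ⊥-elim (ℕ.<⇒≱ k<p (∣⇒≤ p∣k))
... | inj₂ p∣C = p∣C

module IntegerSolver (R : CommutativeRing ℓᶜ ℓ) where
  open CommutativeRing R hiding (zero)
  open TCMult semiring using () renaming (_×_ to _×′_; ×ᵤ≈× to ×ᵤ≈×)
  open IntegerMultiples R

  private
    -- Optimised multiples let the coefficients 0 and 1 evaluate to `0#` and `1#` themselves, where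
    -- `fromℤ` yields `1# + 0#`. The homomorphism laws are carried over from `fromℤ`.
    coefficient : ℤ → Carrier
    coefficient (+ n)    = n ×′ 1#
    coefficient -[1+ n ] = - (suc n ×′ 1#)

    fromℤ≈ : ∀ i → fromℤ i ≈ coefficient i
    fromℤ≈ (+ n)    = ×ᵤ≈× n 1#
    fromℤ≈ -[1+ n ] = -‿cong (×ᵤ≈× (suc n) 1#)

    morphism : CommutativeRing.rawRing ℤ.+-*-commutativeRing -Raw-AlmostCommutative⟶ fromCommutativeRing R
    morphism = record
      { ⟦_⟧    = coefficient
      ; +-homo = λ i j → trans (sym (fromℤ≈ (i ℤ.+ j))) (trans (fromℤ-+ i j) (+-cong (fromℤ≈ i) (fromℤ≈ j)))
      ; *-homo = λ i j → trans (sym (fromℤ≈ (i ℤ.* j))) (trans (fromℤ-* i j) (*-cong (fromℤ≈ i) (fromℤ≈ j)))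
      ; -‿homo = λ i → trans (sym (fromℤ≈ (ℤ.- i))) (trans (fromℤ-neg i) (-‿cong (fromℤ≈ i)))
      ; 0-homo = refl
      ; 1-homo = refl
      }

    fromℤ-≟ : ∀ i j → Maybe (coefficient i ≈ coefficient j)
    fromℤ-≟ i j with i ℤ.≟ j
    ... | yes ≡.refl = just refl
    ... | no _       = nothing

  open RingSolver (CommutativeRing.rawRing ℤ.+-*-commutativeRing) (fromCommutativeRing R) morphism
    fromℤ-≟ public using (solve; _:=_; _:+_; _:*_; _:-_; :-_; con; Polynomial)

  :0 :1 : ∀ {n} → Polynomial n
  :0 = con (+ 0)
  :1 = con (+ 1)

module RingLemmas (R : CommutativeRing ℓᶜ ℓ) where
  open CommutativeRing R hiding (zero)
  open Exp semiring
  open Mult semiring using (×-assoc-*; ×-assocˡ; ×-congʳ; ×-congˡ) renaming (_×_ to _·_)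
  open SemiringSum semiring using (sum; sum-init-last)
  open IntegerSolver R
  open SetoidReasoning setoid
  private module *-Solver = MonoidSolver *-commutativeMonoid
  open *-Solver using (_⊕_; _⊜_)

  infix 4 _∣_

  _∣_ : Carrier → Carrier → Set (ℓᶜ ⊔ ℓ)
  x ∣ y = ∃ λ z → y ≈ x * z

  Unit : Carrier → Set (ℓᶜ ⊔ ℓ)
  Unit = Invertible _≈_ 1# _*_

  unit : ∀ {x} y → x * y ≈ 1# → Unit x
  unit y xy≈1 = y , trans (*-comm y _) xy≈1 , xy≈1

  ∣-resp : ∀ {x x′ y y′} → x ≈ x′ → y ≈ y′ → x ∣ y → x′ ∣ y′
  ∣-resp x≈x′ y≈y′ (z , p) = z , trans (sym y≈y′) (trans p (*-congʳ x≈x′))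

  ∣-trans : ∀ {x y z} → x ∣ y → y ∣ z → x ∣ z
  ∣-trans {x} {y} {z} (a , p) (b , q) = a * b , (begin
    z            ≈⟨ q ⟩
    y * b        ≈⟨ *-congʳ p ⟩
    (x * a) * b  ≈⟨ *-assoc x a b ⟩
    x * (a * b)  ∎)

  ∣-+ : ∀ {x y z} → x ∣ y → x ∣ z → x ∣ (y + z)
  ∣-+ (a , p) (b , q) = a + b , trans (+-cong p q) (sym (distribˡ _ _ _))

  ∣-*ʳ : ∀ {x y} z → x ∣ y → x ∣ (y * z)
  ∣-*ʳ z (a , p) = a * z , trans (*-congʳ p) (*-assoc _ _ _)

  ∣-*ˡ : ∀ {x y} z → x ∣ y → x ∣ (z * y)
  ∣-*ˡ z x∣y = ∣-resp refl (*-comm _ z) (∣-*ʳ z x∣y)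

  ∣-- : ∀ {x y z} → x ∣ y → x ∣ z → x ∣ (y - z)
  ∣-- {x} {y} {z} (a , p) (b , q) = a - b , (begin
    y - z          ≈⟨ +-cong p (-‿cong q) ⟩
    x * a - x * b  ≈⟨ solve 3 (λ x a b → x :* a :- x :* b := x :* (a :- b)) refl x a b ⟩
    x * (a - b)    ∎)

  ∣0 : ∀ {x} → x ∣ 0#
  ∣0 = 0# , sym (zeroʳ _)

  unit-resp : ∀ {x y} → x ≈ y → Unit x → Unit y
  unit-resp x≈y (z , p , q) = z , trans (*-congˡ (sym x≈y)) p , trans (*-congʳ (sym x≈y)) q

  unit-* : ∀ {x y} → Unit x → Unit y → Unit (x * y)
  unit-* {x} {y} (x′ , _ , p) (y′ , _ , q) = unit (x′ * y′) (begin
    (x * y) * (x′ * y′)  ≈⟨ solve 4 (λ x y z w → (x :* y) :* (z :* w) := (x :* z) :* (y :* w)) refl x y x′ y′ ⟩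
    (x * x′) * (y * y′)  ≈⟨ *-cong p q ⟩
    1# * 1#              ≈⟨ *-identityˡ 1# ⟩
    1#                   ∎)

  unit-1 : Unit 1#
  unit-1 = unit 1# (*-identityˡ 1#)

  unit-neg : ∀ {x} → Unit x → Unit (- x)
  unit-neg {x} (y , _ , p) = unit (- y) (trans (solve 2 (λ x y → :- x :* :- y := x :* y) refl x y) p)

  unit-⁻¹ : ∀ {x} ((y , _) : Unit x) → Unit y
  unit-⁻¹ {x} (y , p , q) = x , q , p

  ∣-unit : ∀ {x y} → x ∣ y → Unit y → Unit x
  ∣-unit {x} {y} (a , p) (z , _ , q) = unit (a * z) (begin
    x * (a * z)  ≈⟨ *-assoc x a z ⟨
    (x * a) * z  ≈⟨ *-congʳ p ⟨
    y * z        ≈⟨ q ⟩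
    1#           ∎)

  unit-^ : ∀ {x} k → Unit x → Unit (x ^ k)
  unit-^ zero    u = unit-1
  unit-^ (suc k) u = unit-* u (unit-^ k u)

  unit-cancelˡ : ∀ {x} y → Unit x → x * y ≈ 0# → y ≈ 0#
  unit-cancelˡ {x} y (z , p , _) xy≈0 = begin
    y            ≈⟨ *-identityˡ y ⟨
    1# * y       ≈⟨ *-congʳ p ⟨
    (z * x) * y  ≈⟨ *-assoc z x y ⟩
    z * (x * y)  ≈⟨ *-congˡ xy≈0 ⟩
    z * 0#       ≈⟨ zeroʳ z ⟩
    0#           ∎

  x-y≈0⇒x≈y : ∀ {x y} → x - y ≈ 0# → x ≈ y
  x-y≈0⇒x≈y {x} {y} p = begin
    x            ≈⟨ solve 2 (λ x y → x := (x :- y) :+ y) refl x y ⟩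
    (x - y) + y  ≈⟨ +-congʳ p ⟩
    0# + y       ≈⟨ +-identityˡ y ⟩
    y            ∎

  x≈y⇒x-y≈0 : ∀ {x y} → x ≈ y → x - y ≈ 0#
  x≈y⇒x-y≈0 {x} {y} p = trans (+-congʳ p) (-‿inverseʳ y)

  ^-1 : ∀ k → 1# ^ k ≈ 1#
  ^-1 zero    = refl
  ^-1 (suc k) = trans (*-identityˡ _) (^-1 k)

  *-^ : ∀ x y k → (x * y) ^ k ≈ x ^ k * y ^ k
  *-^ x y zero    = sym (*-identityˡ 1#)
  *-^ x y (suc k) = trans (*-congˡ (*-^ x y k))
    (solve 4 (λ x y z w → (x :* y) :* (z :* w) := (x :* z) :* (y :* w)) refl x y (x ^ k) (y ^ k))

  geometric : Carrier → ℕ → Carrier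
  geometric x zero    = 0#
  geometric x (suc k) = 1# + x * geometric x k

  geometric-factor : ∀ x k → 1# - x ^ k ≈ (1# - x) * geometric x k
  geometric-factor x zero    = trans (-‿inverseʳ 1#) (sym (zeroʳ _))
  geometric-factor x (suc k) = begin
    1# - x * x ^ k
      ≈⟨ solve 2 (λ x y → :1 :- x :* y := (:1 :- x) :+ x :* (:1 :- y)) refl x (x ^ k) ⟩
    (1# - x) + x * (1# - x ^ k)
      ≈⟨ +-congˡ (*-congˡ (geometric-factor x k)) ⟩
    (1# - x) + x * ((1# - x) * geometric x k)
      ≈⟨ solve 2 (λ x g → (:1 :- x) :+ x :* ((:1 :- x) :* g) := (:1 :- x) :* (:1 :+ x :* g)) refl x (geometric x k) ⟩
    (1# - x) * (1# + x * geometric x k) ∎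

  1-x∣1-x^k : ∀ x k → 1# - x ∣ 1# - x ^ k
  1-x∣1-x^k x k = geometric x k , geometric-factor x k

  -- All k powers in the sum are 1 modulo 1 - x. So the sum is a unit whenever k is one and 1 - x
  -- lies in the maximal ideal.
  geometric-residue : ∀ x k → 1# - x ∣ k · 1# - geometric x k
  geometric-residue x zero    = ∣-resp refl (sym (-‿inverseʳ 0#)) ∣0
  geometric-residue x (suc k) with geometric-residue x k
  ... | z , p = z + geometric x k , (begin
    (1# + k · 1#) - (1# + x * g)
      ≈⟨ solve 3 (λ x k g → (:1 :+ k) :- (:1 :+ x :* g) := (k :- g) :+ (:1 :- x) :* g) refl x (k · 1#) g ⟩
    (k · 1# - g) + (1# - x) * g
      ≈⟨ +-congʳ p ⟩
    (1# - x) * z + (1# - x) * g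
      ≈⟨ distribˡ _ _ _ ⟨
    (1# - x) * (z + g) ∎)
    where g = geometric x k

  sum-∣ : ∀ {n x} (f : Fin n → Carrier) → (∀ i → x ∣ f i) → x ∣ sum f
  sum-∣ {zero}  f x∣f = ∣0
  sum-∣ {suc n} f x∣f = ∣-+ (x∣f zero) (sum-∣ (f ∘ suc) (x∣f ∘ suc))

  ·-lift : ∀ n z → n · z ≈ (n · 1#) * z
  ·-lift n z = sym (trans (×-assoc-* n 1# z) (×-congʳ n (*-identityˡ z)))

  private
    middle-term : ∀ p b x y j m → (b ℕ.* p) · (x ^ (2 ℕ.+ j) * y ^ suc m)
                                 ≈ ((p · 1#) * ((x * y) * x)) * (b · (x ^ j * y ^ m))
    middle-term p b x y j m = begin
      (b ℕ.* p) · (x ^ (2 ℕ.+ j) * y ^ suc m)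
        ≈⟨ ×-assocˡ _ b p ⟨
      b · (p · (x ^ (2 ℕ.+ j) * y ^ suc m))
        ≈⟨ ·-lift b _ ⟩
      (b · 1#) * (p · (x ^ (2 ℕ.+ j) * y ^ suc m))
        ≈⟨ *-congˡ (·-lift p _) ⟩
      (b · 1#) * ((p · 1#) * ((x * (x * x ^ j)) * (y * y ^ m)))
        ≈⟨ *-Solver.solve 6 (λ p b x y z w → b ⊕ (p ⊕ ((x ⊕ (x ⊕ z)) ⊕ (y ⊕ w)))
                                          ⊜ (p ⊕ ((x ⊕ y) ⊕ x)) ⊕ (b ⊕ (z ⊕ w)))
             refl (p · 1#) (b · 1#) x y (x ^ j) (y ^ m) ⟩
      ((p · 1#) * ((x * y) * x)) * ((b · 1#) * (x ^ j * y ^ m))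
        ≈⟨ *-congˡ (·-lift b _) ⟨
      ((p · 1#) * ((x * y) * x)) * (b · (x ^ j * y ^ m)) ∎

    second-term : ∀ p x y m → p · ((x * 1#) * y ^ m) ≈ (p · 1#) * (x * y ^ m)
    second-term p x y m = trans (·-lift p _) (*-congˡ (*-congʳ (*-identityʳ x)))

    collect : ∀ a b P x y w z → b + (P * (x * (y * w)) + ((P * ((x * y) * x)) * z + a))
                              ≈ (a + b) + P * ((x * y) * (w + x * z))
    collect a b P x y w z = begin
      b + (P * (x * (y * w)) + ((P * ((x * y) * x)) * z + a))
        ≈⟨ +-congˡ (+-congʳ (*-congˡ (sym (*-assoc x y w)))) ⟩
      b + (P * ((x * y) * w) + ((P * ((x * y) * x)) * z + a))
        ≈⟨ solve 4 (λ a b c d → b :+ (c :+ (d :+ a)) := (a :+ b) :+ (c :+ d)) refl a b _ _ ⟩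
      (a + b) + (P * ((x * y) * w) + (P * ((x * y) * x)) * z)
        ≈⟨ +-congˡ (solve 5 (λ p u w x z → p :* (u :* w) :+ (p :* (u :* x)) :* z := p :* (u :* (w :+ x :* z)))
             refl P (x * y) w x z) ⟩
      (a + b) + P * ((x * y) * (w + x * z)) ∎

  -- Every mixed binomial term is divisible by p x y, and all but p x y^(p - 1) carry a further
  -- factor x. Splitting that term off shows the cofactor of p x y to be y^(p - 2) modulo x, so it
  -- is a unit when y is a unit and x lies in the maximal ideal.
  prime-power-+ : ∀ {p} → Prime p → ∀ x y → ∃ λ z →
    (x + y) ^ p ≈ (x ^ p + y ^ p) + (p · 1#) * ((x * y) * (y ^ (p ∸ 2) + x * z))
  prime-power-+ {zero}         p-prime = ⊥-elim (¬prime[0] p-prime)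
  prime-power-+ {suc zero}     p-prime = ⊥-elim (¬prime[1] p-prime)
  prime-power-+ {p@(suc (suc q))} p-prime x y = z , (begin
    (x + y) ^ p
      ≈⟨ Binomial.theorem commutativeSemiring p x y ⟩
    term zero + (term (suc zero) + sum (λ k → term (suc (suc k))))
      ≈⟨ +-congˡ (+-congˡ (sum-init-last (λ k → term (suc (suc k))))) ⟩
    term zero + (term (suc zero) + (sum middle + term (suc (suc (fromℕ q)))))
      ≈⟨ +-cong first (+-cong second (+-cong (proj₂ middle-sum) last)) ⟩
    y ^ p + ((p · 1#) * (x * (y * y ^ q)) + (((p · 1#) * ((x * y) * x)) * z + x ^ p))
      ≈⟨ collect (x ^ p) (y ^ p) (p · 1#) x y (y ^ q) z ⟩
    (x ^ p + y ^ p) + (p · 1#) * ((x * y) * (y ^ q + x * z)) ∎)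
    where
    term : Fin (suc p) → Carrier
    term = Binomial.binomialTerm commutativeSemiring x y p

    middle : Fin q → Carrier
    middle k = term (suc (suc (inject₁ k)))

    middle-∣ : ∀ k → (p · 1#) * ((x * y) * x) ∣ middle k
    middle-∣ k with p∣pCk p-prime (suc (toℕ (inject₁ k)))
                     (s≤s (s≤s (≡.subst (ℕ._< q) (≡.sym (Fin.toℕ-inject₁ k)) (Fin.toℕ<n k))))
    ... | divides b C≡bp = b · (x ^ j * y ^ (q ∸ suc j)) , (begin
        (p C (2 ℕ.+ j)) · (x ^ (2 ℕ.+ j) * y ^ (q ∸ j))
          ≡⟨ ≡.cong₂ (λ n m → n · (x ^ (2 ℕ.+ j) * y ^ m)) C≡bp q∸j ⟩
        (b ℕ.* p) · (x ^ (2 ℕ.+ j) * y ^ suc (q ∸ suc j))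
          ≈⟨ middle-term p b x y j (q ∸ suc j) ⟩
        ((p · 1#) * ((x * y) * x)) * (b · (x ^ j * y ^ (q ∸ suc j))) ∎)
      where
      j = toℕ (inject₁ k)
      q∸j : q ∸ j ≡ suc (q ∸ suc j)
      q∸j = ℕ.+-∸-assoc 1 (≡.subst (ℕ._< q) (≡.sym (Fin.toℕ-inject₁ k)) (Fin.toℕ<n k))

    middle-sum = sum-∣ middle middle-∣
    z = proj₁ middle-sum

    first : term zero ≈ y ^ p
    first = trans (+-identityʳ _) (*-identityˡ _)

    second : term (suc zero) ≈ (p · 1#) * (x * (y * y ^ q))
    second = trans (×-congˡ (nC1≡n p)) (second-term p x y (suc q))

    last : term (suc (suc (fromℕ q))) ≈ x ^ p
    last = begin
      (p C (2 ℕ.+ toℕ (fromℕ q))) · (x ^ (2 ℕ.+ toℕ (fromℕ q)) * y ^ (q ∸ toℕ (fromℕ q)))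
        ≡⟨ ≡.cong (λ k → (p C (2 ℕ.+ k)) · (x ^ (2 ℕ.+ k) * y ^ (q ∸ k))) (Fin.toℕ-fromℕ q) ⟩
      (p C p) · (x ^ p * y ^ (q ∸ q))
        ≡⟨ ≡.cong₂ (λ k m → k · (x ^ p * y ^ m)) (nCn≡1 p) (ℕ.n∸n≡0 q) ⟩
      x ^ p * 1# + 0#
        ≈⟨ trans (+-identityʳ _) (*-identityʳ _) ⟩
      x ^ p ∎

  ^-regular : ∀ {x} → (∀ y → x * y ≈ 0# → y ≈ 0#) → ∀ k y → x ^ k * y ≈ 0# → y ≈ 0#
  ^-regular x-regular zero    y y≈0   = trans (sym (*-identityˡ y)) y≈0
  ^-regular {x} x-regular (suc k) y xy≈0 =
    ^-regular x-regular k y (x-regular _ (trans (sym (*-assoc x (x ^ k) y)) xy≈0))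

  ^-∣-^ : ∀ {x k l} → k ℕ.≤ l → x ^ k ∣ x ^ l
  ^-∣-^ {x} {k} {l} k≤l = x ^ (l ∸ k) , trans (^-congʳ x (≡.sym (ℕ.m+[n∸m]≡n k≤l))) (^-homo-* x k (l ∸ k))

  ∣-*-cong : ∀ {x y} z → x ∣ y → z * x ∣ z * y
  ∣-*-cong {x} {y} z (a , p) = a , trans (*-congˡ p) (sym (*-assoc z x a))

  ∣-prime-^ : ∀ {p} → Prime p → ∀ {x y} → x ∣ y → x ∣ y ^ p
  ∣-prime-^ {zero}  p-prime x∣y = ⊥-elim (¬prime[0] p-prime)
  ∣-prime-^ {suc p} p-prime x∣y = ∣-*ʳ _ x∣y

  -- The factor 1 - x next to p matters for p = 2: it makes (1 - x)^(p^v) and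
  -- 1 - x^(p^v) associated as soon as the latter divides p.
  1-x^prime-power : ∀ {p} → Prime p → ∀ x v →
    (p · 1#) * (1# - x) ∣ (1# - x) ^ (p ℕ.^ v) - (1# - x ^ (p ℕ.^ v))
  1-x^prime-power {p} p-prime x zero = ∣-resp refl
    (sym (x≈y⇒x-y≈0 (trans (*-identityʳ _) (+-congˡ (-‿cong (sym (*-identityʳ x))))))) ∣0
  1-x^prime-power {p} p-prime x (suc v) = ∣-resp refl step (∣-+ D∣₁ D∣₂)
    where
    P = p · 1#
    D = P * (1# - x)
    y = x ^ (p ℕ.^ v)
    A = 1# - y
    previous = 1-x^prime-power p-prime x v
    -- By induction D divides B, and (1 - x)^(p^v) is A + B, while A + y is 1. Expanding both pth
    -- powers cancels A^p and leaves B^p and terms p A (⋯), in which B or A supplies the factor 1 -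
    -- x.
    B = (1# - x) ^ (p ℕ.^ v) - A
    A+B = prime-power-+ p-prime A B
    A+y = prime-power-+ p-prime A y

    D∣₁ : D ∣ B ^ p + P * ((A * B) * (B ^ (p ∸ 2) + A * proj₁ A+B))
    D∣₁ = ∣-+ (∣-prime-^ p-prime previous) (∣-*ˡ P (∣-*ʳ _ (∣-*ˡ A previous)))

    D∣₂ : D ∣ - (P * ((A * y) * (y ^ (p ∸ 2) + A * proj₁ A+y)))
    D∣₂ = ∣-resp refl (+-identityˡ _) (∣-- ∣0 (∣-*-cong P (∣-*ʳ _ (∣-*ʳ y (1-x∣1-x^k x (p ℕ.^ v))))))

    power-suc : ∀ z → z ^ (p ℕ.^ suc v) ≈ (z ^ (p ℕ.^ v)) ^ p
    power-suc z = trans (^-congʳ z (ℕ.*-comm p (p ℕ.^ v))) (sym (^-assocʳ z (p ℕ.^ v) p))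

    step : (B ^ p + P * ((A * B) * (B ^ (p ∸ 2) + A * proj₁ A+B)))
           + - (P * ((A * y) * (y ^ (p ∸ 2) + A * proj₁ A+y)))
         ≈ (1# - x) ^ (p ℕ.^ suc v) - (1# - x ^ (p ℕ.^ suc v))
    step = begin
      (B ^ p + V) + - W
        ≈⟨ solve 5 (λ a b v w z → (b :+ v) :+ :- w := ((a :+ b) :+ v) :- (((a :+ z) :+ w) :- z))
             refl (A ^ p) (B ^ p) V W (y ^ p) ⟩
      ((A ^ p + B ^ p) + V) - (((A ^ p + y ^ p) + W) - y ^ p)
        ≈⟨ +-cong (proj₂ A+B) (-‿cong (+-congʳ (proj₂ A+y))) ⟨
      (A + B) ^ p - ((A + y) ^ p - y ^ p)
        ≈⟨ +-cong (^-congˡ p (solve 2 (λ a b → a :+ (b :- a) := b) refl A _))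
             (-‿cong (+-cong (trans (^-congˡ p (solve 1 (λ y → (:1 :- y) :+ y := :1) refl y)) (^-1 p))
                             (-‿cong (sym (power-suc x))))) ⟩
      ((1# - x) ^ (p ℕ.^ v)) ^ p - (1# - x ^ (p ℕ.^ suc v))
        ≈⟨ +-congʳ (power-suc (1# - x)) ⟨
      (1# - x) ^ (p ℕ.^ suc v) - (1# - x ^ (p ℕ.^ suc v)) ∎
      where
      V = P * ((A * B) * (B ^ (p ∸ 2) + A * proj₁ A+B))
      W = P * ((A * y) * (y ^ (p ∸ 2) + A * proj₁ A+y))

-- The uniformizer 1 - ζ

-- Ends the infinite descent: a nonzero integer of absolute value k is not divisible by p^k.
k<p^k : ∀ {p} → Prime p → ∀ k → k ℕ.< p ℕ.^ k
k<p^k {zero}        p-prime k       = ⊥-elim (¬prime[0] p-prime)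
k<p^k {suc zero}    p-prime k       = ⊥-elim (¬prime[1] p-prime)
k<p^k {suc (suc q)} p-prime zero    = s≤s z≤n
k<p^k {suc (suc q)} p-prime (suc k) = begin
  2 ℕ.+ k                 ≡⟨ ℕ.+-comm 2 k ⟩
  k ℕ.+ 2                 ≤⟨ ℕ.+-monoʳ-≤ k (s≤s (s≤s z≤n)) ⟩
  k ℕ.+ (2 ℕ.+ k)         ≡⟨ ℕ.+-suc k (suc k) ⟩
  suc k ℕ.+ suc k         ≤⟨ ℕ.+-mono-≤ (k<p^k p-prime k) (k<p^k p-prime k) ⟩
  r ℕ.+ r                 ≤⟨ ℕ.+-monoʳ-≤ r (ℕ.m≤m+n r (q ℕ.* r)) ⟩
  (2 ℕ.+ q) ℕ.* r         ∎
  where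
  open ℕ.≤-Reasoning
  r = suc (suc q) ℕ.^ k

module _ (S : CommutativeRing ℓᶜ ℓ) where
  open CommutativeRing S hiding (zero)
  open Exp semiring
  open Mult semiring using () renaming (_×_ to _·_)
  open RingLemmas S

  -- Throughout n = m + 1. The pth root of unity `y` and `s = 1 - y` link p to t: up to units, p is
  -- s^(p - 1) and s is t^(p^m).
  module Uniformizer
    (1≉0 : ¬ (1# ≈ 0#))
    {p : ℕ} (p-prime : Prime p) (m : ℕ) (ζ : Carrier) (ζ-root : ζ ^ (p ℕ.^ suc m) ≈ 1#)
    (1-ζ^pᵐ-regular : ∀ x → (1# - ζ ^ (p ℕ.^ m)) * x ≈ 0# → x ≈ 0#)
    (1+py-unit : ∀ y → Unit (1# + (p · 1#) * y))
    (prime-to-p-unit : ∀ k → p ∤ k → Unit (k · 1#))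
    (residue : ∀ x → ∃ λ k → (1# - ζ) ∣ (x - k · 1#))
    where

    open SemiringSum semiring using (sum; sum-cong-≋; *-distribˡ-sum)
    open IntegerMultiples S using (fromℤ; fromℤ-*)
    open IntegerSolver S
    open SetoidReasoning setoid

    private
      pⁿ = p ℕ.^ suc m
      P = p · 1#
      t = 1# - ζ
      y = ζ ^ (p ℕ.^ m)
      s = 1# - y

    rank : ℕ
    rank = (p ∸ 1) ℕ.* p ℕ.^ m

    t-regular : ∀ x → t * x ≈ 0# → x ≈ 0#
    t-regular x tx≈0 with 1-x∣1-x^k ζ (p ℕ.^ m)
    ... | g , s≈tg = 1-ζ^pᵐ-regular x (begin
      s * x        ≈⟨ *-congʳ s≈tg ⟩
      (t * g) * x  ≈⟨ solve 3 (λ t g x → (t :* g) :* x := g :* (t :* x)) refl t g x ⟩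
      g * (t * x)  ≈⟨ *-congˡ tx≈0 ⟩
      g * 0#       ≈⟨ zeroʳ g ⟩
      0#           ∎)

    -- At v = n the term 1 - ζ^(p^n) of `1-x^prime-power` vanishes, so t^(p^n) itself is a multiple
    -- of p t.
    P∣t^N : P ∣ t ^ pⁿ
    P∣t^N = ∣-trans (t , refl) (∣-resp refl (begin
      t ^ pⁿ - (1# - ζ ^ (p ℕ.^ suc m))
        ≈⟨ +-congˡ (-‿cong (+-congˡ (-‿cong ζ-root))) ⟩
      t ^ pⁿ - (1# - 1#)
        ≈⟨ solve 1 (λ x → x :- (:1 :- :1) := x) refl _ ⟩
      t ^ pⁿ ∎) (1-x^prime-power p-prime ζ (suc m)))

    -- 1 + t z divides 1 - (- t z)^(p^n), which is 1 plus a multiple of p.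
    1+tz-unit : ∀ z → Unit (1# + t * z)
    1+tz-unit z = ∣-unit
      (∣-resp (solve 2 (λ t z → :1 :- t :* (:- z) := :1 :+ t :* z) refl t z) refl
        (1-x∣1-x^k (t * - z) (p ℕ.^ suc m)))
      (unit-resp (begin
        1# + P * - (g * w)     ≈⟨ solve 3 (λ p g w → :1 :+ p :* (:- (g :* w)) := :1 :- (p :* g) :* w) refl P g w ⟩
        1# - (P * g) * w       ≈⟨ +-congˡ (-‿cong (*-congʳ (proj₂ P∣t^N))) ⟨
        1# - t ^ pⁿ * w         ≈⟨ +-congˡ (-‿cong (*-^ t (- z) pⁿ)) ⟨
        1# - (t * - z) ^ pⁿ    ∎)
        (1+py-unit (- (g * w))))
      where
      g = proj₁ P∣t^N
      w = (- z) ^ pⁿ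

    unit-residue : ∀ {x u} → Unit u → t ∣ x - u → Unit x
    unit-residue {x} {u} u-unit@(v , _ , uv≈1) (z , x-u≈tz) = unit-resp (begin
      u * (1# + t * (v * z))        ≈⟨ solve 4 (λ u t v z → u :* (:1 :+ t :* (v :* z)) := u :+ t :* ((u :* v) :* z)) refl u t v z ⟩
      u + t * ((u * v) * z)         ≈⟨ +-congˡ (*-congˡ (trans (*-congʳ uv≈1) (*-identityˡ z))) ⟩
      u + t * z                     ≈⟨ +-congˡ x-u≈tz ⟨
      u + (x - u)                   ≈⟨ solve 2 (λ u x → u :+ (x :- u) := x) refl u x ⟩
      x                             ∎)
      (unit-* u-unit (1+tz-unit (v * z)))

    -- An inverse z of t makes 1 = (t z)^(p^n) a multiple p y of p. Then 1 - p y is both a unit and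
    -- zero.
    t-nonunit : ¬ (t ∣ 1#)
    t-nonunit (z , 1≈tz) = 1≉0 (begin
      1#                                  ≈⟨ proj₁ (proj₂ inverse) ⟨
      proj₁ inverse * (1# + P * - (g * w)) ≈⟨ *-congˡ vanish ⟩
      proj₁ inverse * 0#                  ≈⟨ zeroʳ _ ⟩
      0#                                  ∎)
      where
      g = proj₁ P∣t^N
      w = z ^ pⁿ
      inverse = 1+py-unit (- (g * w))
      vanish : 1# + P * - (g * w) ≈ 0#
      vanish = begin
        1# + P * - (g * w)     ≈⟨ solve 3 (λ p g w → :1 :+ p :* (:- (g :* w)) := :1 :- (p :* g) :* w) refl P g w ⟩
        1# - (P * g) * w       ≈⟨ +-congˡ (-‿cong (*-congʳ (proj₂ P∣t^N))) ⟨
        1# - t ^ pⁿ * w         ≈⟨ +-congˡ (-‿cong (*-^ t z pⁿ)) ⟨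
        1# - (t * z) ^ pⁿ      ≈⟨ +-congˡ (-‿cong (^-congˡ (p ℕ.^ suc m) 1≈tz)) ⟨
        1# - 1# ^ pⁿ           ≈⟨ +-congˡ (-‿cong (^-1 (p ℕ.^ suc m))) ⟩
        1# - 1#                ≈⟨ -‿inverseʳ 1# ⟩
        0#                     ∎

    ζ-unit : Unit ζ
    ζ-unit = unit-residue unit-1 (- 1# , solve 1 (λ z → z :- :1 := (:1 :- z) :* (:- :1)) refl ζ)

    y^p≈1 : y ^ p ≈ 1#
    y^p≈1 = trans (^-assocʳ ζ (p ℕ.^ m) p) (trans (^-congʳ ζ (ℕ.*-comm (p ℕ.^ m) p)) ζ-root)

    -- From 1 = (s + y)^p, dividing by s.
    P∼s^[p-1] : ∃ λ u → Unit u × P ≈ u * s ^ (p ∸ 1)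
    P∼s^[p-1] = - v , unit-neg (unit-⁻¹ w-unit) , (begin
      P                         ≈⟨ *-identityʳ P ⟨
      P * 1#                    ≈⟨ *-congˡ (proj₂ (proj₂ w-unit)) ⟨
      P * (w * v)               ≈⟨ solve 3 (λ p w v → p :* (w :* v) := :- v :* (:- (p :* w))) refl P w v ⟩
      - v * - (P * w)           ≈⟨ *-congˡ (x-y≈0⇒x≈y s^[p-1]≈) ⟨
      - v * s ^ (p ∸ 1)         ∎)
      where
      1≈[s+y]^p = prime-power-+ p-prime s y
      z = proj₁ 1≈[s+y]^p
      -- The expansion reads 1 = s^p + 1 + p s `w`, and `w` is y^(p - 1) modulo s, hence a unit.
      w = y * (y ^ (p ∸ 2) + s * z)
      w-unit : Unit w
      w-unit = unit-residue (unit-* (unit-^ (p ℕ.^ m) ζ-unit) (unit-^ (p ∸ 2) (unit-^ (p ℕ.^ m) ζ-unit)))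
        (∣-resp refl (solve 4 (λ s y a z → s :* (y :* z) := (y :* (a :+ s :* z)) :- y :* a) refl s y (y ^ (p ∸ 2)) z)
          (∣-*ʳ (y * z) (1-x∣1-x^k ζ (p ℕ.^ m))))
      v = proj₁ w-unit
      s^p : s ^ p ≈ s * s ^ (p ∸ 1)
      s^p = ^-congʳ s (≡.sym (lemma p-prime))
        where
        lemma : ∀ {p} → Prime p → suc (p ∸ 1) ≡ p
        lemma {zero} p-prime = ⊥-elim (¬prime[0] p-prime)
        lemma {suc p} p-prime = ≡.refl
      s^[p-1]≈ : s ^ (p ∸ 1) - - (P * w) ≈ 0#
      s^[p-1]≈ = 1-ζ^pᵐ-regular _ (begin
        s * (s ^ (p ∸ 1) - - (P * w))
          ≈⟨ solve 5 (λ s a p y b → s :* (a :- (:- (p :* (y :* b)))) := ((s :* a :+ :1) :+ p :* ((s :* y) :* b)) :- :1)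
               refl s (s ^ (p ∸ 1)) P y (y ^ (p ∸ 2) + s * z) ⟩
        ((s * s ^ (p ∸ 1) + 1#) + P * ((s * y) * (y ^ (p ∸ 2) + s * z))) - 1#
          ≈⟨ +-congʳ (+-congʳ (+-cong s^p y^p≈1)) ⟨
        ((s ^ p + y ^ p) + P * ((s * y) * (y ^ (p ∸ 2) + s * z))) - 1#
          ≈⟨ +-congʳ (proj₂ 1≈[s+y]^p) ⟨
        (s + y) ^ p - 1#
          ≈⟨ x≈y⇒x-y≈0 (trans (^-congˡ p (solve 1 (λ y → (:1 :- y) :+ y := :1) refl y)) (^-1 p)) ⟩
        0# ∎)

    s∣P : s ∣ P
    s∣P = ∣-resp refl (sym (proj₂ (proj₂ P∼s^[p-1]))) (∣-*ˡ _ (s∣s^ p-prime))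
      where
      s∣s^ : ∀ {p} → Prime p → s ∣ s ^ (p ∸ 1)
      s∣s^ {zero}        p-prime = ⊥-elim (¬prime[0] p-prime)
      s∣s^ {suc zero}    p-prime = ⊥-elim (¬prime[1] p-prime)
      s∣s^ {suc (suc q)} p-prime = s ^ q , refl

    t∣P : t ∣ P
    t∣P = ∣-trans (1-x∣1-x^k ζ (p ℕ.^ m)) s∣P

    1-ζ^p^v∣s : ∀ v → v ℕ.≤ m → 1# - ζ ^ (p ℕ.^ v) ∣ s
    1-ζ^p^v∣s v v≤m = ∣-resp refl (+-congˡ (-‿cong (begin
        (ζ ^ (p ℕ.^ v)) ^ (p ℕ.^ (m ∸ v))  ≈⟨ ^-assocʳ ζ (p ℕ.^ v) _ ⟩
        ζ ^ (p ℕ.^ v ℕ.* p ℕ.^ (m ∸ v))    ≡⟨ ≡.cong (ζ ^_) (ℕ.^-distribˡ-+-* p v (m ∸ v)) ⟨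
        ζ ^ (p ℕ.^ (v ℕ.+ (m ∸ v)))        ≡⟨ ≡.cong (λ k → ζ ^ (p ℕ.^ k)) (ℕ.m+[n∸m]≡n v≤m) ⟩
        y                                  ∎)))
      (1-x∣1-x^k (ζ ^ (p ℕ.^ v)) (p ℕ.^ (m ∸ v)))

    -- Put x = 1 - ζ^(p^v). As x divides s and s divides p, the error p t z of `1-x^prime-power` is
    -- a multiple of x t, so t^(p^v) is x times an element of the form 1 + t a.
    1-ζ^p^v∼t : ∀ v → v ℕ.≤ m → ∃ λ u → Unit u × 1# - ζ ^ (p ℕ.^ v) ≈ u * t ^ (p ℕ.^ v)
    1-ζ^p^v∼t v v≤m = proj₁ w , unit-⁻¹ w , (begin
      x                                 ≈⟨ *-identityˡ x ⟨
      1# * x                            ≈⟨ *-congʳ (proj₁ (proj₂ w)) ⟨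
      (proj₁ w * (1# + t * (a * z))) * x
        ≈⟨ solve 5 (λ v t a z x → (v :* (:1 :+ t :* (a :* z))) :* x := v :* (((x :* a) :* t) :* z :+ x)) refl _ t a z x ⟩
      proj₁ w * (((x * a) * t) * z + x)   ≈⟨ *-congˡ (+-congʳ (*-congʳ (*-congʳ (proj₂ x∣P)))) ⟨
      proj₁ w * ((P * t) * z + x)         ≈⟨ *-congˡ (+-congʳ (proj₂ t^p^v∼x)) ⟨
      proj₁ w * ((t ^ (p ℕ.^ v) - x) + x) ≈⟨ *-congˡ (solve 2 (λ a x → (a :- x) :+ x := a) refl _ x) ⟩
      proj₁ w * t ^ (p ℕ.^ v)             ∎)
      where
      x = 1# - ζ ^ (p ℕ.^ v)
      t^p^v∼x = 1-x^prime-power p-prime ζ v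
      x∣P = ∣-trans (1-ζ^p^v∣s v v≤m) s∣P
      z = proj₁ t^p^v∼x
      a = proj₁ x∣P
      w = 1+tz-unit (a * z)

    -- The geometric sum of length d in ζ^(p^v) is d modulo t and therefore a unit, so the
    -- prime-to-p factor of the exponent does not affect the valuation.
    1-ζ^d∼t : ∀ v d → v ℕ.≤ m → p ∤ d → ∃ λ u → Unit u × 1# - ζ ^ (p ℕ.^ v ℕ.* d) ≈ u * t ^ (p ℕ.^ v)
    1-ζ^d∼t v d v≤m p∤d = g * u , unit-* g-unit u-unit , (begin
      1# - ζ ^ (p ℕ.^ v ℕ.* d)           ≈⟨ +-congˡ (-‿cong (^-assocʳ ζ (p ℕ.^ v) d)) ⟨
      1# - (ζ ^ (p ℕ.^ v)) ^ d           ≈⟨ geometric-factor _ d ⟩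
      (1# - ζ ^ (p ℕ.^ v)) * g           ≈⟨ *-congʳ (proj₂ (proj₂ previous)) ⟩
      (u * t ^ (p ℕ.^ v)) * g            ≈⟨ solve 3 (λ u t g → (u :* t) :* g := (g :* u) :* t) refl u _ g ⟩
      (g * u) * t ^ (p ℕ.^ v)            ∎)
      where
      previous = 1-ζ^p^v∼t v v≤m
      u = proj₁ previous
      u-unit = proj₁ (proj₂ previous)
      g = geometric (ζ ^ (p ℕ.^ v)) d
      g-unit : Unit g
      g-unit = unit-residue (prime-to-p-unit d p∤d)
        (∣-resp refl (solve 2 (λ a b → :0 :- (a :- b) := b :- a) refl (d · 1#) g)
          (∣-- ∣0 (∣-trans (1-x∣1-x^k ζ (p ℕ.^ v)) (geometric-residue _ d))))

    P∼t^rank : ∃ λ u → Unit u × P ≈ u * t ^ rank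
    P∼t^rank =
      let u , u-unit , P≈ = P∼s^[p-1]
          v , v-unit , s≈ = 1-ζ^p^v∼t m ℕ.≤-refl
      in u * v ^ (p ∸ 1) , unit-* u-unit (unit-^ (p ∸ 1) v-unit) , (begin
      P                                               ≈⟨ P≈ ⟩
      u * s ^ (p ∸ 1)                                 ≈⟨ *-congˡ (^-congˡ (p ∸ 1) s≈) ⟩
      u * (v * t ^ (p ℕ.^ m)) ^ (p ∸ 1)               ≈⟨ *-congˡ (*-^ v _ (p ∸ 1)) ⟩
      u * (v ^ (p ∸ 1) * (t ^ (p ℕ.^ m)) ^ (p ∸ 1))   ≈⟨ *-congˡ (*-congˡ (trans (^-assocʳ t (p ℕ.^ m) (p ∸ 1))
                                                           (^-congʳ t (ℕ.*-comm (p ℕ.^ m) (p ∸ 1))))) ⟩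
      u * (v ^ (p ∸ 1) * t ^ rank)                    ≈⟨ *-assoc u _ _ ⟨
      (u * v ^ (p ∸ 1)) * t ^ rank                    ∎)

    -- The residue of x is a natural number, for which divisibility by p is decidable. As t divides
    -- p, a multiple of p gives a multiple of t; any other residue is a unit.
    t∣⊎unit : ∀ x → t ∣ x ⊎ Unit x
    t∣⊎unit x with residue x
    ... | k , t∣x-k with p ℕ.∣? k
    ...   | no p∤k            = inj₂ (unit-residue (prime-to-p-unit k p∤k) t∣x-k)
    ...   | yes (divides q k≡qp) = inj₁ (∣-resp refl
            (solve 2 (λ x k → (x :- k) :+ k := x) refl x (k · 1#))
            (∣-+ t∣x-k (∣-resp refl (trans (sym (Mult.×1-homo-* semiring q p)) (reflexive (≡.cong (_· 1#) (≡.sym k≡qp))))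
               (∣-*ˡ (q · 1#) t∣P))))

    fromℤ-unit : ∀ i → p ∤ ∣ i ∣ → Unit (fromℤ i)
    fromℤ-unit (+ k)    p∤i = prime-to-p-unit k p∤i
    fromℤ-unit -[1+ k ] p∤i = unit-neg (prime-to-p-unit (suc k) p∤i)

    t∣fromℤ : ∀ i → t ∣ fromℤ i → p ℕ.∣ ∣ i ∣
    t∣fromℤ i t∣i with p ℕ.∣? ∣ i ∣
    ... | yes p∣i = p∣i
    ... | no p∤i  = ⊥-elim (t-nonunit (∣-resp refl (proj₂ (proj₂ (fromℤ-unit i p∤i))) (∣-*ʳ _ t∣i)))

    t^-∣-cancel : ∀ k {x} → t ^ suc k ∣ t * x → t ^ k ∣ x
    t^-∣-cancel k {x} (z , tx≈) = z , x-y≈0⇒x≈y (t-regular _ (begin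
      t * (x - t ^ k * z)          ≈⟨ solve 4 (λ t x a z → t :* (x :- a :* z) := t :* x :- (t :* a) :* z) refl t x (t ^ k) z ⟩
      t * x - (t * t ^ k) * z      ≈⟨ x≈y⇒x-y≈0 tx≈ ⟩
      0#                           ∎))

    t-adic : ∀ {k} → (Fin k → ℤ) → Carrier
    t-adic d = sum (λ l → fromℤ (d l) * t ^ toℕ l)

    t-adic-suc : ∀ {k} (d : Fin (suc k) → ℤ) → t-adic d ≈ fromℤ (d zero) + t * t-adic (d ∘ suc)
    t-adic-suc d = +-cong (*-identityʳ _) (begin
      sum (λ l → fromℤ (d (suc l)) * (t * t ^ toℕ l))
        ≈⟨ sum-cong-≋ (λ l → solve 3 (λ d t a → d :* (t :* a) := t :* (d :* a)) refl (fromℤ (d (suc l))) t (t ^ toℕ l)) ⟩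
      sum (λ l → t * (fromℤ (d (suc l)) * t ^ toℕ l))
        ≈⟨ *-distribˡ-sum t (λ l → fromℤ (d (suc l)) * t ^ toℕ l) ⟨
      t * t-adic (d ∘ suc) ∎)

    t^rank∣fromℤ : ∀ i → p ℕ.∣ ∣ i ∣ → t ^ rank ∣ fromℤ i
    t^rank∣fromℤ i p∣i with ℤ.∣ᵤ⇒∣ {+ p} {i} p∣i
    ... | ℤ.divides q ≡.refl = ∣-resp refl (sym (fromℤ-* q (+ p))) (∣-*ˡ (fromℤ q)
          (let u , _ , P≈ = P∼t^rank in u , trans P≈ (*-comm u _)))

    t^k∣t-adic⇒p∣ : ∀ {k} → k ℕ.≤ rank → (d : Fin k → ℤ) → t ^ k ∣ t-adic d → ∀ l → p ℕ.∣ ∣ d l ∣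
    t^k∣t-adic⇒p∣ {suc k} k<r d t^k∣ = go
      where
      t^k∣′ : t ^ suc k ∣ fromℤ (d zero) + t * t-adic (d ∘ suc)
      t^k∣′ = ∣-resp refl (t-adic-suc d) t^k∣

      p∣d₀ : p ℕ.∣ ∣ d zero ∣
      p∣d₀ = t∣fromℤ (d zero) (∣-resp refl (solve 2 (λ a b → (a :+ b) :- b := a) refl _ _)
        (∣-- (∣-trans (t ^ k , refl) t^k∣′) (t-adic (d ∘ suc) , refl)))

      t^k∣d₀ : t ^ suc k ∣ fromℤ (d zero)
      t^k∣d₀ = ∣-trans (^-∣-^ k<r) (t^rank∣fromℤ (d zero) p∣d₀)

      go : ∀ l → p ℕ.∣ ∣ d l ∣
      go zero    = p∣d₀
      go (suc l) = t^k∣t-adic⇒p∣ (ℕ.<⇒≤ k<r) (d ∘ suc)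
        (t^-∣-cancel k (∣-resp refl (solve 2 (λ a b → (a :+ b) :- a := b) refl _ _) (∣-- t^k∣′ t^k∣d₀))) l

    P-regular : ∀ x → P * x ≈ 0# → x ≈ 0#
    P-regular x Px≈0 = let u , u-unit , P≈ = P∼t^rank in
      ^-regular t-regular rank x (unit-cancelˡ _ u-unit (trans (sym (*-assoc u _ x)) (trans (*-congʳ (sym P≈)) Px≈0)))

    -- The descent: all coefficients of a relation are divisible by p, and since p is regular,
    -- dividing them by p gives a relation again.
    t-adic≈0⇒p^∣ : ∀ k (d : Fin rank → ℤ) → t-adic d ≈ 0# → ∀ l → p ℕ.^ k ℕ.∣ ∣ d l ∣
    t-adic≈0⇒p^∣ zero    d d≈0 l = ℕ.1∣ ∣ d l ∣
    t-adic≈0⇒p^∣ (suc k) d d≈0 l = ≡.subst (p ℕ.^ suc k ℕ.∣_)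
      (≡.sym (≡.trans (≡.cong ∣_∣ (d≡ l)) (≡.trans (ℤ.abs-* (e l) (+ p)) (ℕ.*-comm ∣ e l ∣ p))))
      (ℕ.*-monoʳ-∣ p (t-adic≈0⇒p^∣ k e (P-regular _ (begin
        P * t-adic e
          ≈⟨ *-distribˡ-sum P (λ l → fromℤ (e l) * t ^ toℕ l) ⟩
        sum (λ l → P * (fromℤ (e l) * t ^ toℕ l))
          ≈⟨ sum-cong-≋ (λ l → trans (sym (*-assoc P _ _)) (*-congʳ (trans (*-comm P _)
               (trans (sym (fromℤ-* (e l) (+ p))) (reflexive (≡.cong fromℤ (≡.sym (d≡ l)))))))) ⟩
        t-adic d
          ≈⟨ d≈0 ⟩
        0# ∎)) l))
      where
      p∣d = λ l → ℤ.∣ᵤ⇒∣ {+ p} {d l} (t^k∣t-adic⇒p∣ ℕ.≤-refl d (0# , trans d≈0 (sym (zeroʳ _))) l)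
      e = λ l → ℤ.quotient (p∣d l)
      d≡ : ∀ l → d l ≡ e l ℤ.* + p
      d≡ l = ℤ._∣_.equality (p∣d l)

    t-adic-independent : (d : Fin rank → ℤ) → t-adic d ≈ 0# → ∀ l → d l ≡ + 0
    t-adic-independent d d≈0 l with ∣ d l ∣ in eq
    ... | zero  = ℤ.∣i∣≡0⇒i≡0 eq
    ... | suc k = ⊥-elim (ℕ.<⇒≱ (k<p^k p-prime (suc k))
                    (∣⇒≤ (≡.subst (p ℕ.^ suc k ℕ.∣_) eq (t-adic≈0⇒p^∣ (suc k) d d≈0 l))))

    ζ^-ζ^∼t : ∀ v d b → v ℕ.≤ m → p ∤ d → ∃ λ u → Unit u × ζ ^ (b ℕ.+ p ℕ.^ v ℕ.* d) - ζ ^ b ≈ u * t ^ (p ℕ.^ v)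
    ζ^-ζ^∼t v d b v≤m p∤d =
      let u , u-unit , eq = 1-ζ^d∼t v d v≤m p∤d
      in - (ζ ^ b) * u , unit-* (unit-neg (unit-^ b ζ-unit)) u-unit , (begin
      ζ ^ (b ℕ.+ p ℕ.^ v ℕ.* d) - ζ ^ b             ≈⟨ +-congʳ (^-homo-* ζ b _) ⟩
      ζ ^ b * ζ ^ (p ℕ.^ v ℕ.* d) - ζ ^ b           ≈⟨ solve 2 (λ b d → b :* d :- b := (:- b) :* (:1 :- d)) refl _ _ ⟩
      - (ζ ^ b) * (1# - ζ ^ (p ℕ.^ v ℕ.* d))        ≈⟨ *-congˡ eq ⟩
      - (ζ ^ b) * (u * t ^ (p ℕ.^ v))               ≈⟨ *-assoc _ _ _ ⟨
      (- (ζ ^ b) * u) * t ^ (p ℕ.^ v)               ∎)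

-- Uniqueness of elementary divisors over a local ring

module LinearCombinations (A : Ring ℓᵃ ℓ₁) (M : LeftModule A m₁ ℓ₂) where
  open Ring A using (Carrier; _+_; _*_; 0#; 1#)
  open LeftModule M
  open Sum +ᴹ-commutativeMonoid public
    using (sum; sum-cong-≋; sum-remove; sum-replicate-zero; ∑-distrib-+; ∑-comm)
  open Sum (Ring.+-commutativeMonoid A) using () renaming (sum to sumᴬ)
  open SetoidReasoning ≈ᴹ-setoid

  sum-zero : ∀ {n} (f : Fin n → Carrierᴹ) → (∀ i → f i ≈ᴹ 0ᴹ) → sum f ≈ᴹ 0ᴹ
  sum-zero {n} f f≈0 = ≈ᴹ-trans (sum-cong-≋ f≈0) (sum-replicate-zero n)

  sum-single : ∀ {n} (f : Fin n → Carrierᴹ) k → (∀ i → i ≢ k → f i ≈ᴹ 0ᴹ) → sum f ≈ᴹ f k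
  sum-single {suc n} f k f≈0 = begin
    sum f                              ≈⟨ sum-remove {i = k} f ⟩
    f k +ᴹ sum (λ i → f (punchIn k i)) ≈⟨ +ᴹ-congˡ (sum-zero _ (λ i → f≈0 _ (Fin.punchInᵢ≢i k i))) ⟩
    f k +ᴹ 0ᴹ                          ≈⟨ +ᴹ-identityʳ (f k) ⟩
    f k                                ∎

  *ₗ-distribˡ-sum : ∀ {n} s (f : Fin n → Carrierᴹ) → s *ₗ sum f ≈ᴹ sum (λ i → s *ₗ f i)
  *ₗ-distribˡ-sum {zero}  s f = *ₗ-zeroʳ s
  *ₗ-distribˡ-sum {suc n} s f = ≈ᴹ-trans (*ₗ-distribˡ s _ _) (+ᴹ-congˡ (*ₗ-distribˡ-sum s (f ∘ suc)))

  *ₗ-distribʳ-sum : ∀ {n} (q : Fin n → Carrier) x → sumᴬ q *ₗ x ≈ᴹ sum (λ i → q i *ₗ x)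
  *ₗ-distribʳ-sum {zero}  q x = *ₗ-zeroˡ x
  *ₗ-distribʳ-sum {suc n} q x = ≈ᴹ-trans (*ₗ-distribʳ x _ _) (+ᴹ-congˡ (*ₗ-distribʳ-sum (q ∘ suc) x))

  combination : ∀ {n} → (Fin n → Carrier) → (Fin n → Carrierᴹ) → Carrierᴹ
  combination q v = sum (λ i → q i *ₗ v i)

  combination-+ : ∀ {n} q q′ (v : Fin n → Carrierᴹ) →
    combination (λ i → q i + q′ i) v ≈ᴹ combination q v +ᴹ combination q′ v
  combination-+ q q′ v = ≈ᴹ-trans (sum-cong-≋ (λ i → *ₗ-distribʳ (v i) (q i) (q′ i))) (∑-distrib-+ (λ i → q i *ₗ v i) (λ i → q′ i *ₗ v i))

  combination-* : ∀ {n} s q (v : Fin n → Carrierᴹ) →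
    combination (λ i → s * q i) v ≈ᴹ s *ₗ combination q v
  combination-* s q v = ≈ᴹ-trans (sum-cong-≋ (λ i → *ₗ-assoc s (q i) (v i))) (≈ᴹ-sym (*ₗ-distribˡ-sum s (λ i → q i *ₗ v i)))

  -- An inductive closure, so that stability under a map is shown by recursion on the derivation.
  -- Coefficients are extracted only where a basis demands them.
  data Span (G : Pred Carrierᴹ ℓ) : Pred Carrierᴹ (ℓᵃ ⊔ m₁ ⊔ ℓ₂ ⊔ ℓ) where
    gen   : ∀ {x} → G x → Span G x
    zero  : Span G 0ᴹ
    add   : ∀ {x y} → Span G x → Span G y → Span G (x +ᴹ y)
    scale : ∀ {x} s → Span G x → Span G (s *ₗ x)
    resp  : ∀ {x y} → x ≈ᴹ y → Span G x → Span G y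

  Span-bind : {G : Pred Carrierᴹ ℓ} {H : Pred Carrierᴹ ℓ₃} →
              (∀ {x} → G x → Span H x) → ∀ {x} → Span G x → Span H x
  Span-bind f (gen x∈)     = f x∈
  Span-bind f zero         = zero
  Span-bind f (add x∈ y∈)  = add (Span-bind f x∈) (Span-bind f y∈)
  Span-bind f (scale s x∈) = scale s (Span-bind f x∈)
  Span-bind f (resp p x∈)  = resp p (Span-bind f x∈)

  Below : (ℕ → Carrierᴹ) → ℕ → Pred Carrierᴹ ℓ₂
  Below v k x = ∃ λ l → l ℕ.< k × x ≈ᴹ v l

  Span-coefficients : ∀ {r} (v : ℕ → Carrierᴹ) {x} → Span (Below v r) x →
                      ∃ λ (q : Fin r → Carrier) → x ≈ᴹ combination q (v ∘ toℕ)
  Span-coefficients {r} v (gen {x} (l , l<r , x≈)) = δ , (begin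
    x                        ≈⟨ x≈ ⟩
    v l                      ≡⟨ ≡.cong v (Fin.toℕ-fromℕ< l<r) ⟨
    v (toℕ k)                ≈⟨ *ₗ-identityˡ _ ⟨
    1# *ₗ v (toℕ k)          ≈⟨ *ₗ-congʳ (Ring.reflexive A δ-k) ⟨
    δ k *ₗ v (toℕ k)         ≈⟨ sum-single _ k (λ i i≢k → ≈ᴹ-trans (*ₗ-congʳ (Ring.reflexive A (δ-≢ i i≢k))) (*ₗ-zeroˡ _)) ⟨
    combination δ (v ∘ toℕ)  ∎)
    where
    k = fromℕ< l<r
    δ : Fin r → Carrier
    δ i with i Fin.≟ k
    ... | yes _ = 1#
    ... | no  _ = 0#
    δ-k : δ k ≡ 1#
    δ-k with k Fin.≟ k
    ... | yes _  = ≡.refl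
    ... | no k≢k = ⊥-elim (k≢k ≡.refl)
    δ-≢ : ∀ i → i ≢ k → δ i ≡ 0#
    δ-≢ i i≢k with i Fin.≟ k
    ... | yes i≡k = ⊥-elim (i≢k i≡k)
    ... | no  _   = ≡.refl
  Span-coefficients {r} v zero = (λ _ → 0#) , ≈ᴹ-sym (sum-zero {r} _ (λ i → *ₗ-zeroˡ (v (toℕ i))))
  Span-coefficients v (add x∈ y∈) with Span-coefficients v x∈ | Span-coefficients v y∈
  ... | q , x≈ | q′ , y≈ = (λ i → q i + q′ i) , ≈ᴹ-trans (+ᴹ-cong x≈ y≈) (≈ᴹ-sym (combination-+ q q′ (v ∘ toℕ)))
  Span-coefficients v (scale s x∈) with Span-coefficients v x∈
  ... | q , x≈ = (λ i → s * q i) , ≈ᴹ-trans (*ₗ-congˡ x≈) (≈ᴹ-sym (combination-* s q (v ∘ toℕ)))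
  Span-coefficients v (resp x≈y x∈) with Span-coefficients v x∈
  ... | q , x≈ = q , ≈ᴹ-trans (≈ᴹ-sym x≈y) x≈

module LinearMap (S : CommutativeRing ℓᵃ ℓ₁)
  (M : LeftModule (CommutativeRing.ring S) m₁ ℓ₂) (N : LeftModule (CommutativeRing.ring S) m₂ ℓ₃)
  (f : LeftModule.Carrierᴹ M → LeftModule.Carrierᴹ N)
  (f-linear : LeftModuleMorphisms.IsLeftModuleHomomorphism (LeftModule.rawLeftModule M) (LeftModule.rawLeftModule N) f)
  where
  private
    module M = LinearCombinations (CommutativeRing.ring S) M
    module N = LinearCombinations (CommutativeRing.ring S) N
  open LeftModule N
  open LeftModuleMorphisms.IsLeftModuleHomomorphism f-linear

  f-combination : ∀ {n} q (v : Fin n → LeftModule.Carrierᴹ M) → f (M.combination q v) ≈ᴹ N.combination q (f ∘ v)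
  f-combination {zero}  q v = 0ᴹ-homo
  f-combination {suc n} q v = ≈ᴹ-trans (+ᴹ-homo _ _) (+ᴹ-cong (*ₗ-homo _ _) (f-combination (q ∘ suc) (v ∘ suc)))

module BasisProperties (S : CommutativeRing ℓᵃ ℓ₁) (M : LeftModule (CommutativeRing.ring S) m₁ ℓ₂)
  {r} (v : Fin r → LeftModule.Carrierᴹ M) (v-basis : IsBasis S M v) where
  open CommutativeRing S
  open LeftModule M
  open LinearCombinations ring M
  open IsBasis v-basis
  open RingLemmas S using (x-y≈0⇒x≈y)
  open RingProperties ring using (-1*x≈-x)
  open SetoidReasoning ≈ᴹ-setoid

  coefficients-unique : ∀ q q′ → combination q v ≈ᴹ combination q′ v → ∀ i → q i ≈ q′ i
  coefficients-unique q q′ eq i = x-y≈0⇒x≈y (trans (+-congˡ (sym (-1*x≈-x (q′ i)))) (independent _ (begin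
    combination (λ i → q i + - 1# * q′ i) v             ≈⟨ combination-+ q _ v ⟩
    combination q v +ᴹ combination (λ i → - 1# * q′ i) v ≈⟨ +ᴹ-cong eq (combination-* (- 1#) q′ v) ⟩
    x +ᴹ (- 1#) *ₗ x                                     ≈⟨ +ᴹ-congʳ (*ₗ-identityˡ x) ⟨
    1# *ₗ x +ᴹ (- 1#) *ₗ x                               ≈⟨ *ₗ-distribʳ x 1# (- 1#) ⟨
    (1# - 1#) *ₗ x                                       ≈⟨ *ₗ-congʳ (-‿inverseʳ 1#) ⟩
    0# *ₗ x                                              ≈⟨ *ₗ-zeroˡ x ⟩
    0ᴹ                                                   ∎) i))
    where x = combination q′ v

module _ (S : CommutativeRing ℓᵃ ℓ₁) where
  open CommutativeRing S hiding (zero)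
  open Exp semiring
  open RingLemmas S

  -- Here S is local, its maximal ideal being generated by the regular element t. The disjunction
  -- `t∣⊎unit` decides vanishing in the residue field, which elimination needs for its pivots.
  module LocalRing
    (t : Carrier)
    (t-regular : ∀ x → t * x ≈ 0# → x ≈ 0#)
    (t-nonunit : ¬ (t ∣ 1#))
    (t∣⊎unit : ∀ x → t ∣ x ⊎ Unit x)
    where
    open SemiringSum semiring using (sum; sum-cong-≋; sum-remove; *-distribˡ-sum; ∑-distrib-+)
    open IntegerSolver S

    t∣⇒¬unit : ∀ {x} → t ∣ x → ¬ Unit x
    t∣⇒¬unit t∣x (y , _ , xy≈1) = t-nonunit (∣-resp refl xy≈1 (∣-*ʳ y t∣x))

    t^-∣-cancel : ∀ k {x} → t ^ suc k ∣ t ^ k * x → t ∣ x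
    t^-∣-cancel k {x} (z , eq) = z , x-y≈0⇒x≈y (^-regular t-regular k _ (trans
      (solve 4 (λ a x t z → a :* (x :- t :* z) := a :* x :- (t :* a) :* z) refl (t ^ k) x t z)
      (x≈y⇒x-y≈0 eq)))

    ∣-cancel-unit : ∀ {u x} → Unit u → t ∣ u * x → t ∣ x
    ∣-cancel-unit {u} {x} (v , vu≈1 , _) t∣ux = ∣-resp refl
      (trans (sym (*-assoc v u x)) (trans (*-congʳ vu≈1) (*-identityˡ x))) (∣-*ˡ v t∣ux)

    t∣⊎∃unit : ∀ {n} (x : Fin n → Carrier) → (∀ i → t ∣ x i) ⊎ ∃ λ i → Unit (x i)
    t∣⊎∃unit {ℕ.zero}  x = inj₁ λ ()
    t∣⊎∃unit {ℕ.suc n} x with t∣⊎unit (x zero) | t∣⊎∃unit (x ∘ suc)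
    ... | inj₂ u | _            = inj₂ (zero , u)
    ... | inj₁ _ | inj₂ (i , u) = inj₂ (suc i , u)
    ... | inj₁ p | inj₁ q       = inj₁ λ { zero → p ; (suc i) → q i }

    private
      sum-eliminate : ∀ {n} (x y c : Fin n → Carrier) α b →
        sum (λ j → (x j - α * (b * y j)) * c j) ≈ α * - (b * sum (λ j → y j * c j)) + sum (λ j → x j * c j)
      sum-eliminate x y c α b = begin
        sum (λ j → (x j - α * (b * y j)) * c j)
          ≈⟨ sum-cong-≋ (λ j → solve 5 (λ x α b y c → (x :- α :* (b :* y)) :* c := (:- (α :* b)) :* (y :* c) :+ x :* c) refl (x j) α b (y j) (c j)) ⟩
        sum (λ j → - (α * b) * (y j * c j) + x j * c j)
          ≈⟨ ∑-distrib-+ (λ j → - (α * b) * (y j * c j)) (λ j → x j * c j) ⟩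
        sum (λ j → - (α * b) * (y j * c j)) + sum (λ j → x j * c j)
          ≈⟨ +-congʳ (*-distribˡ-sum (- (α * b)) (λ j → y j * c j)) ⟨
        - (α * b) * sum (λ j → y j * c j) + sum (λ j → x j * c j)
          ≈⟨ +-congʳ (solve 3 (λ α b s → (:- (α :* b)) :* s := α :* (:- (b :* s))) refl α b _) ⟩
        α * - (b * sum (λ j → y j * c j)) + sum (λ j → x j * c j) ∎
        where open SetoidReasoning setoid

    -- Gaussian elimination over the residue field.
    kernel-vector-mod-t : ∀ n (A : Fin n → Fin (suc n) → Carrier) →
      ∃ λ (c : Fin (suc n) → Carrier) → (∃ λ j → Unit (c j)) × ∀ i → t ∣ sum (λ j → A i j * c j)
    kernel-vector-mod-t ℕ.zero    A = (λ _ → 1#) , (zero , unit-1) , λ ()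
    kernel-vector-mod-t (ℕ.suc n) A with t∣⊎∃unit (A zero)
    ... | inj₁ t∣A₀ = c , (suc (proj₁ j) , proj₂ j) , λ
            { zero    → sum-∣ (λ j → A zero j * c j) (λ j → ∣-*ʳ (c j) (t∣A₀ j))
            ; (suc i) → ∣-+ (∣-*ˡ _ ∣0) (t∣Ac i) }
      where
      IH = kernel-vector-mod-t n (λ i j → A (suc i) (suc j))
      c : Fin (2 ℕ.+ n) → Carrier
      c zero    = 0#
      c (suc j) = proj₁ IH j
      j = proj₁ (proj₂ IH)
      t∣Ac = proj₂ (proj₂ IH)
    ... | inj₂ (k , b , _ , ab≈1) = c , (punchIn k (proj₁ j) , unit-resp (reflexive (≡.sym (insertAt-punchIn c′ k (- (b * s)) (proj₁ j)))) (proj₂ j)) , λ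
            { zero    → ∣-resp refl (sym (row zero)) (0# , (begin
                A zero k * - (b * s) + s  ≈⟨ solve 3 (λ a b s → a :* (:- (b :* s)) :+ s := (:- (a :* b :- :1)) :* s) refl _ b s ⟩
                - (A zero k * b - 1#) * s ≈⟨ *-congʳ (-‿cong (x≈y⇒x-y≈0 ab≈1)) ⟩
                - 0# * s                  ≈⟨ solve 2 (λ s t → (:- :0) :* s := t :* :0) refl s t ⟩
                t * 0#                    ∎))
            ; (suc i) → ∣-resp refl (trans
                (sum-eliminate (λ j → A (suc i) (punchIn k j)) (λ j → A zero (punchIn k j)) c′ (A (suc i) k) b) (sym (row (suc i)))) (t∣Ac i) }
      where
      open SetoidReasoning setoid
      -- The unit in the first row clears column `k` from the other rows. The coordinate inserted at
      -- `k` afterwards solves the first row exactly.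
      IH = kernel-vector-mod-t n (λ i j → A (suc i) (punchIn k j) - A (suc i) k * (b * A zero (punchIn k j)))
      c′ = proj₁ IH
      j = proj₁ (proj₂ IH)
      t∣Ac = proj₂ (proj₂ IH)
      s = sum (λ j → A zero (punchIn k j) * c′ j)
      c : Fin (2 ℕ.+ n) → Carrier
      c = insertAt c′ k (- (b * s))
      row : ∀ i → sum (λ j → A i j * c j) ≈ A i k * - (b * s) + sum (λ j → A i (punchIn k j) * c′ j)
      row i = trans (sum-remove {i = k} (λ j → A i j * c j)) (+-cong
        (*-congˡ (reflexive (insertAt-lookup c′ k (- (b * s)))))
        (sum-cong-≋ (λ j → *-congˡ {A i (punchIn k j)} (reflexive (insertAt-punchIn c′ k (- (b * s)) j)))))

    module _ (M : LeftModule ring m₁ ℓ₂) (N : LeftModule ring m₂ ℓ₃)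
      (f : LeftModule.Carrierᴹ M → LeftModule.Carrierᴹ N)
      (f-linear : LeftModuleMorphisms.IsLeftModuleHomomorphism (LeftModule.rawLeftModule M) (LeftModule.rawLeftModule N) f)
      where
      private
        module M = LinearCombinations ring M
        module N where
          open LeftModule N public
          open LinearCombinations ring N public

      -- Let e′ k < e k, and let P express the second target basis through the first. Comparing both
      -- diagonal forms of f gives t^(e′ j) P j i = Q j i t^(e i) up to units, and e′ j ≤ e′ k < e k
      -- ≤ e i whenever j ≤ k ≤ i, so t divides those P j i. Modulo t the first k + 1 vectors of the
      -- second basis then lie in the span of k vectors and are dependent. Exchanging the two forms
      -- yields equality.
      elementary-divisors-≤ : ∀ {r} {e e′ : Fin r → ℕ} →
        HasElementaryDivisors S t M N f e → HasElementaryDivisors S t M N f e′ → ∀ k → e k ℕ.≤ e′ k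
      elementary-divisors-≤ {suc r} {e} {e′} D D′ k = ℕ.≮⇒≥ e′k≮ek
        where
        module D = HasElementaryDivisors D
        module D′ = HasElementaryDivisors D′
        Q P : Fin (suc r) → Fin (suc r) → Carrier
        Q j = proj₁ (IsBasis.spanning D.source-basis (D′.source j))
        P j = proj₁ (IsBasis.spanning D.target-basis (D′.target j))

        PQ : ∀ j i → (D′.unit j * t ^ e′ j) * P j i ≈ Q j i * (D.unit i * t ^ e i)
        PQ j = BasisProperties.coefficients-unique S N D.target D.target-basis _ _ (begin
          N.combination (λ i → (D′.unit j * t ^ e′ j) * P j i) D.target
            ≈⟨ N.combination-* _ (P j) D.target ⟩
          (D′.unit j * t ^ e′ j) N.*ₗ N.combination (P j) D.target
            ≈⟨ N.*ₗ-congˡ (proj₂ (IsBasis.spanning D.target-basis (D′.target j))) ⟨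
          (D′.unit j * t ^ e′ j) N.*ₗ D′.target j
            ≈⟨ D′.diagonal j ⟨
          f (D′.source j)
            ≈⟨ ⟦⟧-cong (proj₂ (IsBasis.spanning D.source-basis (D′.source j))) ⟩
          f (M.combination (Q j) D.source)
            ≈⟨ f-combination (Q j) D.source ⟩
          N.combination (Q j) (f ∘ D.source)
            ≈⟨ N.sum-cong-≋ (λ i → N.*ₗ-congˡ {Q j i} (D.diagonal i)) ⟩
          N.sum (λ i → Q j i N.*ₗ ((D.unit i * t ^ e i) N.*ₗ D.target i))
            ≈⟨ N.sum-cong-≋ (λ i → N.*ₗ-assoc (Q j i) (D.unit i * t ^ e i) (D.target i)) ⟨
          N.combination (λ i → Q j i * (D.unit i * t ^ e i)) D.target ∎)
          where
          open SetoidReasoning N.≈ᴹ-setoid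
          open LinearMap S M N f f-linear
          open LeftModuleMorphisms.IsLeftModuleHomomorphism f-linear using (⟦⟧-cong)

        -- Beyond the first k rows of P, which are to be killed modulo t, further
        -- rows force the coordinates of c with index greater than k into t S.
        A : Fin r → Fin (suc r) → Carrier
        A i j with toℕ i ℕ.<? toℕ k
        ... | yes _ = P j (inject₁ i)
        ... | no  _ with j Fin.≟ suc i
        ...   | yes _ = 1#
        ...   | no  _ = 0#

        kernel = kernel-vector-mod-t r A
        c = proj₁ kernel
        j₀ = proj₁ (proj₁ (proj₂ kernel))
        c-unit = proj₂ (proj₁ (proj₂ kernel))
        t∣Ac = proj₂ (proj₂ kernel)

        A-< : ∀ i j → toℕ i ℕ.< toℕ k → A i j ≡ P j (inject₁ i)
        A-< i j i<k with toℕ i ℕ.<? toℕ k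
        ... | yes _  = ≡.refl
        ... | no i≮k = ⊥-elim (i≮k i<k)

        A-≥ : ∀ i j → ¬ toℕ i ℕ.< toℕ k → (j ≡ suc i → A i j ≡ 1#) × (j ≢ suc i → A i j ≡ 0#)
        A-≥ i j i≮k with toℕ i ℕ.<? toℕ k
        ... | yes i<k = ⊥-elim (i≮k i<k)
        ... | no  _ with j Fin.≟ suc i
        ...   | yes j≡i = (λ _ → ≡.refl) , λ j≢i → ⊥-elim (j≢i j≡i)
        ...   | no  j≢i = (λ j≡i → ⊥-elim (j≢i j≡i)) , λ _ → ≡.refl

        t∣c : ∀ j → toℕ k ℕ.< toℕ j → t ∣ c j
        t∣c (suc j) (s≤s k≤j) = ∣-resp refl (begin
          sum (λ l → A j l * c l)
            ≈⟨ LinearCombinations.sum-single ring (TensorUnit.leftModule) (λ l → A j l * c l) (suc j)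
                 (λ l l≢j → trans (*-congʳ (reflexive (proj₂ (A-≥ j l (ℕ.≤⇒≯ k≤j)) l≢j))) (zeroˡ (c l))) ⟩
          A j (suc j) * c (suc j)
            ≈⟨ *-congʳ (reflexive (proj₁ (A-≥ j (suc j) (ℕ.≤⇒≯ k≤j)) ≡.refl)) ⟩
          1# * c (suc j)
            ≈⟨ *-identityˡ _ ⟩
          c (suc j) ∎) (t∣Ac j)
          where open SetoidReasoning setoid

        e′k≮ek : ¬ e′ k ℕ.< e k
        e′k≮ek e′k<ek = t∣⇒¬unit (z j₀ , c≈tz j₀) c-unit
          where
          t∣P : ∀ i j → toℕ j ℕ.≤ toℕ k → toℕ k ℕ.≤ toℕ i → t ∣ P j i
          t∣P i j j≤k k≤i = ∣-cancel-unit (D′.unit-inv j) (t^-∣-cancel (e′ j)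
            (∣-resp refl (trans (sym (PQ j i)) (solve 3 (λ u a p → (u :* a) :* p := a :* (u :* p)) refl _ _ _))
              (∣-*ˡ (Q j i) (∣-*ˡ (D.unit i)
                (^-∣-^ (ℕ.≤-trans (s≤s (D′.monotone j≤k)) (ℕ.≤-trans e′k<ek (D.monotone k≤i))))))))

          t∣Pc : ∀ i → t ∣ sum (λ j → P j i * c j)
          t∣Pc i with toℕ i ℕ.<? toℕ k
          ... | yes i<k = ∣-resp refl (sum-cong-≋ (λ j → *-congʳ {c j} (reflexive (≡.trans
                  (A-< i′ j (≡.subst (ℕ._< toℕ k) (≡.sym (Fin.toℕ-lower₁ i r≢i)) i<k))
                  (≡.cong (P j) (Fin.inject₁-lower₁ i r≢i)))))) (t∣Ac i′)
            where
            r≢i : r ≢ toℕ i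
            r≢i r≡i = ℕ.<⇒≱ i<k (≡.subst (toℕ k ℕ.≤_) r≡i (Fin.toℕ≤pred[n] k))
            i′ = lower₁ i r≢i
          ... | no i≮k = sum-∣ (λ j → P j i * c j) t∣term
            where
            t∣term : ∀ j → t ∣ P j i * c j
            t∣term j with toℕ j ℕ.≤? toℕ k
            ... | yes j≤k = ∣-*ʳ (c j) (t∣P i j j≤k (ℕ.≮⇒≥ i≮k))
            ... | no j≰k  = ∣-*ˡ (P j i) (t∣c j (ℕ.≰⇒> j≰k))

          y z : Fin (suc r) → Carrier
          y i = proj₁ (t∣Pc i)
          z = proj₁ (IsBasis.spanning D′.target-basis (N.combination y D.target))

          -- The combination with coefficients c vanishes modulo t, so uniqueness of coefficients in
          -- the second target basis puts every coordinate of c into t S, including the unit one.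
          c≈tz : ∀ j → c j ≈ t * z j
          c≈tz = BasisProperties.coefficients-unique S N D′.target D′.target-basis c (λ j → t * z j) (begin
            N.combination c D′.target
              ≈⟨ N.sum-cong-≋ (λ j → N.*ₗ-congˡ {c j} (proj₂ (IsBasis.spanning D.target-basis (D′.target j)))) ⟩
            N.sum (λ j → c j N.*ₗ N.combination (P j) D.target)
              ≈⟨ N.sum-cong-≋ (λ j → N.combination-* (c j) (P j) D.target) ⟨
            N.sum (λ j → N.sum (λ i → (c j * P j i) N.*ₗ D.target i))
              ≈⟨ N.∑-comm (λ j i → (c j * P j i) N.*ₗ D.target i) ⟩
            N.sum (λ i → N.sum (λ j → (c j * P j i) N.*ₗ D.target i))
              ≈⟨ N.sum-cong-≋ (λ i → N.*ₗ-distribʳ-sum (λ j → c j * P j i) (D.target i)) ⟨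
            N.sum (λ i → sum (λ j → c j * P j i) N.*ₗ D.target i)
              ≈⟨ N.sum-cong-≋ (λ i → N.*ₗ-cong (trans (sum-cong-≋ (λ j → *-comm (c j) (P j i))) (proj₂ (t∣Pc i))) (N.≈ᴹ-refl {D.target i})) ⟩
            N.combination (λ i → t * y i) D.target
              ≈⟨ N.combination-* t y D.target ⟩
            t N.*ₗ N.combination y D.target
              ≈⟨ N.*ₗ-congˡ (proj₂ (IsBasis.spanning D′.target-basis (N.combination y D.target))) ⟩
            t N.*ₗ N.combination z D′.target
              ≈⟨ N.combination-* t z D′.target ⟨
            N.combination (λ j → t * z j) D′.target ∎)
            where open SetoidReasoning N.≈ᴹ-setoid

-- Newton bases

module _ (S : CommutativeRing ℓᵃ ℓ₁) {I : Set ℓᵇ} where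
  private Sᴵ = powerModule S I
  open CommutativeRing S hiding (zero)
  open RingLemmas S
  open LeftModule Sᴵ using (Carrierᴹ; _≈ᴹ_; 0ᴹ)

  -- The coordinate set I is not `Fin r`; `index` and `point` identify it with the numbers below r,
  -- in the order that makes v triangular with units on the diagonal.
  module TriangularBasis
    {r : ℕ} (index : I → ℕ) (index<r : ∀ i → index i ℕ.< r)
    (point : ∀ k → k ℕ.< r → I) (index-point : ∀ k k<r → index (point k k<r) ≡ k)
    (point-index : ∀ i → point (index i) (index<r i) ≡ i)
    (v : ℕ → Carrierᴹ)
    (v-zero : ∀ k i → index i ℕ.< k → v k i ≈ 0#)
    (v-unit : ∀ k i → index i ≡ k → Unit (v k i))
    where
    open LinearCombinations ring Sᴵ
    open IntegerSolver S
    open SetoidReasoning setoid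

    private
      combination-at : ∀ {n} (q : Fin n → Carrier) (w : Fin n → Carrierᴹ) i →
        combination q w i ≈ LinearCombinations.sum ring TensorUnit.leftModule (λ k → q k * w k i)
      combination-at {ℕ.zero}  q w i = refl
      combination-at {ℕ.suc n} q w i = +-congˡ (combination-at (q ∘ suc) (w ∘ suc) i)

      -- Elimination from the first coordinate on: x already vanishes at the first k places, and
      -- subtracting a multiple of `v k` clears the next one. The number l of remaining places
      -- drives the recursion.
      spans : ∀ k l → k ℕ.+ l ≡ r → ∀ x → (∀ i → index i ℕ.< k → x i ≈ 0#) → Span (Below v r) x
      spans k ℕ.zero    k≡r x x≈0 = resp
        (λ i → sym (x≈0 i (≡.subst (index i ℕ.<_) (≡.trans (≡.sym k≡r) (ℕ.+-identityʳ k)) (index<r i)))) zero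
      spans k (ℕ.suc l) k+l≡r x x≈0 = resp (λ i → solve 3 (λ x c v → (x :- c :* v) :+ c :* v := x) refl (x i) c (v k i))
        (add (spans (suc k) l (≡.trans (≡.sym (ℕ.+-suc k l)) k+l≡r) (λ i → x i - c * v k i) vanish)
             (scale c (gen (k , k<r , λ _ → refl))))
        where
        k<r : k ℕ.< r
        k<r = ≡.subst (suc k ℕ.≤_) (≡.trans (≡.sym (ℕ.+-suc k l)) k+l≡r) (ℕ.m≤m+n (suc k) l)
        i₀ = point k k<r
        inverse = v-unit k i₀ (index-point k k<r)
        c = x i₀ * proj₁ inverse
        vanish : ∀ i → index i ℕ.< suc k → x i - c * v k i ≈ 0#
        vanish i i≤k with ℕ.m≤n⇒m<n∨m≡n (ℕ.s≤s⁻¹ i≤k)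
        ... | inj₁ i<k = begin
          x i - c * v k i  ≈⟨ +-cong (x≈0 i i<k) (-‿cong (*-congˡ (v-zero k i i<k))) ⟩
          0# - c * 0#      ≈⟨ solve 1 (λ c → :0 :- c :* :0 := :0) refl c ⟩
          0#               ∎
        ... | inj₂ i≡k = begin
          x i - c * v k i                          ≡⟨ ≡.cong (λ j → x j - c * v k j) i≡i₀ ⟩
          x i₀ - (x i₀ * proj₁ inverse) * v k i₀   ≈⟨ +-congˡ (-‿cong (*-assoc _ _ _)) ⟩
          x i₀ - x i₀ * (proj₁ inverse * v k i₀)   ≈⟨ +-congˡ (-‿cong (*-congˡ (proj₁ (proj₂ inverse)))) ⟩
          x i₀ - x i₀ * 1#                         ≈⟨ x≈y⇒x-y≈0 (sym (*-identityʳ _)) ⟩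
          0#                                       ∎
          where
          point-cong : ∀ {k l} k<r l<r → k ≡ l → point k k<r ≡ point l l<r
          point-cong k<r l<r ≡.refl = ≡.cong (point _) (ℕ.<-irrelevant k<r l<r)
          i≡i₀ : i ≡ i₀
          i≡i₀ = ≡.trans (≡.sym (point-index i)) (point-cong (index<r i) k<r i≡k)

      -- At place k the vectors of larger index vanish, and those of smaller index have coefficient
      -- 0 by induction, so a unit times q k is all that is left.
      independent-below : ∀ (q : Fin r → Carrier) → combination q (v ∘ toℕ) ≈ᴹ 0ᴹ →
        ∀ n k → toℕ k ℕ.< n → q k ≈ 0#
      independent-below q q≈0 (ℕ.suc n) k k≤n = unit-cancelˡ (q k) (v-unit (toℕ k) i (index-point _ _)) (begin
        v (toℕ k) i * q k          ≈⟨ *-comm _ _ ⟩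
        q k * v (toℕ k) i          ≈⟨ LinearCombinations.sum-single ring TensorUnit.leftModule (λ l → q l * v (toℕ l) i) k others ⟨
        LinearCombinations.sum ring TensorUnit.leftModule (λ l → q l * v (toℕ l) i) ≈⟨ combination-at q (v ∘ toℕ) i ⟨
        combination q (v ∘ toℕ) i  ≈⟨ q≈0 i ⟩
        0#                         ∎)
        where
        i = point (toℕ k) (Fin.toℕ<n k)
        others : ∀ l → l ≢ k → q l * v (toℕ l) i ≈ 0#
        others l l≢k with ℕ.<-cmp (toℕ l) (toℕ k)
        ... | tri< l<k _ _ = trans (*-congʳ (independent-below q q≈0 n l (ℕ.<-≤-trans l<k (ℕ.s≤s⁻¹ k≤n)))) (zeroˡ _)
        ... | tri≈ _ l≡k _ = ⊥-elim (l≢k (Fin.toℕ-injective l≡k))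
        ... | tri> _ _ k<l = trans (*-congˡ (v-zero (toℕ l) i (≡.subst (ℕ._< toℕ l) (≡.sym (index-point _ _)) k<l))) (zeroʳ _)

    triangular-basis : IsBasis S Sᴵ (v ∘ toℕ)
    triangular-basis = record
      { spanning    = λ x → Span-coefficients v (spans 0 r ≡.refl x λ _ ())
      ; independent = λ q q≈0 k → independent-below q q≈0 (suc (toℕ k)) k ℕ.≤-refl
      }

-- If w m l is the valuation of z m - z l, this is the valuation at z m of the
-- Newton polynomial (x - z 0) ⋯ (x - z (k - 1)).
newtonExponent : (ℕ → ℕ → ℕ) → ℕ → ℕ → ℕ
newtonExponent w ℕ.zero    m = 0
newtonExponent w (ℕ.suc k) m = newtonExponent w k m ℕ.+ w m k

module _ (S : CommutativeRing ℓᵃ ℓ₁) {I : Set ℓᵇ} where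
  private Sᴵ = powerModule S I
  open CommutativeRing S hiding (zero)
  open Exp semiring
  open RingLemmas S
  open LeftModule Sᴵ using (Carrierᴹ; _≈ᴹ_; _*ₗ_; _+ᴹ_; 0ᴹ)

  module NewtonBasis
    (t : Carrier) (t-regular : ∀ x → t * x ≈ 0# → x ≈ 0#)
    {r : ℕ} (index : I → ℕ) (index<r : ∀ i → index i ℕ.< r)
    (point : ∀ k → k ℕ.< r → I) (index-point : ∀ k k<r → index (point k k<r) ≡ k)
    (point-index : ∀ i → point (index i) (index<r i) ≡ i)
    (z : ℕ → Carrier) (w : ℕ → ℕ → ℕ)
    (z-z∼t^w : ∀ {l m} → l ℕ.< m → m ℕ.< r → ∃ λ u → Unit u × z m - z l ≈ u * t ^ w m l)
    where
    open IntegerSolver S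

    private exponent = newtonExponent w

    newton : ℕ → Carrier → Carrier
    newton ℕ.zero    x = 1#
    newton (ℕ.suc k) x = (x - z k) * newton k x

    newton-zero : ∀ k m → m ℕ.< k → newton k (z m) ≈ 0#
    newton-zero (ℕ.suc k) m m≤k with ℕ.m≤n⇒m<n∨m≡n (ℕ.s≤s⁻¹ m≤k)
    ... | inj₁ m<k    = trans (*-congˡ (newton-zero k m m<k)) (zeroʳ _)
    ... | inj₂ ≡.refl = trans (*-congʳ (-‿inverseʳ _)) (zeroˡ _)

    newton∼t^exponent : ∀ k m → k ℕ.≤ m → m ℕ.< r → ∃ λ u → Unit u × newton k (z m) ≈ u * t ^ exponent k m
    newton∼t^exponent ℕ.zero    m k≤m m<r = 1# , unit-1 , sym (*-identityˡ 1#)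
    newton∼t^exponent (ℕ.suc k) m k<m m<r =
      let u , u-unit , eq = newton∼t^exponent k m (ℕ.<⇒≤ k<m) m<r
          v , v-unit , eq′ = z-z∼t^w k<m m<r
      in v * u , unit-* v-unit u-unit , (begin
      (z m - z k) * newton k (z m)                        ≈⟨ *-cong eq′ eq ⟩
      (v * t ^ w m k) * (u * t ^ exponent k m)            ≈⟨ solve 4 (λ v a u b → (v :* a) :* (u :* b) := (v :* u) :* (b :* a)) refl v _ u _ ⟩
      (v * u) * (t ^ exponent k m * t ^ w m k)            ≈⟨ *-congˡ (^-homo-* t (exponent k m) (w m k)) ⟨
      (v * u) * t ^ (exponent k m ℕ.+ w m k)              ∎)
      where open SetoidReasoning setoid

    module _
      (minimal : ∀ k m → k ℕ.≤ m → m ℕ.< r → exponent k k ℕ.≤ exponent k m)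
      (M : LeftModule ring m₁ ℓ₂)
      where
      private module M = LeftModule M

      module _
        (f : M.Carrierᴹ → Carrierᴹ)
        (f-linear : LeftModuleMorphisms.IsLeftModuleHomomorphism M.rawLeftModule (LeftModule.rawLeftModule Sᴵ) f)
        (Θ : M.Carrierᴹ → M.Carrierᴹ)
        (Θ-linear : LeftModuleMorphisms.IsLeftModuleHomomorphism M.rawLeftModule M.rawLeftModule Θ)
        (v₀ : M.Carrierᴹ)
        (f-v₀ : ∀ i → f v₀ i ≈ 1#)
        (f-Θ : ∀ x i → f (Θ x) i ≈ z (index i) * f x i)
        (Θ^ : ℕ → M.Carrierᴹ) (Θ^0 : Θ^ 0 M.≈ᴹ v₀) (Θ^suc : ∀ k → Θ^ (suc k) M.≈ᴹ Θ (Θ^ k))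
        (Θ^-spans : ∀ x → LinearCombinations.Span ring M (LinearCombinations.Below ring M Θ^ r) x)
        where
        private
          module Θ = LeftModuleMorphisms.IsLeftModuleHomomorphism Θ-linear
          module f = LeftModuleMorphisms.IsLeftModuleHomomorphism f-linear
          module MC = LinearCombinations ring M

        e : ℕ → ℕ
        e k = exponent k k

        exponent-monoˡ : ∀ {k l} m → k ℕ.≤ l → exponent k m ℕ.≤ exponent l m
        exponent-monoˡ {l = ℕ.zero}  m z≤n = z≤n
        exponent-monoˡ {l = ℕ.suc l} m k≤l with ℕ.m≤n⇒m<n∨m≡n k≤l
        ... | inj₁ k<l    = ℕ.≤-trans (exponent-monoˡ m (ℕ.s≤s⁻¹ k<l)) (ℕ.m≤m+n _ (w m l))
        ... | inj₂ ≡.refl = ℕ.≤-refl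

        basis : ℕ → M.Carrierᴹ
        basis ℕ.zero    = v₀
        basis (ℕ.suc k) = Θ (basis k) M.+ᴹ (- z k) M.*ₗ basis k

        f-basis : ∀ k i → f (basis k) i ≈ newton k (z (index i))
        f-basis ℕ.zero    i = f-v₀ i
        f-basis (ℕ.suc k) i = begin
          f (Θ (basis k) M.+ᴹ (- z k) M.*ₗ basis k) i        ≈⟨ f.+ᴹ-homo _ _ i ⟩
          f (Θ (basis k)) i + f ((- z k) M.*ₗ basis k) i     ≈⟨ +-cong (f-Θ _ i) (f.*ₗ-homo _ _ i) ⟩
          z (index i) * f (basis k) i + - z k * f (basis k) i ≈⟨ distribʳ _ _ _ ⟨
          (z (index i) - z k) * f (basis k) i                ≈⟨ *-congˡ (f-basis k i) ⟩
          newton (suc k) (z (index i))                       ∎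
          where open SetoidReasoning setoid

        private
          quotient : ∀ k m → m ℕ.< r → ∃ λ v →
            (m ℕ.< k → v ≈ 0#) × (m ≡ k → Unit v) × newton k (z m) ≈ t ^ e k * v
          quotient k m m<r with m ℕ.<? k
          ... | yes m<k = 0# , (λ _ → refl) , (λ m≡k → ⊥-elim (ℕ.<⇒≢ m<k m≡k)) ,
                  trans (newton-zero k m m<k) (sym (zeroʳ _))
          ... | no m≮k =
            let u , u-unit , eq = newton∼t^exponent k m (ℕ.≮⇒≥ m≮k) m<r
                d = exponent k m ∸ e k
            in u * t ^ d , (λ m<k → ⊥-elim (m≮k m<k)) ,
               (λ m≡k → unit-* u-unit (unit-resp (^-congʳ t (≡.sym (≡.trans
                 (≡.cong (λ l → exponent k l ∸ e k) m≡k) (ℕ.n∸n≡0 (e k))))) unit-1)) , (begin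
            newton k (z m)              ≈⟨ eq ⟩
            u * t ^ exponent k m        ≈⟨ *-congˡ (^-congʳ t (ℕ.m+[n∸m]≡n (minimal k m (ℕ.≮⇒≥ m≮k) m<r))) ⟨
            u * t ^ (e k ℕ.+ d)         ≈⟨ *-congˡ (^-homo-* t (e k) d) ⟩
            u * (t ^ e k * t ^ d)       ≈⟨ solve 3 (λ u a b → u :* (a :* b) := a :* (u :* b)) refl u _ _ ⟩
            t ^ e k * (u * t ^ d)       ∎)
            where open SetoidReasoning setoid

        target : ℕ → Carrierᴹ
        target k i = proj₁ (quotient k (index i) (index<r i))

        f-basis≈t^e*target : ∀ k → f (basis k) ≈ᴹ (t ^ e k) *ₗ target k
        f-basis≈t^e*target k i = trans (f-basis k i) (proj₂ (proj₂ (proj₂ (quotient k (index i) (index<r i)))))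

        target-basis : IsBasis S Sᴵ (target ∘ toℕ)
        target-basis = TriangularBasis.triangular-basis S index index<r point index-point point-index target
          (λ k i → proj₁ (proj₂ (quotient k (index i) (index<r i))))
          (λ k i → proj₁ (proj₂ (proj₂ (quotient k (index i) (index<r i)))))

        private
          open MC using (Span; Below; gen; zero; add; scale; resp; Span-bind)

          -- Since Θ gₗ = gₗ₊₁ + zₗ gₗ, applying Θ raises the bound by only one, so that the kth
          -- power of Θ needs no vector beyond gₖ.
          Θ-Span : ∀ k {x} → Span (Below basis k) x → Span (Below basis (suc k)) (Θ x)
          Θ-Span k (gen {x} (l , l<k , x≈)) = resp Θx≈
            (add (gen (suc l , s≤s l<k , M.≈ᴹ-refl)) (scale (z l) (gen (l , ℕ.m<n⇒m<1+n l<k , M.≈ᴹ-refl))))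
            where
            open SetoidReasoning M.≈ᴹ-setoid
            g = basis l
            Θx≈ : (Θ g M.+ᴹ (- z l) M.*ₗ g) M.+ᴹ z l M.*ₗ g M.≈ᴹ Θ x
            Θx≈ = begin
              (Θ g M.+ᴹ (- z l) M.*ₗ g) M.+ᴹ z l M.*ₗ g ≈⟨ M.+ᴹ-assoc _ _ _ ⟩
              Θ g M.+ᴹ ((- z l) M.*ₗ g M.+ᴹ z l M.*ₗ g) ≈⟨ M.+ᴹ-congˡ (M.*ₗ-distribʳ g (- z l) (z l)) ⟨
              Θ g M.+ᴹ (- z l + z l) M.*ₗ g             ≈⟨ M.+ᴹ-congˡ (M.*ₗ-congʳ (-‿inverseˡ (z l))) ⟩
              Θ g M.+ᴹ 0# M.*ₗ g                        ≈⟨ M.+ᴹ-congˡ (M.*ₗ-zeroˡ g) ⟩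
              Θ g M.+ᴹ M.0ᴹ                             ≈⟨ M.+ᴹ-identityʳ _ ⟩
              Θ g                                       ≈⟨ Θ.⟦⟧-cong x≈ ⟨
              Θ x                                       ∎
          Θ-Span k zero         = resp (M.≈ᴹ-sym Θ.0ᴹ-homo) zero
          Θ-Span k (add x∈ y∈)  = resp (M.≈ᴹ-sym (Θ.+ᴹ-homo _ _)) (add (Θ-Span k x∈) (Θ-Span k y∈))
          Θ-Span k (scale s x∈) = resp (M.≈ᴹ-sym (Θ.*ₗ-homo _ _)) (scale s (Θ-Span k x∈))
          Θ-Span k (resp p x∈)  = resp (Θ.⟦⟧-cong p) (Θ-Span k x∈)

          Θ^∈Span : ∀ k → Span (Below basis (suc k)) (Θ^ k)
          Θ^∈Span ℕ.zero    = resp (M.≈ᴹ-sym Θ^0) (gen (0 , s≤s z≤n , M.≈ᴹ-refl))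
          Θ^∈Span (ℕ.suc k) = resp (M.≈ᴹ-sym (Θ^suc k)) (Θ-Span (suc k) (Θ^∈Span k))

        spanning : ∀ x → ∃ λ (q : Fin r → Carrier) → x M.≈ᴹ MC.combination q (basis ∘ toℕ)
        spanning x = MC.Span-coefficients basis (Span-bind (λ (k , k<r , x≈) → resp (M.≈ᴹ-sym x≈)
          (Span-bind (λ (l , l≤k , y≈) → gen (l , ℕ.≤-trans l≤k k<r , y≈)) (Θ^∈Span k))) (Θ^-spans x))

        -- The images are the vectors t^eₖ times a basis of the target, independent because t is
        -- regular. Both the freeness of the source and the injectivity of f follow from this;
        -- neither is presupposed.
        f-independent : ∀ (q : Fin r → Carrier) → f (MC.combination q (basis ∘ toℕ)) ≈ᴹ 0ᴹ → ∀ k → q k ≈ 0#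
        f-independent q fq≈0 k = ^-regular t-regular (e (toℕ k)) (q k) (trans (*-comm _ _)
          (IsBasis.independent target-basis (λ l → q l * t ^ e (toℕ l)) (begin
            NC.combination (λ l → q l * t ^ e (toℕ l)) (target ∘ toℕ)
              ≈⟨ NC.sum-cong-≋ {r} (λ l → LeftModule.*ₗ-assoc Sᴵ (q l) (t ^ e (toℕ l)) (target (toℕ l))) ⟩
            NC.sum (λ l → q l *ₗ ((t ^ e (toℕ l)) *ₗ target (toℕ l)))
              ≈⟨ NC.sum-cong-≋ {r} (λ l i → *-congˡ (sym (f-basis≈t^e*target (toℕ l) i))) ⟩
            NC.combination q (f ∘ basis ∘ toℕ)
              ≈⟨ LinearMap.f-combination S M Sᴵ f f-linear q (basis ∘ toℕ) ⟨
            f (MC.combination q (basis ∘ toℕ))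
              ≈⟨ fq≈0 ⟩
            0ᴹ ∎) k))
          where
          open SetoidReasoning (LeftModule.≈ᴹ-setoid Sᴵ)
          module NC = LinearCombinations ring Sᴵ

        f-kernel : ∀ x → f x ≈ᴹ 0ᴹ → x M.≈ᴹ M.0ᴹ
        f-kernel x fx≈0 =
          let q , x≈ = spanning x
              q≈0 = f-independent q (λ i → trans (sym (f.⟦⟧-cong x≈ i)) (fx≈0 i))
          in M.≈ᴹ-trans x≈ (MC.sum-zero {r} _ (λ k → M.≈ᴹ-trans (M.*ₗ-congʳ (q≈0 k)) (M.*ₗ-zeroˡ (basis (toℕ k)))))

        elementary-divisors : HasElementaryDivisors S t M Sᴵ f {r} (e ∘ toℕ)
        elementary-divisors = record
          { monotone     = λ {k} {l} k≤l → ℕ.≤-trans (minimal (toℕ k) (toℕ l) k≤l (Fin.toℕ<n l)) (exponent-monoˡ (toℕ l) k≤l)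
          ; source       = basis ∘ toℕ
          ; source-basis = record
            { spanning    = spanning
            ; independent = λ q q≈0 → f-independent q (λ i → trans (f.⟦⟧-cong q≈0 i) (f.0ᴹ-homo i))
            }
          ; target       = target ∘ toℕ
          ; target-basis = target-basis
          ; unit         = λ _ → 1#
          ; unit-inv     = λ _ → unit-1
          ; diagonal     = λ k i → trans (f-basis≈t^e*target (toℕ k) i) (*-congʳ (sym (*-identityˡ _)))
          }

-- Integers prime to p

module Counting where
  open import Data.Nat.Base using (_+_; _*_; _^_; _≤_; _<_)
  open import Data.Nat.Divisibility
  open import Data.Nat.DivMod using (_/_; _%_; m≡m%n+[m/n]*n; m%n<n)
  open import Data.Nat.Properties
  open import Relation.Binary.PropositionalEquality using (refl; sym; trans; cong; cong₂; subst)

  ⟦_∣_⟧ : ℕ → ℕ → ℕ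
  ⟦ m ∣ d ⟧ = if does (m ∣? d) then 1 else 0

  ⟦∣⟧-yes : ∀ {m d} → m ∣ d → ⟦ m ∣ d ⟧ ≡ 1
  ⟦∣⟧-yes {m} {d} m∣d = cong (if_then 1 else 0) (dec-true (m ∣? d) m∣d)

  ⟦∣⟧-no : ∀ {m d} → m ∤ d → ⟦ m ∣ d ⟧ ≡ 0
  ⟦∣⟧-no {m} {d} m∤d = cong (if_then 1 else 0) (dec-false (m ∣? d) m∤d)

  -- This is ⌊x / m⌋ in counting form, which fits the recursion along the integers prime to p.
  multiples : ℕ → ℕ → ℕ
  multiples m zero    = 0
  multiples m (suc x) = multiples m x + ⟦ m ∣ suc x ⟧

  multiples-floor : ∀ m q {c} → c < m → multiples m (q * m + c) ≡ q
  multiples-floor m zero    {zero}  c<m = refl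
  multiples-floor (suc m) (suc q) {zero}  c<m = begin
    multiples (suc m) (suc m + q * suc m + 0)
      ≡⟨ cong (multiples (suc m)) (trans (+-identityʳ _) (cong suc (+-comm m (q * suc m)))) ⟩
    multiples (suc m) (q * suc m + m) + ⟦ suc m ∣ suc (q * suc m + m) ⟧
      ≡⟨ cong₂ _+_ (multiples-floor (suc m) q ≤-refl)
           (⟦∣⟧-yes (divides (suc q) (cong suc (+-comm (q * suc m) m)))) ⟩
    q + 1
      ≡⟨ +-comm q 1 ⟩
    suc q ∎
    where open ≡.≡-Reasoning
  multiples-floor m q {suc c} c<m = begin
    multiples m (q * m + suc c)                             ≡⟨ cong (multiples m) (+-suc (q * m) c) ⟩
    multiples m (q * m + c) + ⟦ m ∣ suc (q * m + c) ⟧       ≡⟨ cong₂ _+_ (multiples-floor m q (<⇒≤ c<m)) (⟦∣⟧-no m∤) ⟩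
    q + 0                                                   ≡⟨ +-identityʳ q ⟩
    q                                                       ∎
    where
    open ≡.≡-Reasoning
    m∤ : m ∤ suc (q * m + c)
    m∤ m∣ = <⇒≱ c<m (∣⇒≤ (∣m+n∣m⇒∣n (subst (m ∣_) (sym (+-suc (q * m) c)) m∣) (divides q refl)))

  multiples-mono : ∀ m {x y} → x ≤ y → multiples m x ≤ multiples m y
  multiples-mono m {y = zero}  z≤n = z≤n
  multiples-mono m {y = suc y} x≤y with m≤n⇒m<n∨m≡n x≤y
  ... | inj₁ x<y  = ≤-trans (multiples-mono m (ℕ.s≤s⁻¹ x<y)) (m≤m+n _ _)
  ... | inj₂ refl = ≤-refl

  -- The inequality ⌊x / m⌋ + ⌊y / m⌋ ≤ ⌊(x + y) / m⌋, the sole source of minimality of the Newton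
  -- exponents on the diagonal.
  multiples-superadditive : ∀ m .{{_ : ℕ.NonZero m}} x y → multiples m x + multiples m y ≤ multiples m (x + y)
  multiples-superadditive m x y = begin
    multiples m x + multiples m y
      ≡⟨ cong₂ (λ u v → multiples m u + multiples m v) (div x) (div y) ⟩
    multiples m (x / m * m + x % m) + multiples m (y / m * m + y % m)
      ≡⟨ cong₂ _+_ (multiples-floor m (x / m) (m%n<n x m)) (multiples-floor m (y / m) (m%n<n y m)) ⟩
    x / m + y / m
      ≡⟨ multiples-floor m (x / m + y / m) (ℕ.>-nonZero⁻¹ m) ⟨
    multiples m ((x / m + y / m) * m + 0)
      ≤⟨ multiples-mono m (≤-trans (≤-reflexive (trans (+-identityʳ _) (*-distribʳ-+ m (x / m) (y / m))))
           (+-mono-≤ (≤-trans (m≤m+n _ (x % m)) (≤-reflexive (sym (div x))))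
                     (≤-trans (m≤m+n _ (y % m)) (≤-reflexive (sym (div y)))))) ⟩
    multiples m (x + y) ∎
    where
    open ≤-Reasoning
    div : ∀ x → x ≡ x / m * m + x % m
    div x = trans (m≡m%n+[m/n]*n x m) (+-comm (x % m) _)

  N-suc : ∀ p j → N p (suc j) + ⟦ p ∣ suc j ⟧ ≡ suc (N p j)
  N-suc p j = begin
    length (filter P? (upTo (2 + j))) + ⟦ p ∣ suc j ⟧
      ≡⟨ cong (λ l → length (filter P? l) + ⟦ p ∣ suc j ⟧) (List.upTo-∷ʳ (suc j)) ⟨
    length (filter P? (upTo (suc j) ++ [ suc j ])) + ⟦ p ∣ suc j ⟧
      ≡⟨ cong (λ l → length l + ⟦ p ∣ suc j ⟧) (List.filter-++ P? (upTo (suc j)) [ suc j ]) ⟩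
    length (filter P? (upTo (suc j)) ++ filter P? [ suc j ]) + ⟦ p ∣ suc j ⟧
      ≡⟨ cong (_+ ⟦ p ∣ suc j ⟧) (List.length-++ (filter P? (upTo (suc j)))) ⟩
    N p j + length (filter P? [ suc j ]) + ⟦ p ∣ suc j ⟧
      ≡⟨ +-assoc (N p j) _ _ ⟩
    N p j + (length (filter P? [ suc j ]) + ⟦ p ∣ suc j ⟧)
      ≡⟨ cong (λ z → N p j + z) last ⟩
    N p j + 1
      ≡⟨ +-comm (N p j) 1 ⟩
    suc (N p j) ∎
    where
    open ≡.≡-Reasoning
    P? = λ i → ¬? (p ∣? i)
    last : length (filter P? [ suc j ]) + ⟦ p ∣ suc j ⟧ ≡ 1
    last with p ∣? suc j
    ... | yes _ = refl
    ... | no  _ = refl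

  N-multiples : ∀ p j → N p j + multiples p j ≡ j
  N-multiples p zero with p ∣? 0
  ... | yes _  = refl
  ... | no p∤0 = ⊥-elim (p∤0 (p ∣0))
  N-multiples p (suc j) = begin
    N p (suc j) + (multiples p j + ⟦ p ∣ suc j ⟧)  ≡⟨ cong (λ z → N p (suc j) + z) (+-comm (multiples p j) _) ⟩
    N p (suc j) + (⟦ p ∣ suc j ⟧ + multiples p j)  ≡⟨ +-assoc (N p (suc j)) _ _ ⟨
    N p (suc j) + ⟦ p ∣ suc j ⟧ + multiples p j    ≡⟨ cong (_+ multiples p j) (N-suc p j) ⟩
    suc (N p j + multiples p j)                    ≡⟨ cong suc (N-multiples p j) ⟩
    suc j                                          ∎
    where open ≡.≡-Reasoning

  N-mono : ∀ p {i j} → i ≤ j → N p i ≤ N p j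
  N-mono p {j = zero}  z≤n = ≤-refl
  N-mono p {j = suc j} i≤j with m≤n⇒m<n∨m≡n i≤j
  ... | inj₂ refl = ≤-refl
  ... | inj₁ i<j  = ≤-trans (N-mono p (ℕ.s≤s⁻¹ i<j)) (ℕ.s≤s⁻¹ (begin
    suc (N p j)                 ≡⟨ N-suc p j ⟨
    N p (suc j) + ⟦ p ∣ suc j ⟧ ≤⟨ +-monoʳ-≤ (N p (suc j)) (⟦∣⟧≤1 p (suc j)) ⟩
    N p (suc j) + 1             ≡⟨ +-comm _ 1 ⟩
    suc (N p (suc j))           ∎))
    where
    open ≤-Reasoning
    ⟦∣⟧≤1 : ∀ m d → ⟦ m ∣ d ⟧ ≤ 1
    ⟦∣⟧≤1 m d with m ∣? d
    ... | yes _ = ≤-refl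
    ... | no  _ = z≤n

  prime⇒2≤ : ∀ {p} → Prime p → 2 ≤ p
  prime⇒2≤ {zero}        p-prime = ⊥-elim (¬prime[0] p-prime)
  prime⇒2≤ {suc zero}    p-prime = ⊥-elim (¬prime[1] p-prime)
  prime⇒2≤ {suc (suc p)} p-prime = s≤s (s≤s z≤n)

  module PrimeTo {p : ℕ} (p-prime : Prime p) where

    instance
      p≢0 : ℕ.NonZero p
      p≢0 = ℕ.>-nonZero (<⇒≤ (prime⇒2≤ p-prime))

    p∤1 : p ∤ 1
    p∤1 p∣1 = <⇒≱ (prime⇒2≤ p-prime) (∣⇒≤ p∣1)

    -- A step of one or two suffices, as p ≥ 2 does not divide two consecutive integers.
    next : ℕ → ℕ
    next j with p ∣? suc j
    ... | yes _ = 2 + j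
    ... | no  _ = suc j

    next-cases : ∀ j → (p ∣ suc j × next j ≡ 2 + j) ⊎ (p ∤ suc j × next j ≡ suc j)
    next-cases j with p ∣? suc j
    ... | yes p∣j = inj₁ (p∣j , refl)
    ... | no  p∤j = inj₂ (p∤j , refl)

    p∤suc : ∀ {j} → p ∣ j → p ∤ suc j
    p∤suc {j} p∣j p∣j+1 = p∤1 (∣m+n∣m⇒∣n (subst (p ∣_) (+-comm 1 j) p∣j+1) p∣j)

    -- The increasing enumeration of the positive integers prime to p.
    nth : ℕ → ℕ
    nth zero    = 1
    nth (suc k) = next (nth k)

    p∤nth : ∀ k → p ∤ nth k
    p∤nth zero = p∤1
    p∤nth (suc k) with next-cases (nth k)
    ... | inj₁ (p∣ , eq) = subst (p ∤_) (sym eq) (p∤suc p∣)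
    ... | inj₂ (p∤ , eq) = subst (p ∤_) (sym eq) p∤

    nth<nth-suc : ∀ k → nth k < nth (suc k)
    nth<nth-suc k with next-cases (nth k)
    ... | inj₁ (_ , eq) = subst (nth k <_) (sym eq) (m≤n+m (suc (nth k)) 1)
    ... | inj₂ (_ , eq) = ≤-reflexive (sym eq)

    nth-mono-≤ : ∀ {k l} → k ≤ l → nth k ≤ nth l
    nth-mono-≤ {l = zero}  z≤n = ≤-refl
    nth-mono-≤ {l = suc l} k≤l with m≤n⇒m<n∨m≡n k≤l
    ... | inj₁ k<l  = ≤-trans (nth-mono-≤ (ℕ.s≤s⁻¹ k<l)) (<⇒≤ (nth<nth-suc l))
    ... | inj₂ refl = ≤-refl

    nth-mono-< : ∀ {k l} → k < l → nth k < nth l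
    nth-mono-< {k} k<l = <-≤-trans (nth<nth-suc k) (nth-mono-≤ k<l)

    N-suc-∣ : ∀ {j} → p ∣ suc j → N p (suc j) ≡ N p j
    N-suc-∣ {j} p∣ = suc-injective (trans (+-comm 1 _) (trans (cong (λ z → N p (suc j) + z) (sym (⟦∣⟧-yes p∣))) (N-suc p j)))

    N-suc-∤ : ∀ {j} → p ∤ suc j → N p (suc j) ≡ suc (N p j)
    N-suc-∤ {j} p∤ = trans (sym (+-identityʳ _)) (trans (cong (λ z → N p (suc j) + z) (sym (⟦∣⟧-no p∤))) (N-suc p j))

    N-nth : ∀ k → N p (nth k) ≡ suc k
    N-nth zero = trans (N-suc-∤ p∤1) (cong suc (trans (sym (+-identityʳ _)) (N-multiples p 0)))
    N-nth (suc k) with next-cases (nth k)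
    ... | inj₁ (p∣ , eq) = trans (cong (N p) eq) (trans (N-suc-∤ (p∤suc p∣)) (cong suc (trans (N-suc-∣ p∣) (N-nth k))))
    ... | inj₂ (p∤ , eq) = trans (cong (N p) eq) (trans (N-suc-∤ p∤) (cong suc (N-nth k)))

    -- Any number is bracketed by two consecutive values of `nth`, and strictly between those there
    -- is at most a multiple of p.
    nth-surjective : ∀ j → p ∤ j → ∃ λ k → nth k ≡ j
    nth-surjective zero    p∤j = ⊥-elim (p∤j (p ∣0))
    nth-surjective (suc j) p∤j with bracket j
      where
      bracket : ∀ j → ∃ λ k → nth k ≤ suc j × suc j < nth (suc k)
      bracket zero    = 0 , ≤-refl , nth<nth-suc 0
      bracket (suc j) with bracket j
      ... | k , k≤ , <k with m≤n⇒m<n∨m≡n <k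
      ...   | inj₁ j<k = k , m≤n⇒m≤1+n k≤ , j<k
      ...   | inj₂ j≡k = suc k , ≤-reflexive (sym j≡k) , subst (_< nth (2 + k)) (sym j≡k) (nth<nth-suc (suc k))
    ... | k , k≤ , <k with m≤n⇒m<n∨m≡n k≤
    ...   | inj₂ k≡ = k , k≡
    ...   | inj₁ k< with next-cases (nth k)
    ...     | inj₂ (_ , eq) = ⊥-elim (<⇒≱ (subst (suc j <_) eq <k) k<)
    ...     | inj₁ (p∣ , eq) = ⊥-elim (p∤j (subst (p ∣_) (≤-antisym k< (ℕ.s≤s⁻¹ (subst (suc j <_) eq <k))) p∣))

    N-p^ : ∀ m → N p (p ^ suc m) ≡ (p ∸ 1) * p ^ m
    N-p^ m = +-cancelʳ-≡ (p ^ m) _ _ (begin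
      N p (p * p ^ m) + p ^ m                              ≡⟨ cong (λ z → N p (p * p ^ m) + z) (multiples-floor p (p ^ m) (<⇒≤ (prime⇒2≤ p-prime))) ⟨
      N p (p * p ^ m) + multiples p (p ^ m * p + 0)        ≡⟨ cong (λ x → N p (p * p ^ m) + multiples p x) (trans (+-identityʳ _) (*-comm (p ^ m) p)) ⟩
      N p (p * p ^ m) + multiples p (p * p ^ m)            ≡⟨ N-multiples p (p * p ^ m) ⟩
      p * p ^ m                                            ≡⟨ cong (_* p ^ m) (m∸n+n≡m (<⇒≤ (prime⇒2≤ p-prime))) ⟨
      (p ∸ 1 + 1) * p ^ m                                  ≡⟨ *-distribʳ-+ (p ^ m) (p ∸ 1) 1 ⟩
      (p ∸ 1) * p ^ m + 1 * p ^ m                          ≡⟨ cong (λ z → (p ∸ 1) * p ^ m + z) (*-identityˡ (p ^ m)) ⟩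
      (p ∸ 1) * p ^ m + p ^ m                              ∎)
      where open ≡.≡-Reasoning

    nth<p^⇒k<rank : ∀ m k → nth k < p ^ suc m → k < (p ∸ 1) * p ^ m
    nth<p^⇒k<rank m k lt = begin
      suc k              ≡⟨ N-nth k ⟨
      N p (nth k)        ≤⟨ N-mono p (<⇒≤ lt) ⟩
      N p (p ^ suc m)    ≡⟨ N-p^ m ⟩
      (p ∸ 1) * p ^ m    ∎
      where open ≤-Reasoning

    k<rank⇒nth<p^ : ∀ m k → k < (p ∸ 1) * p ^ m → nth k < p ^ suc m
    k<rank⇒nth<p^ m k k<r = ≰⇒> λ p^≤ → <⇒≱ k<r (ℕ.s≤s⁻¹ (begin
      suc ((p ∸ 1) * p ^ m)   ≡⟨ cong suc (N-p^ m) ⟨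
      suc (N p (p ^ suc m))   ≤⟨ N-< (≤∧≢⇒< p^≤ λ eq → p∤nth k (subst (p ∣_) eq (m∣m*n (p ^ m)))) (p∤nth k) ⟩
      N p (nth k)             ≡⟨ N-nth k ⟩
      suc k                   ∎))
      where
      open ≤-Reasoning
      N-< : ∀ {i j} → i < j → p ∤ j → suc (N p i) ≤ N p j
      N-< {i} {suc j} i≤j p∤j = ≤-trans (s≤s (N-mono p (ℕ.s≤s⁻¹ i≤j))) (≤-reflexive (sym (N-suc-∤ p∤j)))

    -- For s ≥ v this is p^v when d = p^v d′ with p ∤ d′.
    p-part : ℕ → ℕ → ℕ
    p-part zero    d = 1
    p-part (suc s) d = p-part s d + (p ^ suc s ∸ p ^ s) * ⟦ p ^ suc s ∣ d ⟧

    private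
      p^s≤p^1+s : ∀ s → p ^ s ≤ p ^ suc s
      p^s≤p^1+s s = m≤n*m (p ^ s) p

      p-part-∣ : ∀ s d → p ^ s ∣ d → p-part s d ≡ p ^ s
      p-part-∣ zero    d p∣d = refl
      p-part-∣ (suc s) d p∣d = begin
        p-part s d + (p ^ suc s ∸ p ^ s) * ⟦ p ^ suc s ∣ d ⟧
          ≡⟨ cong₂ (λ x y → x + (p ^ suc s ∸ p ^ s) * y) (p-part-∣ s d (∣-trans (n∣m*n p) p∣d)) (⟦∣⟧-yes p∣d) ⟩
        p ^ s + (p ^ suc s ∸ p ^ s) * 1
          ≡⟨ cong (λ z → p ^ s + z) (*-identityʳ _) ⟩
        p ^ s + (p ^ suc s ∸ p ^ s)
          ≡⟨ m+[n∸m]≡n (p^s≤p^1+s s) ⟩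
        p ^ suc s ∎
        where open ≡.≡-Reasoning

    p-part-p^v*d : ∀ s v d → v ≤ s → p ∤ d → p-part s (p ^ v * d) ≡ p ^ v
    p-part-p^v*d s v d v≤s p∤d with m≤n⇒m<n∨m≡n v≤s
    p-part-p^v*d s v d v≤s p∤d | inj₂ refl = p-part-∣ v _ (m∣m*n d)
    p-part-p^v*d (suc s) v d v≤s p∤d | inj₁ v<s = begin
      p-part s (p ^ v * d) + (p ^ suc s ∸ p ^ s) * ⟦ p ^ suc s ∣ p ^ v * d ⟧
        ≡⟨ cong₂ (λ x y → x + (p ^ suc s ∸ p ^ s) * y) (p-part-p^v*d s v d (ℕ.s≤s⁻¹ v<s) p∤d) (⟦∣⟧-no ∤) ⟩
      p ^ v + (p ^ suc s ∸ p ^ s) * 0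
        ≡⟨ cong (λ z → p ^ v + z) (*-zeroʳ (p ^ suc s ∸ p ^ s)) ⟩
      p ^ v + 0
        ≡⟨ +-identityʳ _ ⟩
      p ^ v ∎
      where
      open ≡.≡-Reasoning
      ∤ : p ^ suc s ∤ p ^ v * d
      ∤ p∣ = p∤d (*-cancelˡ-∣ (p ^ v) {{m^n≢0 p v}} (∣-trans (subst (_∣ p ^ suc s) (*-comm p (p ^ v)) (p^∣ (ℕ.s≤s⁻¹ v<s))) p∣))
        where
        p^∣ : v ≤ s → p ^ suc v ∣ p ^ suc s
        p^∣ v≤s = divides (p ^ (s ∸ v)) (trans (cong (p ^_) (sym (m+[n∸m]≡n (s≤s v≤s))))
          (trans (^-distribˡ-+-* p (suc v) (s ∸ v)) (*-comm (p ^ suc v) _)))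

    p-adic-factor : ∀ n d → 0 < d → d < p ^ n → ∃₂ λ v d′ → v < n × p ∤ d′ × d ≡ p ^ v * d′
    p-adic-factor zero    d 0<d d<1 = ⊥-elim (<⇒≱ 0<d (ℕ.s≤s⁻¹ d<1))
    p-adic-factor (suc n) d 0<d d<p^ with p ∣? d
    ... | no p∤d = 0 , d , s≤s z≤n , p∤d , sym (*-identityˡ d)
    ... | yes (divides q refl) with p-adic-factor n q (n≢0⇒n>0 λ { refl → <⇒≢ 0<d refl })
                                     (*-cancelˡ-< p _ _ (subst (_< p * p ^ n) (*-comm q p) d<p^))
    ...   | v , d′ , v<n , p∤d′ , refl = suc v , d′ , s≤s v<n , p∤d′ ,
                trans (*-comm (p ^ v * d′) p) (sym (*-assoc p (p ^ v) d′))

    weight : ℕ → ℕ → ℕ → ℕ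
    weight s m l = p-part s (nth m ∸ nth l)

    congruent : ℕ → ℕ → ℕ → ℕ
    congruent q zero    m = 0
    congruent q (suc k) m = congruent q k m + ⟦ q ∣ nth m ∸ nth k ⟧

    -- Put c = `nth m`. Both sides count the multiples of q among the numbers c - x with 0 ≤ x < c,
    -- the left side only over x ≥ `nth k` and those x that `nth` enumerates before. The omitted x
    -- are multiples of p, so c - x is prime to p and no multiple of q.
    congruent-multiples : ∀ q k m → p ∣ q → k ≤ m →
      congruent q k m + multiples q (nth m ∸ nth k) ≡ multiples q (nth m)
    congruent-multiples q zero m p∣q k≤m = sym (begin
      multiples q (nth m)                            ≡⟨ cong (multiples q) nth≡ ⟨
      multiples q (nth m ∸ 1) + ⟦ q ∣ suc (nth m ∸ 1) ⟧ ≡⟨ cong (λ z → multiples q (nth m ∸ 1) + z) (⟦∣⟧-no λ q∣ → p∤nth m (∣-trans p∣q (subst (q ∣_) nth≡ q∣))) ⟩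
      multiples q (nth m ∸ 1) + 0                    ≡⟨ +-identityʳ _ ⟩
      multiples q (nth m ∸ 1)                        ∎)
      where
      open ≡.≡-Reasoning
      nth≡ : suc (nth m ∸ 1) ≡ nth m
      nth≡ = m+[n∸m]≡n (nth-mono-≤ {0} {m} z≤n)
    congruent-multiples q (suc k) m p∣q k<m = begin
      congruent q k m + ⟦ q ∣ c ∸ j ⟧ + multiples q (c ∸ nth (suc k))
        ≡⟨ cong (λ z → congruent q k m + ⟦ q ∣ c ∸ j ⟧ + z) skip ⟩
      congruent q k m + ⟦ q ∣ c ∸ j ⟧ + multiples q (c ∸ suc j)
        ≡⟨ +-assoc (congruent q k m) _ _ ⟩
      congruent q k m + (⟦ q ∣ c ∸ j ⟧ + multiples q (c ∸ suc j))
        ≡⟨ cong (λ z → congruent q k m + z) (trans (+-comm ⟦ q ∣ c ∸ j ⟧ _) (cong (λ x → multiples q (c ∸ suc j) + ⟦ q ∣ x ⟧) (sym c∸j))) ⟩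
      congruent q k m + multiples q (suc (c ∸ suc j))
        ≡⟨ cong (λ x → congruent q k m + multiples q x) c∸j ⟩
      congruent q k m + multiples q (c ∸ j)
        ≡⟨ congruent-multiples q k m p∣q (<⇒≤ k<m) ⟩
      multiples q c ∎
      where
      open ≡.≡-Reasoning
      c = nth m
      j = nth k
      c∸j : suc (c ∸ suc j) ≡ c ∸ j
      c∸j = sym (+-∸-assoc 1 (nth-mono-< k<m))
      skip : multiples q (c ∸ nth (suc k)) ≡ multiples q (c ∸ suc j)
      skip with next-cases j
      ... | inj₂ (_ , eq)  = cong (λ x → multiples q (c ∸ x)) eq
      ... | inj₁ (p∣ , eq) = begin
        multiples q (c ∸ nth (suc k))                            ≡⟨ cong (λ x → multiples q (c ∸ x)) eq ⟩
        multiples q (c ∸ (2 + j))                                ≡⟨ +-identityʳ _ ⟨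
        multiples q (c ∸ (2 + j)) + 0                            ≡⟨ cong (λ z → multiples q (c ∸ (2 + j)) + z) (⟦∣⟧-no q∤) ⟨
        multiples q (suc (c ∸ (2 + j)))                          ≡⟨ cong (multiples q) c∸1+j ⟩
        multiples q (c ∸ suc j)                                  ∎
        where
        2+j≤c : 2 + j ≤ c
        2+j≤c = subst (_≤ c) eq (nth-mono-≤ k<m)
        c∸1+j : suc (c ∸ (2 + j)) ≡ c ∸ suc j
        c∸1+j = sym (+-∸-assoc 1 2+j≤c)
        q∤ : q ∤ suc (c ∸ (2 + j))
        q∤ q∣ = p∤nth m (∣m∸n∣n⇒∣m p (<⇒≤ 2+j≤c) (∣-trans p∣q (subst (q ∣_) c∸1+j q∣)) p∣)

    newtonExponent-zero : ∀ k m → newtonExponent (weight 0) k m ≡ k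
    newtonExponent-zero zero    m = refl
    newtonExponent-zero (suc k) m = trans (cong (_+ 1) (newtonExponent-zero k m)) (+-comm k 1)

    -- By the recursion of `p-part`, passing to level s + 1 adds p^(s + 1) - p^s for each difference
    -- divisible by p^(s + 1), so the sum of weights becomes a count of congruences.
    newtonExponent-suc : ∀ s k m → newtonExponent (weight (suc s)) k m
      ≡ newtonExponent (weight s) k m + (p ^ suc s ∸ p ^ s) * congruent (p ^ suc s) k m
    newtonExponent-suc s zero    m = sym (*-zeroʳ (p ^ suc s ∸ p ^ s))
    newtonExponent-suc s (suc k) m = begin
      newtonExponent (weight (suc s)) k m + (a + b * i)
        ≡⟨ cong (_+ (a + b * i)) (newtonExponent-suc s k m) ⟩
      e + b * r + (a + b * i)
        ≡⟨ +-assoc e _ _ ⟩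
      e + (b * r + (a + b * i))
        ≡⟨ cong (λ z → e + z) (trans (sym (+-assoc (b * r) a _)) (trans (cong (_+ b * i) (+-comm (b * r) a)) (+-assoc a _ _))) ⟩
      e + (a + (b * r + b * i))
        ≡⟨ cong (λ x → e + (a + x)) (*-distribˡ-+ b r i) ⟨
      e + (a + b * (r + i))
        ≡⟨ +-assoc e a _ ⟨
      e + a + b * (r + i) ∎
      where
      open ≡.≡-Reasoning
      a = weight s m k
      b = p ^ suc s ∸ p ^ s
      e = newtonExponent (weight s) k m
      r = congruent (p ^ suc s) k m
      i = ⟦ p ^ suc s ∣ nth m ∸ nth k ⟧

    congruent-diagonal : ∀ q k → p ∣ q → congruent q k k ≡ multiples q (nth k)
    congruent-diagonal q k p∣q = begin
      congruent q k k                                   ≡⟨ +-identityʳ _ ⟨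
      congruent q k k + 0                               ≡⟨ cong (λ x → congruent q k k + multiples q x) (n∸n≡0 (nth k)) ⟨
      congruent q k k + multiples q (nth k ∸ nth k)     ≡⟨ congruent-multiples q k k p∣q ≤-refl ⟩
      multiples q (nth k)                               ∎
      where open ≡.≡-Reasoning

    -- Level by level: for modulus q the count at m is ⌊iₘ / q⌋ - ⌊(iₘ - iₖ) / q⌋, which is at least
    -- ⌊iₖ / q⌋, the count at k.
    newtonExponent-minimal : ∀ s k m → k ≤ m →
      newtonExponent (weight s) k k ≤ newtonExponent (weight s) k m
    newtonExponent-minimal zero k m k≤m =
      ≤-reflexive (trans (newtonExponent-zero k k) (sym (newtonExponent-zero k m)))
    newtonExponent-minimal (suc s) k m k≤m = begin
      newtonExponent (weight (suc s)) k k
        ≡⟨ newtonExponent-suc s k k ⟩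
      newtonExponent (weight s) k k + (p ^ suc s ∸ p ^ s) * congruent q k k
        ≤⟨ +-mono-≤ (newtonExponent-minimal s k m k≤m) (*-monoʳ-≤ (p ^ suc s ∸ p ^ s) congruent-≤) ⟩
      newtonExponent (weight s) k m + (p ^ suc s ∸ p ^ s) * congruent q k m
        ≡⟨ newtonExponent-suc s k m ⟨
      newtonExponent (weight (suc s)) k m ∎
      where
      open ≤-Reasoning
      q = p ^ suc s
      instance _ = m^n≢0 p (suc s)
      congruent-≤ : congruent q k k ≤ congruent q k m
      congruent-≤ = +-cancelʳ-≤ (multiples q (nth m ∸ nth k)) _ _ (begin
        congruent q k k + multiples q (nth m ∸ nth k)      ≡⟨ cong (_+ multiples q (nth m ∸ nth k)) (congruent-diagonal q k (m∣m*n (p ^ s))) ⟩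
        multiples q (nth k) + multiples q (nth m ∸ nth k)  ≤⟨ multiples-superadditive q (nth k) (nth m ∸ nth k) ⟩
        multiples q (nth k + (nth m ∸ nth k))              ≡⟨ cong (multiples q) (m+[n∸m]≡n (nth-mono-≤ k≤m)) ⟩
        multiples q (nth m)                                ≡⟨ congruent-multiples q k m (m∣m*n (p ^ s)) k≤m ⟨
        congruent q k m + multiples q (nth m ∸ nth k)      ∎)

    -- Floors of j / p^s and the digit sum

    Σ-floors : (ℕ → ℕ) → ℕ → ℕ
    Σ-floors q zero    = 0
    Σ-floors q (suc s) = Σ-floors q s + (p ^ suc s ∸ p ^ s) * q (suc s)

    newtonExponent-diagonal : ∀ (q : ℕ → ℕ) k → (∀ s → multiples (p ^ suc s) (nth k) ≡ q (suc s)) →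
      ∀ s → newtonExponent (weight s) k k ≡ k + Σ-floors q s
    newtonExponent-diagonal q k q≡ zero    = trans (newtonExponent-zero k k) (sym (+-identityʳ k))
    newtonExponent-diagonal q k q≡ (suc s) = begin
      newtonExponent (weight (suc s)) k k
        ≡⟨ newtonExponent-suc s k k ⟩
      newtonExponent (weight s) k k + (p ^ suc s ∸ p ^ s) * congruent (p ^ suc s) k k
        ≡⟨ cong₂ (λ x y → x + (p ^ suc s ∸ p ^ s) * y) (newtonExponent-diagonal q k q≡ s)
             (trans (congruent-diagonal (p ^ suc s) k (m∣m*n (p ^ s))) (q≡ s)) ⟩
      k + Σ-floors q s + (p ^ suc s ∸ p ^ s) * q (suc s)
        ≡⟨ +-assoc k _ _ ⟩
      k + Σ-floors q (suc s) ∎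
      where open ≡.≡-Reasoning

    -- Reconciles two cut-offs: the weights stop at level m, the expansion at length L, and both lie
    -- beyond the last contributing floor.
    Σ-floors-stable : ∀ q B → (∀ s → B ≤ s → q (suc s) ≡ 0) → ∀ k → Σ-floors q (k + B) ≡ Σ-floors q B
    Σ-floors-stable q B q≡0 zero    = refl
    Σ-floors-stable q B q≡0 (suc k) = begin
      Σ-floors q (k + B) + (p ^ suc (k + B) ∸ p ^ (k + B)) * q (suc (k + B))
        ≡⟨ cong₂ (λ x y → x + (p ^ suc (k + B) ∸ p ^ (k + B)) * y) (Σ-floors-stable q B q≡0 k) (q≡0 (k + B) (m≤n+m B k)) ⟩
      Σ-floors q B + (p ^ suc (k + B) ∸ p ^ (k + B)) * 0
        ≡⟨ cong (λ z → Σ-floors q B + z) (*-zeroʳ (p ^ suc (k + B) ∸ p ^ (k + B))) ⟩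
      Σ-floors q B + 0
        ≡⟨ +-identityʳ _ ⟩
      Σ-floors q B ∎
      where open ≡.≡-Reasoning

    private
      open module ℕ-Sum = SemiringSum +-*-semiring using (sum; sum-cong-≋; *-distribˡ-sum)

    -- The number q s has the digits from place s on, so it is the floor of j / p^s, obtained from
    -- the digits by Horner's scheme instead of by division.
    floors : ∀ L (a : ℕ → ℕ) → (∀ s → L ≤ s → a s ≡ 0) → ∃ λ (q : ℕ → ℕ) →
      (q 0 ≡ sum {L} (λ s → a (toℕ s) * p ^ toℕ s)) ×
      (∀ s → q s ≡ a s + p * q (suc s)) × (∀ s → L ≤ s → q s ≡ 0)
    floors zero    a a≡0 = (λ _ → 0) , refl ,
      (λ s → sym (trans (cong₂ _+_ (a≡0 s z≤n) (*-zeroʳ p)) refl)) , λ _ _ → refl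
    floors (suc L) a a≡0 with floors L (a ∘ suc) (λ s L≤s → a≡0 (suc s) (s≤s L≤s))
    ... | q′ , q′₀≡ , q′-step , q′≡0 = q , refl ,
      (λ { zero → q-step ; (suc s) → q′-step s }) , λ { (suc s) (s≤s L≤s) → q′≡0 s L≤s }
      where
      open ≡.≡-Reasoning
      q : ℕ → ℕ
      q zero    = sum {suc L} (λ s → a (toℕ s) * p ^ toℕ s)
      q (suc s) = q′ s
      q-step : q 0 ≡ a 0 + p * q′ 0
      q-step = cong₂ _+_ (*-identityʳ (a 0)) (begin
        sum {L} (λ s → a (suc (toℕ s)) * (p * p ^ toℕ s))
          ≡⟨ sum-cong-≋ {L} (λ s → trans (sym (*-assoc (a (suc (toℕ s))) p _))
               (trans (cong (_* p ^ toℕ s) (*-comm (a (suc (toℕ s))) p)) (*-assoc p _ _))) ⟩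
        sum {L} (λ s → p * (a (suc (toℕ s)) * p ^ toℕ s))
          ≡⟨ *-distribˡ-sum {L} p (λ s → a (suc (toℕ s)) * p ^ toℕ s) ⟨
        p * sum {L} (λ s → a (suc (toℕ s)) * p ^ toℕ s)
          ≡⟨ cong (p *_) q′₀≡ ⟨
        p * q′ 0 ∎)

    module _ (a q : ℕ → ℕ) (a<p : ∀ s → a s < p) (q-step : ∀ s → q s ≡ a s + p * q (suc s)) where

      remainder : ∀ s → ∃ λ c → c < p ^ s × q 0 ≡ q s * p ^ s + c
      remainder zero    = 0 , s≤s z≤n , sym (trans (+-identityʳ _) (*-identityʳ (q 0)))
      remainder (suc s) with remainder s
      ... | c , c<p^s , q₀≡ = a s * p ^ s + c , lt , (begin
        q 0                                            ≡⟨ q₀≡ ⟩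
        q s * p ^ s + c                                ≡⟨ cong (λ x → x * p ^ s + c) (q-step s) ⟩
        (a s + p * q (suc s)) * p ^ s + c              ≡⟨ cong (_+ c) (*-distribʳ-+ (p ^ s) (a s) _) ⟩
        a s * p ^ s + p * q (suc s) * p ^ s + c        ≡⟨ cong (_+ c) (+-comm (a s * p ^ s) _) ⟩
        p * q (suc s) * p ^ s + a s * p ^ s + c        ≡⟨ +-assoc (p * q (suc s) * p ^ s) _ c ⟩
        p * q (suc s) * p ^ s + (a s * p ^ s + c)      ≡⟨ cong (_+ (a s * p ^ s + c)) (trans (cong (_* p ^ s) (*-comm p (q (suc s)))) (*-assoc (q (suc s)) p _)) ⟩
        q (suc s) * p ^ suc s + (a s * p ^ s + c)      ∎)
        where
        open ≡.≡-Reasoning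
        lt : a s * p ^ s + c < p ^ suc s
        lt = ≤R.begin-strict
          a s * p ^ s + c       ≤R.<⟨ +-monoʳ-< (a s * p ^ s) c<p^s ⟩
          a s * p ^ s + p ^ s   ≤R.≡⟨ +-comm _ (p ^ s) ⟩
          suc (a s) * p ^ s     ≤R.≤⟨ *-monoˡ-≤ (p ^ s) (a<p s) ⟩
          p * p ^ s             ≤R.∎
          where module ≤R = ≤-Reasoning

      multiples-floors : ∀ s → multiples (p ^ s) (q 0) ≡ q s
      multiples-floors s with remainder s
      ... | c , c<p^s , q₀≡ = trans (cong (multiples (p ^ s)) q₀≡) (multiples-floor (p ^ s) (q s) c<p^s)

      floors-vanish : ∀ n → q 0 < p ^ n → ∀ s → n ≤ s → q s ≡ 0
      floors-vanish n q₀<p^n s n≤s with q s in eq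
      ... | zero  = refl
      ... | suc x = ⊥-elim (<⇒≱ q₀<p^n (begin
        p ^ n                                  ≤⟨ ^-monoʳ-≤ p n≤s ⟩
        p ^ s                                  ≤⟨ m≤m+n (p ^ s) (x * p ^ s) ⟩
        suc x * p ^ s                          ≡⟨ cong (_* p ^ s) eq ⟨
        q s * p ^ s                            ≤⟨ m≤m+n (q s * p ^ s) _ ⟩
        q s * p ^ s + proj₁ (remainder s)      ≡⟨ proj₂ (proj₂ (remainder s)) ⟨
        q 0                                    ∎))
        where open ≤-Reasoning

      private
        open module ℤ-Sum = Sum ℤ.+-0-commutativeMonoid using () renaming (sum to sumℤ; sum-init-last to sumℤ-init-last)

        term : ℕ → ℤ
        term s = (ℤ.+ (a s * (s + 1)) ℤ.- ℤ.+ (a (suc s) * (s + 2))) ℤ.* ℤ.+ (p ^ s)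

        sum-snoc : ∀ (f : ℕ → ℤ) B → sumℤ {suc B} (f ∘ toℕ) ≡ sumℤ {B} (f ∘ toℕ) ℤ.+ f B
        sum-snoc f B = trans (sumℤ-init-last {B} (f ∘ toℕ)) (cong₂ ℤ._+_
          (ℤ-Sum.sum-cong-≗ {B} (λ i → cong f (Fin.toℕ-inject₁ i))) (cong f (Fin.toℕ-fromℕ B)))

        pos-step : ∀ s → ℤ.+ q s ≡ ℤ.+ a s ℤ.+ ℤ.+ p ℤ.* ℤ.+ q (suc s)
        pos-step s = trans (cong ℤ.+_ (q-step s)) (cong (λ x → ℤ.+ a s ℤ.+ x) (ℤ.pos-* p (q (suc s))))

        identity₀ : ∀ u v → ℤ.0ℤ ≡ (u ℤ.- v ℤ.+ ℤ.0ℤ) ℤ.+ (v ℤ.- u) ℤ.* (ℤ.1ℤ ℤ.* ℤ.1ℤ)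
        identity₀ = solve-∀

        -- The induction step of `telescope`, with two floors eliminated through q s = a s + p q (s
        -- + 1) so that a polynomial identity remains.
        identity′ : ∀ F A A′ Q″ P X b → let Q′ = A′ ℤ.+ P ℤ.* Q″ in
          F ℤ.+ (Q′ ℤ.- (A ℤ.+ P ℤ.* Q′)) ℤ.* (b ℤ.* X) ℤ.+ (A ℤ.* b ℤ.- A′ ℤ.* (b ℤ.+ ℤ.1ℤ)) ℤ.* X
          ≡ (F ℤ.+ (P ℤ.* X ℤ.- X) ℤ.* Q′) ℤ.+ (Q″ ℤ.- Q′) ℤ.* ((b ℤ.+ ℤ.1ℤ) ℤ.* (P ℤ.* X))
        identity′ = solve-∀

        identity : ∀ F A A′ Q′ Q″ P X b → Q′ ≡ A′ ℤ.+ P ℤ.* Q″ →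
          F ℤ.+ (Q′ ℤ.- (A ℤ.+ P ℤ.* Q′)) ℤ.* (b ℤ.* X) ℤ.+ (A ℤ.* b ℤ.- A′ ℤ.* (b ℤ.+ ℤ.1ℤ)) ℤ.* X
          ≡ (F ℤ.+ (P ℤ.* X ℤ.- X) ℤ.* Q′) ℤ.+ (Q″ ℤ.- Q′) ℤ.* ((b ℤ.+ ℤ.1ℤ) ℤ.* (P ℤ.* X))
        identity F A A′ _ Q″ P X b refl = identity′ F A A′ Q″ P X b

        -- a s = q s - p q (s + 1) makes the sum telescope.
        telescope : ∀ B → sumℤ {B} (term ∘ toℕ) ≡
          (ℤ.+ q 0 ℤ.- ℤ.+ q 1 ℤ.+ ℤ.+ Σ-floors q B)
          ℤ.+ (ℤ.+ q (suc B) ℤ.- ℤ.+ q B) ℤ.* (ℤ.+ (B + 1) ℤ.* ℤ.+ (p ^ B))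
        telescope zero = identity₀ (ℤ.+ q 0) (ℤ.+ q 1)
        telescope (suc B) = begin
          sumℤ {suc B} (term ∘ toℕ)
            ≡⟨ sum-snoc term B ⟩
          sumℤ {B} (term ∘ toℕ) ℤ.+ term B
            ≡⟨ cong₂ ℤ._+_ (telescope B) term≡ ⟩
          (w ℤ.+ F) ℤ.+ (Q′ ℤ.- ℤ.+ q B) ℤ.* (b ℤ.* X) ℤ.+ (A ℤ.* b ℤ.- A′ ℤ.* (b ℤ.+ ℤ.1ℤ)) ℤ.* X
            ≡⟨ cong (λ x → (w ℤ.+ F) ℤ.+ (Q′ ℤ.- x) ℤ.* (b ℤ.* X) ℤ.+ (A ℤ.* b ℤ.- A′ ℤ.* (b ℤ.+ ℤ.1ℤ)) ℤ.* X) (pos-step B) ⟩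
          (w ℤ.+ F) ℤ.+ (Q′ ℤ.- (A ℤ.+ P ℤ.* Q′)) ℤ.* (b ℤ.* X) ℤ.+ (A ℤ.* b ℤ.- A′ ℤ.* (b ℤ.+ ℤ.1ℤ)) ℤ.* X
            ≡⟨ identity (w ℤ.+ F) A A′ Q′ Q″ P X b (pos-step (suc B)) ⟩
          (w ℤ.+ F ℤ.+ (P ℤ.* X ℤ.- X) ℤ.* Q′) ℤ.+ (Q″ ℤ.- Q′) ℤ.* ((b ℤ.+ ℤ.1ℤ) ℤ.* (P ℤ.* X))
            ≡⟨ cong₂ (λ x y → x ℤ.+ (Q″ ℤ.- Q′) ℤ.* y) (trans (ℤ.+-assoc w F _) (cong (λ x → w ℤ.+ x) (sym F-suc)))
                 (cong₂ ℤ._*_ (cong ℤ.+_ (+-comm (B + 1) 1)) (sym (ℤ.pos-* p (p ^ B)))) ⟩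
          (w ℤ.+ ℤ.+ Σ-floors q (suc B)) ℤ.+ (Q″ ℤ.- Q′) ℤ.* (ℤ.+ (suc B + 1) ℤ.* ℤ.+ (p ^ suc B)) ∎
          where
          open ≡.≡-Reasoning
          w = ℤ.+ q 0 ℤ.- ℤ.+ q 1
          F = ℤ.+ Σ-floors q B
          A = ℤ.+ a B
          A′ = ℤ.+ a (suc B)
          Q′ = ℤ.+ q (suc B)
          Q″ = ℤ.+ q (2 + B)
          P = ℤ.+ p
          X = ℤ.+ (p ^ B)
          b = ℤ.+ (B + 1)
          term≡ : term B ≡ (A ℤ.* b ℤ.- A′ ℤ.* (b ℤ.+ ℤ.1ℤ)) ℤ.* X
          term≡ = cong (ℤ._* X) (cong₂ ℤ._-_ (ℤ.pos-* (a B) (B + 1))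
            (trans (ℤ.pos-* (a (suc B)) (B + 2)) (cong (λ x → A′ ℤ.* ℤ.+ x) (sym (+-assoc B 1 1)))))
          F-suc : ℤ.+ Σ-floors q (suc B) ≡ F ℤ.+ (P ℤ.* X ℤ.- X) ℤ.* Q′
          F-suc = cong (λ x → F ℤ.+ x) (trans (ℤ.pos-* (p ^ suc B ∸ p ^ B) (q (suc B))) (cong (ℤ._* Q′)
            (trans (trans (sym (ℤ.⊖-≥ (p^s≤p^1+s B))) (sym (ℤ.m-n≡m⊖n (p ^ suc B) (p ^ B))))
                   (cong (ℤ._- X) (ℤ.pos-* p (p ^ B))))))

      valuation-floors : ∀ L → q L ≡ 0 → q (suc L) ≡ 0 →
        valuation p L a ≡ ℤ.-[1+ 0 ] ℤ.+ (ℤ.+ q 0 ℤ.- ℤ.+ q 1 ℤ.+ ℤ.+ Σ-floors q L)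
      valuation-floors L qL≡0 q1+L≡0 = cong (λ x → ℤ.-[1+ 0 ] ℤ.+ x) (begin
        sumℤ {L} (term ∘ toℕ)
          ≡⟨ telescope L ⟩
        x ℤ.+ (ℤ.+ q (suc L) ℤ.- ℤ.+ q L) ℤ.* (ℤ.+ (L + 1) ℤ.* ℤ.+ (p ^ L))
          ≡⟨ cong₂ (λ u v → x ℤ.+ (ℤ.+ u ℤ.- ℤ.+ v) ℤ.* (ℤ.+ (L + 1) ℤ.* ℤ.+ (p ^ L))) q1+L≡0 qL≡0 ⟩
        x ℤ.+ ℤ.0ℤ
          ≡⟨ ℤ.+-identityʳ x ⟩
        x ∎)
        where
        open ≡.≡-Reasoning
        x = ℤ.+ q 0 ℤ.- ℤ.+ q 1 ℤ.+ ℤ.+ Σ-floors q L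

    -- The k + 1 integers prime to p up to `nth k` number q 0 - q 1, whence the constant -1. The
    -- bound by p^n makes the floors beyond level m vanish, so stopping the weights there loses
    -- nothing.
    newtonExponent-valuation : ∀ m k → nth k < p ^ suc m → ∀ L a → IsExpansion p (nth k) L a →
      ℤ.+ newtonExponent (weight m) k k ≡ valuation p L a
    newtonExponent-valuation m k nth<p^n L a expansion
      with floors L a (IsExpansion.finite expansion)
    ... | q , q₀≡ , q-step , q≡0 = begin
      ℤ.+ newtonExponent (weight m) k k
        ≡⟨ cong ℤ.+_ (newtonExponent-diagonal q k (λ s → trans (cong (multiples (p ^ suc s)) (sym q₀)) (multiples-floors a q digit q-step (suc s))) m) ⟩
      ℤ.+ (k + Σ-floors q m)
        ≡⟨ cong (λ x → ℤ.+ (k + x)) Σ-floors-m≡L ⟩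
      ℤ.+ k ℤ.+ ℤ.+ Σ-floors q L
        ≡⟨ shift (ℤ.+ k) (ℤ.+ q 1) (ℤ.+ Σ-floors q L) ⟩
      ℤ.-[1+ 0 ] ℤ.+ (ℤ.+ (suc k + q 1) ℤ.- ℤ.+ q 1 ℤ.+ ℤ.+ Σ-floors q L)
        ≡⟨ cong (λ x → ℤ.-[1+ 0 ] ℤ.+ (ℤ.+ x ℤ.- ℤ.+ q 1 ℤ.+ ℤ.+ Σ-floors q L)) k+q₁ ⟩
      ℤ.-[1+ 0 ] ℤ.+ (ℤ.+ q 0 ℤ.- ℤ.+ q 1 ℤ.+ ℤ.+ Σ-floors q L)
        ≡⟨ valuation-floors a q digit q-step L (q≡0 L ≤-refl) (q≡0 (suc L) (m≤n+m L 1)) ⟨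
      valuation p L a ∎
      where
      open ≡.≡-Reasoning
      open IsExpansion expansion using (digit; value)
      q₀ : q 0 ≡ nth k
      q₀ = trans q₀≡ (sym value)
      Σ-floors-m≡L : Σ-floors q m ≡ Σ-floors q L
      Σ-floors-m≡L = begin
        Σ-floors q m         ≡⟨ Σ-floors-stable q m (λ s m≤s → floors-vanish a q digit q-step (suc m)
                                  (subst (_< p ^ suc m) (sym q₀) nth<p^n) (suc s) (s≤s m≤s)) L ⟨
        Σ-floors q (L + m)   ≡⟨ cong (Σ-floors q) (+-comm L m) ⟩
        Σ-floors q (m + L)   ≡⟨ Σ-floors-stable q L (λ s L≤s → q≡0 (suc s) (m≤n⇒m≤1+n L≤s)) m ⟩
        Σ-floors q L         ∎
      k+q₁ : suc k + q 1 ≡ q 0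
      k+q₁ = begin
        suc k + q 1                                   ≡⟨ cong (λ z → suc k + z) (multiples-floors a q digit q-step 1) ⟨
        suc k + multiples (p ^ 1) (q 0)               ≡⟨ cong₂ (λ x y → x + multiples y (q 0)) (sym (N-nth k)) (*-identityʳ p) ⟩
        N p (nth k) + multiples p (q 0)               ≡⟨ cong (λ x → N p (nth k) + multiples p x) q₀ ⟩
        N p (nth k) + multiples p (nth k)             ≡⟨ N-multiples p (nth k) ⟩
        nth k                                         ≡⟨ q₀ ⟨
        q 0                                           ∎
      shift : ∀ k q s → k ℤ.+ s ≡ ℤ.-1ℤ ℤ.+ ((ℤ.1ℤ ℤ.+ k ℤ.+ q) ℤ.- q ℤ.+ s)
      shift = solve-∀

open Counting using (prime⇒2≤; module PrimeTo)

-- Nakayama's lemma over ℤ₍ₚ₎ and conjugation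

restrictScalars : (R : CommutativeRing ℓᵃ ℓ₁) {P : Pred (CommutativeRing.Carrier R) ℓ₂} (S : IsSubring R P) →
                  LeftModule (CommutativeRing.ring (subring R S)) ℓᵃ ℓ₁
restrictScalars R S = record
  { Carrierᴹ = Carrier
  ; _≈ᴹ_ = _≈_
  ; _+ᴹ_ = _+_
  ; _*ₗ_ = λ (s , _) x → s * x
  ; 0ᴹ = 0#
  ; -ᴹ_ = -_
  ; isLeftModule = record
    { isLeftSemimodule = record
      { +ᴹ-isCommutativeMonoid = +-isCommutativeMonoid
      ; isPreleftSemimodule = record
        { *ₗ-cong = *-cong
        ; *ₗ-zeroˡ = zeroˡ
        ; *ₗ-distribʳ = λ x s s′ → distribʳ x (proj₁ s) (proj₁ s′)
        ; *ₗ-identityˡ = *-identityˡ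
        ; *ₗ-assoc = λ s s′ x → *-assoc (proj₁ s) (proj₁ s′) x
        ; *ₗ-zeroʳ = λ s → zeroʳ (proj₁ s)
        ; *ₗ-distribˡ = λ s → distribˡ (proj₁ s)
        }
      }
    ; -ᴹ‿cong = -‿cong
    ; -ᴹ‿inverse = -‿inverse
    }
  }
  where open CommutativeRing R

module LocalizedIntegers {c ℓ₁ ℓ₂} (K : HeytingField c ℓ₁ ℓ₂) (char0 : CharZero K) {p : ℕ} (p-prime : Prime p) where

  R : CommutativeRing c ℓ₁
  R = HeytingCommutativeRing.commutativeRing (HeytingField.heytingCommutativeRing K)

  open CommutativeRing R hiding (zero)
  open HeytingField K using (_#_; #-irrefl; #⇒invertible; #-cotrans)
  open Mult semiring using () renaming (_×_ to _·_)
  open Exp semiring using (_^_)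
  open RingLemmas R
  open RingProperties ring using (-0#≈0#)
  open IntegerMultiples R
  open IntegerSolver R
  open SetoidReasoning setoid

  private
    P = p · 1#

  Loc : Pred Carrier ℓ₁
  Loc = Localized R p

  Loc-subring : IsSubring R Loc
  Loc-subring = Localized-isSubring R p-prime

  open IsSubring Loc-subring public

  #0⇒unit : ∀ {x} → x # 0# → Unit x
  #0⇒unit {x} x#0 = unit-resp (trans (+-congˡ -0#≈0#) (+-identityʳ x)) (#⇒invertible x#0)

  positive-unit : ∀ k → 0 ℕ.< k → Unit (k · 1#)
  positive-unit (suc k) 0<k = #0⇒unit (char0 k)

  1≉0 : ¬ (1# ≈ 0#)
  1≉0 1≈0 = #-irrefl (trans (+-identityʳ 1#) 1≈0) (char0 0)

  p∤⇒coprime : ∀ {i} → p ∤ i → Coprime p i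
  p∤⇒coprime p∤i (d∣p , d∣i) with prime⇒irreducible p-prime d∣p
  ... | inj₁ d≡1    = d≡1
  ... | inj₂ ≡.refl = ⊥-elim (p∤i d∣i)

  p∤⇒positive : ∀ {k} → p ∤ k → 0 ℕ.< k
  p∤⇒positive {zero}  p∤0 = ⊥-elim (p∤0 (p ℕ.∣0))
  p∤⇒positive {suc k} p∤k = s≤s z≤n

  p∤-unit : ∀ {k} → p ∤ k → Unit (k · 1#)
  p∤-unit p∤k = positive-unit _ (p∤⇒positive p∤k)

  -- The inverse of i / s is s / i. Denominators are natural numbers, so a negative i is first made
  -- positive by passing to - x.
  Loc-unit : ∀ {x} i s → p ∤ s → s · x ≈ fromℤ i → p ∤ ∣ i ∣ → ∃ λ v → Loc v × x * v ≈ 1#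
  Loc-unit {x} (+ k) s p∤s sx≈k p∤k = n⁻¹ * (s · 1#) , (+ s , k , p∤k , (begin
      k · (n⁻¹ * (s · 1#))            ≈⟨ ·-lift k _ ⟩
      (k · 1#) * (n⁻¹ * (s · 1#))     ≈⟨ *-assoc _ _ _ ⟨
      ((k · 1#) * n⁻¹) * (s · 1#)     ≈⟨ *-congʳ (proj₂ (proj₂ n)) ⟩
      1# * (s · 1#)                   ≈⟨ *-identityˡ _ ⟩
      s · 1#                          ∎)) , (begin
    x * (n⁻¹ * (s · 1#))              ≈⟨ solve 3 (λ x n s → x :* (n :* s) := n :* (s :* x)) refl x n⁻¹ (s · 1#) ⟩
    n⁻¹ * ((s · 1#) * x)              ≈⟨ *-congˡ (·-lift s x) ⟨
    n⁻¹ * (s · x)                     ≈⟨ *-congˡ sx≈k ⟩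
    n⁻¹ * (k · 1#)                    ≈⟨ proj₁ (proj₂ n) ⟩
    1#                                ∎)
    where
    n = p∤-unit p∤k
    n⁻¹ = proj₁ n
  Loc-unit {x} -[1+ k ] s p∤s sx≈ p∤k =
    let v , v∈ , -xv≈1 = Loc-unit { - x} (+ suc k) s p∤s (begin
          s · (- x)          ≈⟨ ·-lift s (- x) ⟩
          (s · 1#) * - x     ≈⟨ solve 2 (λ s x → s :* (:- x) := :- (s :* x)) refl (s · 1#) x ⟩
          - ((s · 1#) * x)   ≈⟨ -‿cong (trans (sym (·-lift s x)) sx≈) ⟩
          - - (suc k · 1#)   ≈⟨ solve 1 (λ x → :- (:- x) := x) refl _ ⟩
          suc k · 1#         ∎) p∤k
    in - v , neg-closed v∈ , trans (solve 2 (λ x v → x :* (:- v) := (:- x) :* v) refl x v) -xv≈1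

  -- For x = i / s the numerator of 1 - p x is s - p i, which is prime to p because s is.
  1-pc-unit : ∀ {x} → Loc x → ∃ λ v → Loc v × (1# - P * x) * v ≈ 1#
  1-pc-unit {x} (i , s , p∤s , sx≈i) = Loc-unit (+ s ℤ.- + p ℤ.* i) s p∤s (begin
      s · (1# - P * x)                    ≈⟨ ·-lift s _ ⟩
      (s · 1#) * (1# - P * x)             ≈⟨ solve 3 (λ s p x → s :* (:1 :- p :* x) := s :- p :* (s :* x)) refl (s · 1#) P x ⟩
      s · 1# - P * ((s · 1#) * x)         ≈⟨ +-congˡ (-‿cong (*-congˡ (trans (sym (·-lift s x)) sx≈i))) ⟩
      s · 1# - P * fromℤ i                ≈⟨ +-congˡ (-‿cong (fromℤ-* (+ p) i)) ⟨
      s · 1# - fromℤ (+ p ℤ.* i)          ≈⟨ +-congˡ (fromℤ-neg (+ p ℤ.* i)) ⟨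
      s · 1# + fromℤ (ℤ.- (+ p ℤ.* i))    ≈⟨ fromℤ-+ (+ s) (ℤ.- (+ p ℤ.* i)) ⟨
      fromℤ (+ s ℤ.- + p ℤ.* i)           ∎)
    λ p∣ → p∤s (ℤ.∣⇒∣ᵤ {+ p} {+ s} (ℤ.∣m+n∣n⇒∣m {+ p} {+ s} {ℤ.- (+ p ℤ.* i)} (ℤ.∣ᵤ⇒∣ {+ p} p∣)
      (ℤ.∣m⇒∣-m {+ p} {+ p ℤ.* i} (ℤ.divides i (ℤ.*-comm (+ p) i)))))

  KM : LeftModule (CommutativeRing.ring (subring R Loc-subring)) c ℓ₁
  KM = restrictScalars R Loc-subring

  module KL = LinearCombinations (CommutativeRing.ring (subring R Loc-subring)) KM
  open KL using (Span; gen; zero; add; scale; resp; Below; Span-bind)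

  _∪Below_,_ : Pred Carrier ℓ → (ℕ → Carrier) → ℕ → Pred Carrier (ℓ ⊔ ℓ₁)
  (I ∪Below v , k) x = I x ⊎ Below v k x

  private
    drop-last : {I : Pred Carrier ℓ} (v : ℕ → Carrier) (k : ℕ) → ∀ {x} → Span (I ∪Below v , suc k) x →
      ∃₂ λ y c → Span (I ∪Below v , k) y × Loc c × x ≈ y + c * v k
    drop-last v k (gen {x} (inj₁ x∈I)) = x , 0# , gen (inj₁ x∈I) , 0-closed ,
      solve 2 (λ x v → x := x :+ :0 :* v) refl x (v k)
    drop-last v k (gen {x} (inj₂ (l , l≤k , x≈))) with ℕ.m≤n⇒m<n∨m≡n (ℕ.s≤s⁻¹ l≤k)
    ... | inj₁ l<k    = x , 0# , gen (inj₂ (l , l<k , x≈)) , 0-closed ,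
      solve 2 (λ x v → x := x :+ :0 :* v) refl x (v k)
    ... | inj₂ ≡.refl = 0# , 1# , zero , 1-closed ,
      trans x≈ (solve 1 (λ v → v := :0 :+ :1 :* v) refl (v k))
    drop-last v k zero = 0# , 0# , zero , 0-closed , solve 1 (λ v → :0 := :0 :+ :0 :* v) refl (v k)
    drop-last v k (add x∈ x′∈) =
      let y , c , y∈ , c∈ , x≈ = drop-last v k x∈
          y′ , c′ , y′∈ , c′∈ , x′≈ = drop-last v k x′∈
      in y + y′ , c + c′ , add y∈ y′∈ , +-closed c∈ c′∈ , trans (+-cong x≈ x′≈)
           (solve 5 (λ y c y′ c′ v → (y :+ c :* v) :+ (y′ :+ c′ :* v) := (y :+ y′) :+ (c :+ c′) :* v) refl y c y′ c′ (v k))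
    drop-last v k (scale (s , s∈) x∈) =
      let y , c , y∈ , c∈ , x≈ = drop-last v k x∈
      in s * y , s * c , scale (s , s∈) y∈ , *-closed s∈ c∈ , trans (*-congˡ x≈)
           (solve 4 (λ s y c v → s :* (y :+ c :* v) := s :* y :+ (s :* c) :* v) refl s y c (v k))
    drop-last v k (resp p x∈) =
      let y , c , y∈ , c∈ , x≈ = drop-last v k x∈ in y , c , y∈ , c∈ , trans (sym p) x≈

  p-Loc : Loc P
  p-Loc = + p , 1 , (λ p∣1 → ℕ.<⇒≱ (prime⇒2≤ p-prime) (∣⇒≤ p∣1)) , +-identityʳ P

  -- Generators are removed one at a time: if vₖ = a + p y with y in the span of
  -- I and v₀, …, vₖ, then (1 - p c) vₖ lies in the span of I and the earlier vₗ.
  nakayama : (I : Pred Carrier ℓ) (v : ℕ → Carrier) (r : ℕ) (T : Pred Carrier ℓ₃) →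
    (∀ l → T (v l)) →
    (∀ {x} → T x → Span (I ∪Below v , r) x) →
    (∀ {x} → T x → ∃₂ λ a y → I a × T y × x ≈ a + P * y) →
    ∀ {x} → T x → Span I x
  nakayama I v zero    T v∈T T⊆ T⊆I+pT x∈ = Span-bind (λ { (inj₁ x∈I) → gen x∈I ; (inj₂ (_ , () , _)) }) (T⊆ x∈)
  nakayama I v (suc r) T v∈T T⊆ T⊆I+pT =
    nakayama I v r T v∈T (λ x∈ → Span-bind reduce (T⊆ x∈)) T⊆I+pT
    where
    vᵣ∈ : Span (I ∪Below v , r) (v r)
    vᵣ∈ =
      let a , y , a∈I , y∈T , v≈ = T⊆I+pT (v∈T r)
          z , c , z∈ , c∈ , y≈ = drop-last v r (T⊆ y∈T)
          u , u∈ , [1-pc]u≈1 = 1-pc-unit c∈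
      in resp (begin
        u * (a + P * z)
          ≈⟨ *-congˡ (solve 4 (λ a z c p → a :+ p :* z := (a :+ p :* (z :+ c)) :- p :* c) refl a z (c * v r) P) ⟩
        u * ((a + P * (z + c * v r)) - P * (c * v r))
          ≈⟨ *-congˡ (+-congʳ (trans v≈ (+-congˡ (*-congˡ y≈)))) ⟨
        u * (v r - P * (c * v r))
          ≈⟨ solve 4 (λ u v p c → u :* (v :- p :* (c :* v)) := ((:1 :- p :* c) :* u) :* v) refl u (v r) P c ⟩
        ((1# - P * c) * u) * v r
          ≈⟨ *-congʳ [1-pc]u≈1 ⟩
        1# * v r
          ≈⟨ *-identityˡ (v r) ⟩
        v r ∎)
        (scale (u , u∈) (add (gen (inj₁ a∈I)) (scale (P , p-Loc) z∈)))

    reduce : ∀ {x} → (I ∪Below v , suc r) x → Span (I ∪Below v , r) x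
    reduce (inj₁ x∈I) = gen (inj₁ x∈I)
    reduce (inj₂ (l , l≤r , x≈)) with ℕ.m≤n⇒m<n∨m≡n (ℕ.s≤s⁻¹ l≤r)
    ... | inj₁ l<r    = gen (inj₂ (l , l<r , x≈))
    ... | inj₂ ≡.refl = resp (sym x≈) vᵣ∈

  module _ (m : ℕ) where

    -- Invertibility of 1 - z^(p^m) stands for z^(p^m) ≠ 1: it allows cancellation without deciding
    -- equality, and it passes to the powers ζ^i with i prime to p.
    record IsRoot (z : Carrier) : Set (c ⊔ ℓ₁) where
      field
        z^pⁿ≈1     : z ^ (p ℕ.^ suc m) ≈ 1#
        1-z^pᵐ-unit : Unit (1# - z ^ (p ℕ.^ m))

      z^pᵐ^p≈1 : (z ^ (p ℕ.^ m)) ^ p ≈ 1#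
      z^pᵐ^p≈1 = trans (Exp.^-assocʳ semiring z (p ℕ.^ m) p)
        (trans (Exp.^-congʳ semiring z (ℕ.*-comm (p ℕ.^ m) p)) z^pⁿ≈1)

      -- The geometric sum is the value at z of the p^n-th cyclotomic polynomial.
      Φ≈0 : geometric (z ^ (p ℕ.^ m)) p ≈ 0#
      Φ≈0 = unit-cancelˡ _ 1-z^pᵐ-unit (begin
        (1# - y) * geometric y p  ≈⟨ geometric-factor y p ⟨
        1# - y ^ p                ≈⟨ x≈y⇒x-y≈0 (sym z^pᵐ^p≈1) ⟩
        0#                        ∎)
        where y = z ^ (p ℕ.^ m)

    primitive⇒root : ∀ {ζ} → IsPrimitiveRoot R (p ℕ.^ suc m) ζ → IsRoot ζ
    primitive⇒root {ζ} ζ-primitive = record { z^pⁿ≈1 = root ; 1-z^pᵐ-unit = 1-y-unit }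
      where
      open IsPrimitiveRoot ζ-primitive
      y = ζ ^ (p ℕ.^ m)
      G = geometric y p

      p≥2 : 1 ℕ.< p
      p≥2 = prime⇒2≤ p-prime

      y≉1 : ¬ (y ≈ 1#)
      y≉1 = minimal (p ℕ.^ m) (ℕ.m^n>0 p {{ℕ.>-nonZero (ℕ.<⇒≤ p≥2)}} m) (ℕ.^-monoʳ-< p p≥2 (ℕ.n<1+n m))

      [1-y]G≈0 : G * (1# - y) ≈ 0#
      [1-y]G≈0 = begin
        G * (1# - y)  ≈⟨ *-comm _ _ ⟩
        (1# - y) * G  ≈⟨ geometric-factor y p ⟨
        1# - y ^ p    ≈⟨ x≈y⇒x-y≈0 (sym (trans (Exp.^-assocʳ semiring ζ (p ℕ.^ m) p)
                           (trans (Exp.^-congʳ semiring ζ (ℕ.*-comm (p ℕ.^ m) p)) root))) ⟩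
        0#            ∎

      P#0 : P # 0#
      P#0 = lemma p-prime
        where
        lemma : ∀ {p} → Prime p → (p · 1#) # 0#
        lemma {zero}  p-prime = ⊥-elim (¬prime[0] p-prime)
        lemma {suc p} p-prime = char0 p

      -- p is a unit congruent to G modulo 1 - y, so either G or 1 - y is a unit.
      1-y-unit : Unit (1# - y)
      1-y-unit with #-cotrans P#0 G
      ... | inj₁ P#G = ∣-unit (geometric-residue y p) (#⇒invertible P#G)
      ... | inj₂ G#0 = ⊥-elim (y≉1 (sym (x-y≈0⇒x≈y (unit-cancelˡ _ (#0⇒unit G#0) [1-y]G≈0))))

    -- A suitable power of ζ^i is ζ again, by Bézout.
    root-^ : ∀ {ζ} i → p ∤ i → IsRoot ζ → IsRoot (ζ ^ i)
    root-^ {ζ} i p∤i ζ-root = record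
      { z^pⁿ≈1 = trans (swap (p ℕ.^ suc m)) (trans (Exp.^-congˡ semiring i z^pⁿ≈1) (^-1 i))
      ; 1-z^pᵐ-unit = unit-resp (+-congˡ (-‿cong (sym (swap (p ℕ.^ m))))) 1-y^i-unit
      }
      where
      open IsRoot ζ-root
      y = ζ ^ (p ℕ.^ m)
      swap : ∀ n → (ζ ^ i) ^ n ≈ (ζ ^ n) ^ i
      swap n = trans (Exp.^-assocʳ semiring ζ i n) (trans (Exp.^-congʳ semiring ζ (ℕ.*-comm i n)) (sym (Exp.^-assocʳ semiring ζ n i)))

      y^pk≈1 : ∀ k → y ^ (k ℕ.* p) ≈ 1#
      y^pk≈1 k = trans (Exp.^-congʳ semiring y (ℕ.*-comm k p)) (trans (sym (Exp.^-assocʳ semiring y p k))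
        (trans (Exp.^-congˡ semiring k z^pᵐ^p≈1) (^-1 k)))

      1-y^i-unit : Unit (1# - y ^ i)
      1-y^i-unit with coprime-Bézout (p∤⇒coprime p∤i)
      ... | Bézout.-+ k l 1+kp≡li = ∣-unit (∣-resp refl (+-congˡ (-‿cong (begin
          (y ^ i) ^ l          ≈⟨ Exp.^-assocʳ semiring y i l ⟩
          y ^ (i ℕ.* l)        ≈⟨ Exp.^-congʳ semiring y (≡.trans (ℕ.*-comm i l) (≡.sym 1+kp≡li)) ⟩
          y * y ^ (k ℕ.* p)    ≈⟨ *-congˡ (y^pk≈1 k) ⟩
          y * 1#               ≈⟨ *-identityʳ y ⟩
          y                    ∎)))
        (1-x∣1-x^k (y ^ i) l)) 1-z^pᵐ-unit
      -- With this sign (y^i)^l is the inverse of y, and 1 - y⁻¹ becomes -(1 - y) after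
      -- multiplication by y.
      ... | Bézout.+- k l 1+li≡kp = ∣-unit (∣-resp refl (begin
          (1# - (y ^ i) ^ l) * y    ≈⟨ solve 2 (λ w y → (:1 :- w) :* y := y :- y :* w) refl _ y ⟩
          y - y * (y ^ i) ^ l       ≈⟨ +-congˡ (-‿cong (begin
              y * (y ^ i) ^ l       ≈⟨ *-congˡ (Exp.^-assocʳ semiring y i l) ⟩
              y ^ suc (i ℕ.* l)     ≈⟨ Exp.^-congʳ semiring y (≡.trans (≡.cong suc (ℕ.*-comm i l)) 1+li≡kp) ⟩
              y ^ (k ℕ.* p)         ≈⟨ y^pk≈1 k ⟩
              1#                    ∎)) ⟩
          y - 1#                    ≈⟨ solve 1 (λ y → y :- :1 := :- (:1 :- y)) refl y ⟩
          - (1# - y)                ∎)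
        (∣-*ʳ y (1-x∣1-x^k (y ^ i) l))) (unit-neg 1-z^pᵐ-unit)

module SubringProjection (R : CommutativeRing ℓᵃ ℓ₁) {P : Pred (CommutativeRing.Carrier R) ℓ₂} (S : IsSubring R P) where
  private
    module R where
      open CommutativeRing R public
      open Exp semiring public
      open Mult semiring public
      open IntegerMultiples R public
      open SemiringSum semiring public
    module S where
      open CommutativeRing (subring R S) public
      open Exp semiring public
      open Mult semiring public
      open IntegerMultiples (subring R S) public
      open SemiringSum semiring public

  proj-^ : ∀ x k → proj₁ (x S.^ k) ≡ proj₁ x R.^ k
  proj-^ x zero    = ≡.refl
  proj-^ x (suc k) = ≡.cong (proj₁ x R.*_) (proj-^ x k)

  proj-× : ∀ k → proj₁ (k S.× S.1#) ≡ k R.× R.1#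
  proj-× zero    = ≡.refl
  proj-× (suc k) = ≡.cong (R.1# R.+_) (proj-× k)

  proj-fromℤ : ∀ i → proj₁ (S.fromℤ i) ≡ R.fromℤ i
  proj-fromℤ (+ k)    = proj-× k
  proj-fromℤ -[1+ k ] = ≡.cong R.-_ (proj-× (suc k))

  proj-sum : ∀ {n} (f : Fin n → S.Carrier) → proj₁ (S.sum f) ≡ R.sum (proj₁ ∘ f)
  proj-sum {zero}  f = ≡.refl
  proj-sum {suc n} f = ≡.cong (proj₁ (f zero) R.+_) (proj-sum (f ∘ suc))

module _ {c ℓ₁ ℓ₂} (K : HeytingField c ℓ₁ ℓ₂) (char0 : CharZero K) {p : ℕ} (p-prime : Prime p) (m : ℕ) where
  open LocalizedIntegers K char0 p-prime

  -- Whether ζ ↦ ξ extends to a map is not yet known, so it is treated as the ℤ₍ₚ₎-submodule of K ×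
  -- K spanned by the pairs (ζ^l, ξ^l) with l < `rank`. Linearity is then automatic and only
  -- single-valuedness is left. The case ξ = ζ is also used, to span T.
  module Conjugation
    {ζ ξ : CommutativeRing.Carrier R} (ζ-root : IsRoot m ζ) (ξ-root : IsRoot m ξ)
    where
    open CommutativeRing R hiding (zero)
    open Exp semiring
    open RingLemmas R
    open RingProperties ring using (-1*x≈-x; -‿distribˡ-*)
    open IntegerSolver R
    open SetoidReasoning setoid

    K×K = DirectProduct.leftModule KM KM
    open LinearCombinations (CommutativeRing.ring (subring R Loc-subring)) K×K public

    rank : ℕ
    rank = (p ∸ 1) ℕ.* p ℕ.^ m

    powers : ℕ → Carrier × Carrier
    powers l = ζ ^ l , ξ ^ l

    private
      Graph = Span (Below powers rank)

      geometric-snoc : ∀ x k → geometric x (suc k) ≈ geometric x k + x ^ k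
      geometric-snoc x zero    = solve 1 (λ x → :1 :+ x :* :0 := :0 :+ :1) refl x
      geometric-snoc x (suc k) = begin
        1# + x * geometric x (suc k)       ≈⟨ +-congˡ (*-congˡ (geometric-snoc x k)) ⟩
        1# + x * (geometric x k + x ^ k)   ≈⟨ solve 3 (λ x g a → :1 :+ x :* (g :+ a) := (:1 :+ x :* g) :+ x :* a) refl x _ _ ⟩
        geometric x (suc k) + x ^ suc k    ∎

      geometric∈ : ∀ k → k ℕ.≤ p ∸ 1 → Graph (geometric (ζ ^ (p ℕ.^ m)) k , geometric (ξ ^ (p ℕ.^ m)) k)
      geometric∈ zero    k≤ = zero
      geometric∈ (suc k) k< = resp (step ζ , step ξ) (add (geometric∈ k (ℕ.<⇒≤ k<))
        (gen (p ℕ.^ m ℕ.* k , lt , refl , refl)))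
        where
        step : ∀ z → geometric (z ^ (p ℕ.^ m)) k + z ^ (p ℕ.^ m ℕ.* k) ≈ geometric (z ^ (p ℕ.^ m)) (suc k)
        step z = trans (+-congˡ (sym (^-assocʳ z (p ℕ.^ m) k))) (sym (geometric-snoc _ k))
        lt : p ℕ.^ m ℕ.* k ℕ.< rank
        lt = ≡.subst (ℕ._< rank) (ℕ.*-comm k (p ℕ.^ m))
          (ℕ.*-monoˡ-< (p ℕ.^ m) {{ℕ.m^n≢0 p m {{ℕ.>-nonZero (ℕ.<⇒≤ (prime⇒2≤ p-prime))}}}} k<)

      -- Φ(ζ) = 0 expresses ζ^rank through lower powers, and likewise for ξ.
      powers-rank∈ : Graph (powers rank)
      powers-rank∈ = resp (top ζ-root , top ξ-root) (scale (- 1# , neg-closed 1-closed) (geometric∈ (p ∸ 1) ℕ.≤-refl))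
        where
        1+p-1 : suc (p ∸ 1) ≡ p
        1+p-1 = ℕ.m+[n∸m]≡n (ℕ.<⇒≤ (prime⇒2≤ p-prime))
        top : ∀ {z} → IsRoot m z → - 1# * geometric (z ^ (p ℕ.^ m)) (p ∸ 1) ≈ z ^ rank
        top {z} z-root = begin
          - 1# * g
            ≈⟨ solve 2 (λ g a → (:- :1) :* g := a :- (g :+ a)) refl g a ⟩
          a - (g + a)
            ≈⟨ +-congˡ (-‿cong (trans (sym (geometric-snoc _ (p ∸ 1))) (reflexive (≡.cong (geometric _) 1+p-1)))) ⟩
          a - geometric (z ^ (p ℕ.^ m)) p
            ≈⟨ +-congˡ (-‿cong (IsRoot.Φ≈0 z-root)) ⟩
          a - 0#
            ≈⟨ solve 1 (λ a → a :- :0 := a) refl a ⟩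
          a
            ≈⟨ trans (^-assocʳ z (p ℕ.^ m) (p ∸ 1)) (^-congʳ z (ℕ.*-comm (p ℕ.^ m) (p ∸ 1))) ⟩
          z ^ rank ∎
          where
          a = (z ^ (p ℕ.^ m)) ^ (p ∸ 1)
          g = geometric (z ^ (p ℕ.^ m)) (p ∸ 1)

      -- Multiplication by (ζ, ξ) leaves the range of exponents only at l = `rank` - 1, where
      -- `powers-rank∈` brings it back.
      shift : ∀ {x y} → Graph (x , y) → Graph (ζ * x , ξ * y)
      shift x∈ = go x∈
        where
        go : ∀ {xy} → Graph xy → Graph (ζ * proj₁ xy , ξ * proj₂ xy)
        go (gen (l , l<r , p , q)) with ℕ.m≤n⇒m<n∨m≡n l<r
        ... | inj₁ l+1<r  = gen (suc l , l+1<r , *-congˡ p , *-congˡ q)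
        ... | inj₂ l+1≡r  = resp (sym (*-congˡ p) , sym (*-congˡ q)) (≡.subst (λ k → Graph (powers k)) (≡.sym l+1≡r) powers-rank∈)
        go zero           = resp (sym (zeroʳ ζ) , sym (zeroʳ ξ)) zero
        go (add x∈ y∈)    = resp (sym (distribˡ _ _ _) , sym (distribˡ _ _ _)) (add (go x∈) (go y∈))
        go (scale (s , s∈) x∈) = resp (swap s ζ _ , swap s ξ _) (scale (s , s∈) (go x∈))
          where
          swap : ∀ s z x → s * (z * x) ≈ z * (s * x)
          swap = solve 3 (λ s z x → s :* (z :* x) := z :* (s :* x)) refl
        go (resp (p , q) x∈) = resp (*-congˡ p , *-congˡ q) (go x∈)

      -- Stronger than (x, y) lying in the graph: multiplication by (x, y) preserves it. In this
      -- form products are mere composition, and membership results by applying it to (1, 1).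
      multiply : ∀ {x} → Adjoin R p ζ x → ∃ λ y → Adjoin R p ξ y ×
        (∀ {u v} → Graph (u , v) → Graph (x * u , y * v))
      multiply {x} (base x∈) = x , base x∈ , scale (x , x∈)
      multiply gen           = ξ , gen , shift
      multiply (add x∈ x′∈)  =
        let y , y∈ , f = multiply x∈
            y′ , y′∈ , f′ = multiply x′∈
        in y + y′ , add y∈ y′∈ , λ uv → resp (sym (distribʳ _ _ _) , sym (distribʳ _ _ _)) (add (f uv) (f′ uv))
      multiply (mul x∈ x′∈)  =
        let y , y∈ , f = multiply x∈
            y′ , y′∈ , f′ = multiply x′∈
        in y * y′ , mul y∈ y′∈ , λ uv → resp (sym (*-assoc _ _ _) , sym (*-assoc _ _ _)) (f (f′ uv))
      multiply (neg x∈)      =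
        let y , y∈ , f = multiply x∈
            negate : ∀ x u → - 1# * (x * u) ≈ - x * u
            negate x u = trans (-1*x≈-x _) (-‿distribˡ-* x u)
        in - y , neg y∈ , λ uv → resp (negate _ _ , negate _ _) (scale (- 1# , neg-closed 1-closed) (f uv))
      multiply (resp x≈x′ x∈) =
        let y , y∈ , f = multiply x∈
        in y , y∈ , λ uv → resp (*-congʳ x≈x′ , refl) (f uv)

      1∈ : Graph (1# , 1#)
      1∈ = gen (0 , ℕ.*-mono-≤ {1} (ℕ.∸-monoˡ-≤ 1 (prime⇒2≤ p-prime)) (ℕ.m^n>0 p {{ℕ.>-nonZero (ℕ.<⇒≤ (prime⇒2≤ p-prime))}} m) , refl , refl)

    conjugate : ∀ {x} → Adjoin R p ζ x → Carrier
    conjugate x∈ = proj₁ (multiply x∈)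

    conjugate∈ : ∀ {x} (x∈ : Adjoin R p ζ x) → Adjoin R p ξ (conjugate x∈)
    conjugate∈ x∈ = proj₁ (proj₂ (multiply x∈))

    conjugate-graph : ∀ {x} (x∈ : Adjoin R p ζ x) → Span (Below powers rank) (x , conjugate x∈)
    conjugate-graph x∈ = resp (*-identityʳ _ , *-identityʳ _) (proj₂ (proj₂ (multiply x∈)) 1∈)

    graph-shift : ∀ {x y} → Span (Below powers rank) (x , y) → Span (Below powers rank) (ζ * x , ξ * y)
    graph-shift = shift

    -- Independence is proved for the powers of 1 - ζ, so the graph is rewritten in them, by the
    -- same change of generators in both components.
    powers′ : ℕ → Carrier × Carrier
    powers′ l = (1# - ζ) ^ l , (1# - ξ) ^ l

    private
      shift′ : ∀ k {xy} → Span (Below powers′ k) xy → Span (Below powers′ (suc k)) (ζ * proj₁ xy , ξ * proj₂ xy)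
      shift′ k (gen (l , l<k , p , q)) = resp (step ζ p , step ξ q) (add (gen (l , ℕ.m<n⇒m<1+n l<k , refl , refl))
        (scale (- 1# , neg-closed 1-closed) (gen (suc l , s≤s l<k , refl , refl))))
        where
        step : ∀ z {x} → x ≈ (1# - z) ^ l → (1# - z) ^ l + - 1# * ((1# - z) * (1# - z) ^ l) ≈ z * x
        step z x≈ = trans (solve 2 (λ z a → a :+ (:- :1) :* ((:1 :- z) :* a) := z :* a) refl z _) (*-congˡ (sym x≈))
      shift′ k zero           = resp (sym (zeroʳ ζ) , sym (zeroʳ ξ)) zero
      shift′ k (add x∈ y∈)    = resp (sym (distribˡ _ _ _) , sym (distribˡ _ _ _)) (add (shift′ k x∈) (shift′ k y∈))
      shift′ k (scale (s , s∈) x∈) = resp (swap s ζ _ , swap s ξ _) (scale (s , s∈) (shift′ k x∈))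
        where
        swap : ∀ s z x → s * (z * x) ≈ z * (s * x)
        swap = solve 3 (λ s z x → s :* (z :* x) := z :* (s :* x)) refl
      shift′ k (resp (p , q) x∈) = resp (*-congˡ p , *-congˡ q) (shift′ k x∈)

      powers∈ : ∀ l → Span (Below powers′ (suc l)) (powers l)
      powers∈ zero    = gen (0 , s≤s z≤n , refl , refl)
      powers∈ (suc l) = shift′ (suc l) (powers∈ l)

    graph-1-ζ : ∀ {xy} → Span (Below powers rank) xy → Span (Below powers′ rank) xy
    graph-1-ζ = Span-bind λ (l , l<r , p , q) → resp (sym p , sym q)
      (Span-bind (λ (k , k≤l , p , q) → gen (k , ℕ.≤-trans k≤l l<r , p , q)) (powers∈ l))

-- The local ring ℤ₍ₚ₎[ζ] and single-valuedness of conjugation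

module _ {c ℓ₁ ℓ₂} (K : HeytingField c ℓ₁ ℓ₂) (char0 : CharZero K) {p : ℕ} (p-prime : Prime p) (m : ℕ) where
  open LocalizedIntegers K char0 p-prime

  module CyclotomicIntegers
    {ζ : CommutativeRing.Carrier R} (ζ-root : IsRoot m ζ)
    where

    T : CommutativeRing (c ⊔ ℓ₁) ℓ₁
    T = subring R (Adjoin-isSubring R p-prime ζ)

    private
      module T where
        open CommutativeRing T public
        open Exp semiring public
        open Mult semiring public using () renaming (_×_ to _·_)
        open RingLemmas T public
        open IntegerMultiples T public
        open SemiringSum semiring public using (sum)
      module proj = SubringProjection R (Adjoin-isSubring R p-prime ζ)

    open CommutativeRing R hiding (zero)
    open Exp semiring
    open Mult semiring using () renaming (_×_ to _·_)
    open RingLemmas R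
    open IntegerMultiples R
    open IntegerSolver R
    open IsRoot ζ-root renaming (z^pⁿ≈1 to ζ^pⁿ≈1; 1-z^pᵐ-unit to 1-ζ^pᵐ-unit)
    open SetoidReasoning setoid

    private
      P = p · 1#
      ∣T∣ = Adjoin R p ζ
      module ζζ = Conjugation K char0 p-prime m ζ-root ζ-root

    open ζζ using (rank) public
    open KL using (Span; Below; gen; zero; add; scale; resp; Span-bind)

    powers-span : ∀ {x} → ∣T∣ x → Span (Below (ζ ^_) rank) x
    powers-span x∈ = project (ζζ.conjugate-graph x∈)
      where
      project : ∀ {xy} → ζζ.Span (ζζ.Below ζζ.powers rank) xy → Span (Below (ζ ^_) rank) (proj₁ xy)
      project (ζζ.gen (l , l<r , p , _)) = gen (l , l<r , p)
      project ζζ.zero          = zero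
      project (ζζ.add x∈ y∈)   = add (project x∈) (project y∈)
      project (ζζ.scale s x∈)  = scale s (project x∈)
      project (ζζ.resp (p , _) x∈) = resp p (project x∈)

    ζ^∈ : ∀ l → ∣T∣ (ζ ^ l)
    ζ^∈ l = ≡.subst ∣T∣ (proj.proj-^ (ζ , gen) l) (proj₂ ((ζ , gen) T.^ l))
      where open Adjoin

    Loc⊆T : ∀ {x} → Loc x → ∣T∣ x
    Loc⊆T = Adjoin.base

    -- With I the multiples of 1 + p y in T, the decomposition x = (1 + p y) x - p (y x) gives T = I
    -- + p T. Nakayama's lemma then puts 1 into I.
    1+py-unit : ∀ y → T.Unit (T.1# T.+ (p T.· T.1#) T.* y)
    1+py-unit (y , y∈) = T.unit {T.1# T.+ (p T.· T.1#) T.* (y , y∈)} (proj₁ 1∈I , proj₁ (proj₂ 1∈I)) (trans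
        (*-congʳ (+-congˡ (*-congʳ (reflexive (proj.proj-× p))))) (sym (proj₂ (proj₂ 1∈I))))
      where
      I : Carrier → Set (c ⊔ ℓ₁)
      I x = ∃ λ z → ∣T∣ z × x ≈ (1# + P * y) * z

      I-closed : ∀ {x} → Span I x → I x
      I-closed (gen x∈) = x∈
      I-closed zero = 0# , Loc⊆T 0-closed , sym (zeroʳ _)
      I-closed (add x∈ x′∈) =
        let z , z∈ , x≈ = I-closed x∈
            z′ , z′∈ , x′≈ = I-closed x′∈
        in z + z′ , Adjoin.add z∈ z′∈ , trans (+-cong x≈ x′≈) (sym (distribˡ _ _ _))
      I-closed (scale (s , s∈) x∈) =
        let z , z∈ , x≈ = I-closed x∈
        in s * z , Adjoin.mul (Loc⊆T s∈) z∈ , trans (*-congˡ x≈) (solve 3 (λ s a z → s :* (a :* z) := a :* (s :* z)) refl s _ z)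
      I-closed (resp p x∈) = let z , z∈ , x≈ = I-closed x∈ in z , z∈ , trans (sym p) x≈

      1∈I : I 1#
      1∈I = I-closed (nakayama I (ζ ^_) rank ∣T∣ ζ^∈
        (λ x∈ → Span-bind (λ x∈ → gen (inj₂ x∈)) (powers-span x∈))
        (λ {x} x∈ → (1# + P * y) * x , - (y * x) , (x , x∈ , refl) , Adjoin.neg (Adjoin.mul y∈ x∈) ,
          solve 3 (λ p y x → x := (:1 :+ p :* y) :* x :+ p :* (:- (y :* x))) refl P y x)
        (Loc⊆T 1-closed))

    prime-to-p-unit : ∀ k → p ∤ k → T.Unit (k T.· T.1#)
    prime-to-p-unit k p∤k = T.unit {k T.· T.1#} (proj₁ inverse , Loc⊆T (+ 1 , k , p∤k , (begin
        k · proj₁ inverse             ≈⟨ ·-lift k _ ⟩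
        (k · 1#) * proj₁ inverse      ≈⟨ proj₂ (proj₂ inverse) ⟩
        1#                            ≈⟨ +-identityʳ 1# ⟨
        1# + 0#                       ∎)))
      (trans (*-congʳ (reflexive (proj.proj-× k))) (proj₂ (proj₂ inverse)))
      where
      inverse = p∤-unit p∤k

    private
      ζᵀ t : T.Carrier
      ζᵀ = ζ , Adjoin.gen
      t = T.1# T.- ζᵀ

    1-ζ^pᵐ-regular : ∀ x → (T.1# T.- ζᵀ T.^ (p ℕ.^ m)) T.* x T.≈ T.0# → x T.≈ T.0#
    1-ζ^pᵐ-regular (x , _) sx≈0 = unit-cancelˡ x 1-ζ^pᵐ-unit
      (trans (*-congʳ (+-congˡ (-‿cong (reflexive (≡.sym (proj.proj-^ ζᵀ (p ℕ.^ m))))))) sx≈0)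

    ζᵀ-root : ζᵀ T.^ (p ℕ.^ suc m) T.≈ T.1#
    ζᵀ-root = trans (reflexive (proj.proj-^ ζᵀ (p ℕ.^ suc m))) ζ^pⁿ≈1

    1≉0ᵀ : ¬ (T.1# T.≈ T.0#)
    1≉0ᵀ = 1≉0

    private
      y = ζᵀ T.^ (p ℕ.^ m)
      G = T.geometric y p

      G≈0 : G T.≈ T.0#
      G≈0 = 1-ζ^pᵐ-regular G (T.trans {(T.1# T.- y) T.* G} {T.1# T.- y T.^ p} {T.0#}
        (T.sym {T.1# T.- y T.^ p} {(T.1# T.- y) T.* G} (T.geometric-factor y p))
        (T.x≈y⇒x-y≈0 {T.1#} {y T.^ p} (T.sym {y T.^ p} {T.1#}
          (trans (reflexive (≡.trans (proj.proj-^ y p) (≡.cong (_^ p) (proj.proj-^ ζᵀ (p ℕ.^ m))))) z^pᵐ^p≈1))))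

      -- Modulo 1 - y, p is congruent to the geometric sum G, which is zero. This has to precede the
      -- theory of the uniformizer, which takes residues as an input.
      t∣P : t T.∣ (p T.· T.1#)
      t∣P = T.∣-trans {t} {T.1# T.- y} {p T.· T.1#} (T.1-x∣1-x^k ζᵀ (p ℕ.^ m))
        (T.∣-resp {T.1# T.- y} {T.1# T.- y} {(p T.· T.1#) T.- G} {p T.· T.1#} refl
          (trans (+-congˡ (-‿cong G≈0)) (solve 1 (λ a → a :- :0 := a) refl _))
          (T.geometric-residue y p))

      inverse-mod-p : ∀ s → p ∤ s → ∃₂ λ s′ f → + 1 ℤ.- + s ℤ.* s′ ≡ f ℤ.* + p
      inverse-mod-p s p∤s with coprime-Bézout (p∤⇒coprime p∤s)
      ... | Bézout.-+ k l 1+kp≡ls = + l , ℤ.- + k , ≡.trans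
              (≡.cong (λ x → + 1 ℤ.- x) (≡.trans (ℤ.*-comm (+ s) (+ l)) (≡.trans (≡.sym (ℤ.pos-* l s))
                (≡.trans (≡.cong +_ (≡.sym 1+kp≡ls)) (≡.cong (λ x → ℤ.1ℤ ℤ.+ x) (ℤ.pos-* k p))))))
              (identity (+ k) (+ p))
        where
        identity : ∀ k p → ℤ.1ℤ ℤ.- (ℤ.1ℤ ℤ.+ k ℤ.* p) ≡ ℤ.- k ℤ.* p
        identity = solve-∀
      ... | Bézout.+- k l 1+ls≡kp = ℤ.- + l , + k , ≡.trans (identity (+ s) (+ l))
              (≡.trans (≡.cong (λ x → ℤ.1ℤ ℤ.+ x) (≡.sym (ℤ.pos-* l s))) (≡.trans (≡.cong +_ 1+ls≡kp) (ℤ.pos-* k p)))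
        where
        identity : ∀ s l → ℤ.1ℤ ℤ.- s ℤ.* ℤ.- l ≡ ℤ.1ℤ ℤ.+ l ℤ.* s
        identity = solve-∀

      -- k is i times an inverse of s modulo p, reduced to a natural number; it is the residue of i
      -- / s.
      fraction-mod-p : ∀ i s → p ∤ s → ∃₂ λ k e → i ℤ.- + s ℤ.* + k ≡ e ℤ.* + p
      fraction-mod-p i s p∤s =
        let s′ , f , eq = inverse-mod-p s p∤s
            k = (i ℤ.* s′) ℤ.%ℕ p
            q = (i ℤ.* s′) ℤ./ℕ p
        in k , i ℤ.* f ℤ.+ + s ℤ.* q , ≡.trans
          (identity₁ i (+ s) s′ q (+ p) (+ k) (ℤ.a≡a%ℕn+[a/ℕn]*n (i ℤ.* s′) p))
          (≡.trans (≡.cong (λ x → i ℤ.* x ℤ.+ + s ℤ.* q ℤ.* + p) eq) (identity₂ i f (+ s) q (+ p)))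
        where
        instance
          p≢0 : ℕ.NonZero p
          p≢0 = ℕ.>-nonZero (ℕ.<⇒≤ (prime⇒2≤ p-prime))
        identity₀ : ∀ i s k q p → i ℤ.- s ℤ.* k ≡ i ℤ.- s ℤ.* ((k ℤ.+ q ℤ.* p) ℤ.- q ℤ.* p)
        identity₀ = solve-∀
        identity₀′ : ∀ i s s′ q p → i ℤ.- s ℤ.* (i ℤ.* s′ ℤ.- q ℤ.* p) ≡ i ℤ.* (ℤ.1ℤ ℤ.- s ℤ.* s′) ℤ.+ s ℤ.* q ℤ.* p
        identity₀′ = solve-∀
        identity₁ : ∀ i s s′ q p k → i ℤ.* s′ ≡ k ℤ.+ q ℤ.* p →
          i ℤ.- s ℤ.* k ≡ i ℤ.* (ℤ.1ℤ ℤ.- s ℤ.* s′) ℤ.+ s ℤ.* q ℤ.* p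
        identity₁ i s s′ q p k eq = ≡.trans (identity₀ i s k q p)
          (≡.trans (≡.cong (λ x → i ℤ.- s ℤ.* (x ℤ.- q ℤ.* p)) (≡.sym eq)) (identity₀′ i s s′ q p))
        identity₂ : ∀ i f s q p → i ℤ.* (f ℤ.* p) ℤ.+ s ℤ.* q ℤ.* p ≡ (i ℤ.* f ℤ.+ s ℤ.* q) ℤ.* p
        identity₂ = solve-∀

      p∤1 : p ∤ 1
      p∤1 p∣1 = ℕ.<⇒≱ (prime⇒2≤ p-prime) (∣⇒≤ p∣1)

      g : Carrier
      g = proj₁ (proj₁ t∣P)

      g∈ : ∣T∣ g
      g∈ = proj₂ (proj₁ t∣P)

      P≈tg : P ≈ (1# - ζ) * g
      P≈tg = trans (reflexive (≡.sym (proj.proj-× p))) (proj₂ t∣P)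

      -- Recursion on membership in T: fractions are reduced modulo p, ζ is 1 modulo t, and sums and
      -- products follow. Residues are natural numbers, so - k is represented by (p - 1) k.
      residueᴷ : ∀ {x} → ∣T∣ x → ∃₂ λ k z → ∣T∣ z × x - k · 1# ≈ (1# - ζ) * z
      residueᴷ {x} (Adjoin.base (i , s , p∤s , sx≈i)) =
        let k , e , eq = fraction-mod-p i s p∤s
            s⁻¹ , _ , ss⁻¹≈1 = p∤-unit p∤s
            s⁻¹∈ : ∣T∣ s⁻¹
            s⁻¹∈ = Loc⊆T (+ 1 , s , p∤s , trans (trans (·-lift s s⁻¹) ss⁻¹≈1) (sym (+-identityʳ 1#)))
            e∈ : ∣T∣ (fromℤ e)
            e∈ = Loc⊆T (e , 1 , p∤1 , +-identityʳ _)
        in k , g * (s⁻¹ * fromℤ e) , Adjoin.mul g∈ (Adjoin.mul s⁻¹∈ e∈) , (begin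
          x - k · 1#                                  ≈⟨ *-identityˡ _ ⟨
          1# * (x - k · 1#)                           ≈⟨ *-congʳ ss⁻¹≈1 ⟨
          ((s · 1#) * s⁻¹) * (x - k · 1#)             ≈⟨ solve 4 (λ s u x k → (s :* u) :* (x :- k) := u :* (s :* x :- s :* k)) refl (s · 1#) s⁻¹ x (k · 1#) ⟩
          s⁻¹ * ((s · 1#) * x - (s · 1#) * (k · 1#))  ≈⟨ *-congˡ (+-cong (trans (sym (·-lift s x)) sx≈i) (-‿cong (sym (fromℤ-* (+ s) (+ k))))) ⟩
          s⁻¹ * (fromℤ i - fromℤ (+ s ℤ.* + k))       ≈⟨ *-congˡ (+-congˡ (fromℤ-neg (+ s ℤ.* + k))) ⟨
          s⁻¹ * (fromℤ i + fromℤ (ℤ.- (+ s ℤ.* + k))) ≈⟨ *-congˡ (fromℤ-+ i _) ⟨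
          s⁻¹ * fromℤ (i ℤ.- + s ℤ.* + k)             ≈⟨ *-congˡ (reflexive (≡.cong fromℤ eq)) ⟩
          s⁻¹ * fromℤ (e ℤ.* + p)                     ≈⟨ *-congˡ (fromℤ-* e (+ p)) ⟩
          s⁻¹ * (fromℤ e * P)                         ≈⟨ *-congˡ (*-congˡ P≈tg) ⟩
          s⁻¹ * (fromℤ e * ((1# - ζ) * g))            ≈⟨ solve 4 (λ u e t g → u :* (e :* (t :* g)) := t :* (g :* (u :* e))) refl s⁻¹ (fromℤ e) (1# - ζ) g ⟩
          (1# - ζ) * (g * (s⁻¹ * fromℤ e))            ∎)
      residueᴷ Adjoin.gen = 1 , - 1# , Adjoin.neg (Loc⊆T 1-closed) ,
        trans (+-congˡ (-‿cong (+-identityʳ 1#))) (solve 1 (λ z → z :- :1 := (:1 :- z) :* (:- :1)) refl ζ)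
      residueᴷ (Adjoin.add {x} {x′} x∈ x′∈) =
        let k , z , z∈ , eq = residueᴷ x∈
            k′ , z′ , z′∈ , eq′ = residueᴷ x′∈
        in k ℕ.+ k′ , z + z′ , Adjoin.add z∈ z′∈ , (begin
          (x + x′) - (k ℕ.+ k′) · 1#              ≈⟨ +-congˡ (-‿cong (fromℤ-+ (+ k) (+ k′))) ⟩
          (x + x′) - (k · 1# + k′ · 1#)           ≈⟨ solve 4 (λ x y k l → (x :+ y) :- (k :+ l) := (x :- k) :+ (y :- l)) refl x x′ _ _ ⟩
          (x - k · 1#) + (x′ - k′ · 1#)           ≈⟨ +-cong eq eq′ ⟩
          (1# - ζ) * z + (1# - ζ) * z′            ≈⟨ distribˡ _ z z′ ⟨
          (1# - ζ) * (z + z′)                     ∎)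
      residueᴷ (Adjoin.mul {x} {x′} x∈ x′∈) =
        let k , z , z∈ , eq = residueᴷ x∈
            k′ , z′ , z′∈ , eq′ = residueᴷ x′∈
        in k ℕ.* k′ , x * z′ + z * (k′ · 1#) ,
           Adjoin.add (Adjoin.mul x∈ z′∈) (Adjoin.mul z∈ (Loc⊆T (+ k′ , 1 , p∤1 , +-identityʳ _))) , (begin
          x * x′ - (k ℕ.* k′) · 1#                ≈⟨ +-congˡ (-‿cong (trans (reflexive (≡.cong fromℤ (ℤ.pos-* k k′))) (fromℤ-* (+ k) (+ k′)))) ⟩
          x * x′ - (k · 1#) * (k′ · 1#)           ≈⟨ solve 4 (λ x y k l → x :* y :- k :* l := x :* (y :- l) :+ (x :- k) :* l) refl x x′ _ _ ⟩
          x * (x′ - k′ · 1#) + (x - k · 1#) * (k′ · 1#) ≈⟨ +-cong (*-congˡ eq′) (*-congʳ eq) ⟩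
          x * ((1# - ζ) * z′) + ((1# - ζ) * z) * (k′ · 1#) ≈⟨ solve 5 (λ x t w z l → x :* (t :* w) :+ (t :* z) :* l := t :* (x :* w :+ z :* l)) refl x (1# - ζ) z′ z (k′ · 1#) ⟩
          (1# - ζ) * (x * z′ + z * (k′ · 1#))     ∎)
      residueᴷ (Adjoin.neg {x} x∈) =
        let k , z , z∈ , eq = residueᴷ x∈
            K = k · 1#
        in (p ∸ 1) ℕ.* k , - (z + g * K) , Adjoin.neg (Adjoin.add z∈ (Adjoin.mul g∈ (Loc⊆T (+ k , 1 , p∤1 , +-identityʳ _)))) , (begin
          - x - ((p ∸ 1) ℕ.* k) · 1#              ≈⟨ +-congˡ (-‿cong (trans (reflexive (≡.cong fromℤ (ℤ.pos-* (p ∸ 1) k))) (fromℤ-* (+ (p ∸ 1)) (+ k)))) ⟩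
          - x - ((p ∸ 1) · 1#) * K                ≈⟨ solve 3 (λ x q k → :- x :- q :* k := :- ((x :- k) :+ (:1 :+ q) :* k)) refl x ((p ∸ 1) · 1#) K ⟩
          - ((x - K) + (1# + (p ∸ 1) · 1#) * K)   ≈⟨ -‿cong (+-cong eq (*-congʳ (trans (reflexive (≡.cong (_· 1#) 1+p-1)) P≈tg))) ⟩
          - ((1# - ζ) * z + ((1# - ζ) * g) * K)   ≈⟨ solve 4 (λ t z g k → :- (t :* z :+ (t :* g) :* k) := t :* (:- (z :+ g :* k))) refl (1# - ζ) z g K ⟩
          (1# - ζ) * - (z + g * K)                ∎)
        where
        1+p-1 : suc (p ∸ 1) ≡ p
        1+p-1 = ℕ.m+[n∸m]≡n (ℕ.<⇒≤ (prime⇒2≤ p-prime))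
      residueᴷ (Adjoin.resp p x∈) =
        let k , z , z∈ , eq = residueᴷ x∈ in k , z , z∈ , trans (+-congʳ (sym p)) eq

    residue : ∀ x → ∃ λ k → t T.∣ (x T.- k T.· T.1#)
    residue (x , x∈) =
      let k , z , z∈ , eq = residueᴷ x∈
      in k , (z , z∈) , trans (+-congˡ (-‿cong (reflexive (proj.proj-× k)))) eq

    module Local = Uniformizer T 1≉0ᵀ p-prime m ζᵀ ζᵀ-root 1-ζ^pᵐ-regular 1+py-unit prime-to-p-unit residue

    private
      common-denominator : ∀ {n} (q : Fin n → Σ Carrier Loc) →
        ∃₂ λ s (d : Fin n → ℤ) → p ∤ s × ∀ l → (s · 1#) * proj₁ (q l) ≈ fromℤ (d l)
      common-denominator {zero}  q = 1 , (λ ()) , p∤1 , λ ()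
      common-denominator {suc n} q =
        let i , s₀ , p∤s₀ , eq₀ = proj₂ (q zero)
            s , d , p∤s , eq = common-denominator (q ∘ suc)
        in s₀ ℕ.* s , (λ { zero → + s ℤ.* i ; (suc l) → + s₀ ℤ.* d l }) , p∤* p∤s₀ p∤s , λ
          { zero → begin
              ((s₀ ℕ.* s) · 1#) * x₀                ≈⟨ *-congʳ (Mult.×1-homo-* semiring s₀ s) ⟩
              ((s₀ · 1#) * (s · 1#)) * x₀           ≈⟨ solve 3 (λ a b x → (a :* b) :* x := b :* (a :* x)) refl (s₀ · 1#) (s · 1#) x₀ ⟩
              (s · 1#) * ((s₀ · 1#) * x₀)           ≈⟨ *-congˡ (trans (sym (·-lift s₀ x₀)) eq₀) ⟩
              (s · 1#) * fromℤ i                    ≈⟨ fromℤ-* (+ s) i ⟨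
              fromℤ (+ s ℤ.* i)                     ∎
          ; (suc l) → begin
              ((s₀ ℕ.* s) · 1#) * proj₁ (q (suc l)) ≈⟨ *-congʳ (Mult.×1-homo-* semiring s₀ s) ⟩
              ((s₀ · 1#) * (s · 1#)) * proj₁ (q (suc l)) ≈⟨ *-assoc _ _ _ ⟩
              (s₀ · 1#) * ((s · 1#) * proj₁ (q (suc l))) ≈⟨ *-congˡ (eq l) ⟩
              (s₀ · 1#) * fromℤ (d l)               ≈⟨ fromℤ-* (+ s₀) (d l) ⟨
              fromℤ (+ s₀ ℤ.* d l)                  ∎
          }
        where
        x₀ = proj₁ (q zero)
        p∤* : ∀ {s s′} → p ∤ s → p ∤ s′ → p ∤ s ℕ.* s′
        p∤* {s} {s′} p∤s p∤s′ p∣ with euclidsLemma s s′ p-prime p∣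
        ... | inj₁ p∣s  = p∤s p∣s
        ... | inj₂ p∣s′ = p∤s′ p∣s′

    -- A common denominator prime to p turns the relation into one with integer coefficients, to
    -- which the descent applies.
    1-ζ-powers-independent : (q : Fin rank → Σ Carrier Loc) →
      KL.combination q (λ l → (1# - ζ) ^ toℕ l) ≈ 0# → ∀ l → proj₁ (q l) ≈ 0#
    1-ζ-powers-independent q q≈0 l =
      let s , d , p∤s , sq≈d = common-denominator q
          t-adic≈0 : Local.t-adic d T.≈ T.0#
          t-adic≈0 = begin
            proj₁ (Local.t-adic d)
              ≡⟨ proj.proj-sum (λ l → T.fromℤ (d l) T.* t T.^ toℕ l) ⟩
            R-sum (λ l → proj₁ (T.fromℤ (d l)) * proj₁ (t T.^ toℕ l))
              ≈⟨ KL.sum-cong-≋ {rank} (λ l → *-cong (reflexive (proj.proj-fromℤ (d l))) (reflexive (proj.proj-^ t (toℕ l)))) ⟩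
            R-sum (λ l → fromℤ (d l) * (1# - ζ) ^ toℕ l)
              ≈⟨ KL.sum-cong-≋ {rank} (λ l → trans (*-congʳ (sym (sq≈d l))) (*-assoc _ _ _)) ⟩
            R-sum (λ l → (s · 1#) * (proj₁ (q l) * (1# - ζ) ^ toℕ l))
              ≈⟨ SemiringSum.*-distribˡ-sum semiring {rank} (s · 1#) (λ l → proj₁ (q l) * (1# - ζ) ^ toℕ l) ⟨
            (s · 1#) * R-sum (λ l → proj₁ (q l) * (1# - ζ) ^ toℕ l)
              ≈⟨ *-congˡ q≈0 ⟩
            (s · 1#) * 0#
              ≈⟨ zeroʳ _ ⟩
            0# ∎
      in unit-cancelˡ _ (p∤-unit p∤s) (trans (sq≈d l) (reflexive (≡.cong fromℤ (Local.t-adic-independent d t-adic≈0 l))))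
      where
      R-sum : (Fin rank → Carrier) → Carrier
      R-sum = SemiringSum.sum semiring

    module _ {ξ : Carrier} (ξ-root : IsRoot m ξ) where
      private module ζξ = Conjugation K char0 p-prime m ζ-root ξ-root

      -- The difference of the two pairs is one combination of pairs of powers of (1 - ζ, 1 - ξ).
      -- Its first component vanishes, so independence kills the coefficients and with them the
      -- second component.
      conjugate-unique : ∀ {x x′ y y′} → ζξ.Span (ζξ.Below ζξ.powers rank) (x , y) →
        ζξ.Span (ζξ.Below ζξ.powers rank) (x′ , y′) → x ≈ x′ → y ≈ y′
      conjugate-unique {x} {x′} {y} {y′} xy∈ xy′∈ x≈x′ =
        let q , eq , eq′ = ζξ.Span-coefficients ζξ.powers′ (ζξ.graph-1-ζ
              (ζξ.add xy∈ (ζξ.scale (- 1# , neg-closed 1-closed) xy′∈)))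
            q≈0 = 1-ζ-powers-independent q (begin
              KL.combination q (λ l → (1# - ζ) ^ toℕ l)                         ≡⟨ proj₁-combination q ⟨
              proj₁ (ζξ.combination q (ζξ.powers′ ∘ toℕ))                       ≈⟨ eq ⟨
              x + - 1# * x′                                                     ≈⟨ solve 2 (λ x y → x :+ (:- :1) :* y := x :- y) refl x x′ ⟩
              x - x′                                                            ≈⟨ x≈y⇒x-y≈0 x≈x′ ⟩
              0#                                                                ∎)
        in x-y≈0⇒x≈y (begin
          y - y′                                       ≈⟨ solve 2 (λ x y → x :- y := x :+ (:- :1) :* y) refl y y′ ⟩
          y + - 1# * y′                                ≈⟨ eq′ ⟩
          proj₂ (ζξ.combination q (ζξ.powers′ ∘ toℕ))  ≡⟨ proj₂-combination q ⟩
          KL.combination q (λ l → (1# - ξ) ^ toℕ l)    ≈⟨ KL.sum-zero {rank} _ (λ l → trans (*-congʳ (q≈0 l)) (zeroˡ _)) ⟩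
          0#                                           ∎)
        where
        proj₁-sum : ∀ {n} (f : Fin n → Carrier × Carrier) → proj₁ (ζξ.sum f) ≡ KL.sum (proj₁ ∘ f)
        proj₁-sum {zero}  f = ≡.refl
        proj₁-sum {suc n} f = ≡.cong (λ x → proj₁ (f zero) + x) (proj₁-sum (f ∘ suc))
        proj₂-sum : ∀ {n} (f : Fin n → Carrier × Carrier) → proj₂ (ζξ.sum f) ≡ KL.sum (proj₂ ∘ f)
        proj₂-sum {zero}  f = ≡.refl
        proj₂-sum {suc n} f = ≡.cong (λ x → proj₂ (f zero) + x) (proj₂-sum (f ∘ suc))
        proj₁-combination : ∀ q → proj₁ (ζξ.combination q (ζξ.powers′ ∘ toℕ)) ≡ KL.combination q (λ l → (1# - ζ) ^ toℕ l)
        proj₁-combination q = proj₁-sum {rank} _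
        proj₂-combination : ∀ q → proj₂ (ζξ.combination q (ζξ.powers′ ∘ toℕ)) ≡ KL.combination q (λ l → (1# - ξ) ^ toℕ l)
        proj₂-combination q = proj₂-sum {rank} _

-- The Dedekind embedding

Adjoin-mono : (R : CommutativeRing ℓᵃ ℓ₁) {p : ℕ} {z w : CommutativeRing.Carrier R} → Adjoin R p w z →
              ∀ {x} → Adjoin R p z x → Adjoin R p w x
Adjoin-mono R z∈ (Adjoin.base x∈)   = Adjoin.base x∈
Adjoin-mono R z∈ Adjoin.gen         = z∈
Adjoin-mono R z∈ (Adjoin.add x∈ y∈) = Adjoin.add (Adjoin-mono R z∈ x∈) (Adjoin-mono R z∈ y∈)
Adjoin-mono R z∈ (Adjoin.mul x∈ y∈) = Adjoin.mul (Adjoin-mono R z∈ x∈) (Adjoin-mono R z∈ y∈)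
Adjoin-mono R z∈ (Adjoin.neg x∈)    = Adjoin.neg (Adjoin-mono R z∈ x∈)
Adjoin-mono R z∈ (Adjoin.resp p x∈) = Adjoin.resp p (Adjoin-mono R z∈ x∈)

module Units {p : ℕ} (p-prime : Prime p) (m : ℕ) where
  open PrimeTo p-prime

  I : Set
  I = UnitsMod (p ℕ.^ suc m)

  rank : ℕ
  rank = (p ∸ 1) ℕ.* p ℕ.^ m

  rep : I → ℕ
  rep i = toℕ (UnitsMod.rep i)

  p∤⇒coprime-^ : ∀ {a} → p ∤ a → ∀ n → Coprime a (p ℕ.^ n)
  p∤⇒coprime-^ p∤a zero    (_ , d∣1) = ℕ.∣1⇒≡1 d∣1
  p∤⇒coprime-^ p∤a (suc n) {d} (d∣a , d∣) = p∤⇒coprime-^ p∤a n (d∣a , coprime-divisor d-coprime d∣)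
    where
    d-coprime : Coprime d p
    d-coprime (e∣d , e∣p) with prime⇒irreducible p-prime e∣p
    ... | inj₁ e≡1    = e≡1
    ... | inj₂ ≡.refl = ⊥-elim (p∤a (ℕ.∣-trans e∣d d∣a))

  -- The coprimality proof is irrelevant and cannot yield the result directly; divisibility is
  -- decided first, and the proof serves only to refute one case.
  p∤rep : ∀ i → p ∤ rep i
  p∤rep record { rep = r ; coprime = coprime } with p ℕ.∣? toℕ r
  ... | no p∤r  = p∤r
  ... | yes p∣r = ⊥-elim-irr (p∤1 (ℕ.∣-reflexive (coprime (p∣r , ℕ.m∣m*n (p ℕ.^ m)))))

  index : I → ℕ
  index i = proj₁ (nth-surjective (rep i) (p∤rep i))

  nth-index : ∀ i → nth (index i) ≡ rep i
  nth-index i = proj₂ (nth-surjective (rep i) (p∤rep i))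

  index<rank : ∀ i → index i ℕ.< rank
  index<rank i = nth<p^⇒k<rank m (index i) (≡.subst (ℕ._< p ℕ.^ suc m) (≡.sym (nth-index i)) (Fin.toℕ<n (UnitsMod.rep i)))

  point : ∀ k → k ℕ.< rank → I
  point k k<r = record
    { rep     = fromℕ< (k<rank⇒nth<p^ m k k<r)
    ; coprime = ≡.subst (λ a → Coprime a (p ℕ.^ suc m)) (≡.sym (Fin.toℕ-fromℕ< _)) (p∤⇒coprime-^ (p∤nth k) (suc m))
    }

  nth-injective : ∀ {k l} → nth k ≡ nth l → k ≡ l
  nth-injective {k} {l} eq = ℕ.suc-injective (≡.trans (≡.sym (N-nth k)) (≡.trans (≡.cong (N p) eq) (N-nth l)))

  index-point : ∀ k k<r → index (point k k<r) ≡ k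
  index-point k k<r = nth-injective (≡.trans (nth-index (point k k<r)) (Fin.toℕ-fromℕ< _))

  rep-injective : ∀ {i j : I} → rep i ≡ rep j → i ≡ j
  rep-injective {i} {j} eq = lemma i j (Fin.toℕ-injective eq)
    where
    lemma : ∀ (i j : I) → UnitsMod.rep i ≡ UnitsMod.rep j → i ≡ j
    lemma record { rep = _ } record { rep = _ } ≡.refl = ≡.refl

  point-index : ∀ i → point (index i) (index<rank i) ≡ i
  point-index i = rep-injective (≡.trans (Fin.toℕ-fromℕ< _) (nth-index i))

module Dedekind {c ℓ₁ ℓ₂} (K : HeytingField c ℓ₁ ℓ₂) (char0 : CharZero K) {p : ℕ} (p-prime : Prime p) (m : ℕ)
  (ζ : HeytingField.Carrier K)
  (ζ-primitive : IsPrimitiveRoot (Cyclotomic.field-ring K p-prime (suc m) ζ) (p ℕ.^ suc m) ζ)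
  where

  open Cyclotomic K p-prime (suc m) ζ
  open LocalizedIntegers K char0 p-prime hiding (R; 1≉0)
  private
    ζ-root = primitive⇒root m ζ-primitive
    module O = CyclotomicIntegers K char0 p-prime m ζ-root
    module units = Units p-prime m
    module proj = SubringProjection field-ring (Adjoin-isSubring field-ring p-prime ζ)
    module 𝕋 where
      open CommutativeRing T public
      open Exp semiring public
      open RingLemmas T public
    module KK = LinearCombinations (CommutativeRing.ring ℤ₍ₚ₎) (DirectProduct.leftModule KM KM)
    module M = LeftModule Source
    module ML = LinearCombinations 𝕋.ring Source
  open units using (I; rep; p∤rep; index; nth-index; index<rank; point; index-point; point-index)
  open PrimeTo p-prime using (nth; weight; p-part; nth-mono-<; k<rank⇒nth<p^; nth<p^⇒k<rank; nth-surjective;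
    newtonExponent-minimal; newtonExponent-valuation; N-nth; p-adic-factor; p-part-p^v*d)

  open CommutativeRing field-ring hiding (zero)
  open Exp semiring
  open RingProperties ring using (-‿distribʳ-*)
  open IntegerSolver field-ring
  open SetoidReasoning setoid
  open T⊗T using (_⊗_; _⊕_; ⊖_; 𝟎; _≋_; _▷_; ⊗-cong; ⊗-distribʳ; ⊗-distribˡ; ⊗-balanced)

  module Conj (i : I) where
    ξ : Carrier
    ξ = ζ ^ rep i
    ξ-root : IsRoot m ξ
    ξ-root = root-^ m (rep i) (p∤rep i) ζ-root
    open Conjugation K char0 p-prime m ζ-root ξ-root public

  σ : I → ∣T∣ → ∣T∣
  σ i (x , x∈) = Conj.conjugate i x∈ , Adjoin-mono field-ring (O.ζ^∈ (rep i)) (Conj.conjugate∈ i x∈)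

  Graph : ∀ i → Carrier × Carrier → Set _
  Graph i = KK.Span (KK.Below (Conj.powers i) rank)

  σ-graph : ∀ i x → Graph i (proj₁ x , proj₁ (σ i x))
  σ-graph i (x , x∈) = Conj.conjugate-graph i x∈

  σ-unique : ∀ i x {y v} → Graph i (y , v) → proj₁ x ≈ y → proj₁ (σ i x) ≈ v
  σ-unique i x yv∈ x≈y = O.conjugate-unique (Conj.ξ-root i) (σ-graph i x) yv∈ x≈y

  σ-cong : ∀ i x y → proj₁ x ≈ proj₁ y → proj₁ (σ i x) ≈ proj₁ (σ i y)
  σ-cong i x y = σ-unique i x (σ-graph i y)

  σ-+ : ∀ i x y → proj₁ (σ i (x 𝕋.+ y)) ≈ proj₁ (σ i x) + proj₁ (σ i y)
  σ-+ i x y = σ-unique i (x 𝕋.+ y) (KK.add (σ-graph i x) (σ-graph i y)) refl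

  σ-* : ∀ i s x → proj₁ (σ i (inclusion s 𝕋.* x)) ≈ proj₁ s * proj₁ (σ i x)
  σ-* i s x = σ-unique i (inclusion s 𝕋.* x) (KK.scale s (σ-graph i x)) refl

  σ-ζ* : ∀ i x → proj₁ (σ i (ζᵀ 𝕋.* x)) ≈ ζ ^ rep i * proj₁ (σ i x)
  σ-ζ* i x = σ-unique i (ζᵀ 𝕋.* x) (Conj.graph-shift i (σ-graph i x)) refl

  σ-ζ^ : ∀ i l → l ℕ.< rank → proj₁ (σ i (ζᵀ 𝕋.^ l)) ≈ (ζ ^ rep i) ^ l
  σ-ζ^ i l l<r = σ-unique i (ζᵀ 𝕋.^ l) (KK.gen (l , l<r , refl , refl)) (reflexive (proj.proj-^ ζᵀ l))

  private
    ∣M∣ = LeftModule.Carrierᴹ Source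
    ∣N∣ = LeftModule.Carrierᴹ Target

  δ₀ : ∣M∣ → ∣N∣
  δ₀ (x ⊗ y) i = x 𝕋.* σ i y
  δ₀ (u ⊕ v) i = δ₀ u i 𝕋.+ δ₀ v i
  δ₀ (⊖ u)   i = 𝕋.- δ₀ u i
  δ₀ 𝟎       i = 𝕋.0#

  δ₀-cong : ∀ {u v} → u ≋ v → ∀ i → proj₁ (δ₀ u i) ≈ proj₁ (δ₀ v i)
  δ₀-cong T⊗T.≋-refl i            = refl
  δ₀-cong (T⊗T.≋-sym p) i         = sym (δ₀-cong p i)
  δ₀-cong (T⊗T.≋-trans p q) i     = trans (δ₀-cong p i) (δ₀-cong q i)
  δ₀-cong (T⊗T.⊕-cong p q) i      = +-cong (δ₀-cong p i) (δ₀-cong q i)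
  δ₀-cong (T⊗T.⊖-cong p) i        = -‿cong (δ₀-cong p i)
  δ₀-cong (T⊗T.⊕-assoc u v w) i   = +-assoc _ _ _
  δ₀-cong (T⊗T.⊕-comm u v) i      = +-comm _ _
  δ₀-cong (T⊗T.⊕-identityˡ u) i   = +-identityˡ _
  δ₀-cong (T⊗T.⊕-inverseˡ u) i    = -‿inverseˡ _
  δ₀-cong (⊗-cong {y = y} {y′} p q) i = *-cong p (σ-cong i y y′ q)
  δ₀-cong (⊗-distribʳ x x′ y) i   = distribʳ _ _ _
  δ₀-cong (⊗-distribˡ x y y′) i   = trans (*-congˡ (σ-+ i y y′)) (distribˡ _ _ _)
  δ₀-cong (⊗-balanced s x y) i    = sym (begin
    proj₁ x * proj₁ (σ i (inclusion s 𝕋.* y))  ≈⟨ *-congˡ (σ-* i s y) ⟩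
    proj₁ x * (proj₁ s * proj₁ (σ i y))        ≈⟨ solve 3 (λ x s y → x :* (s :* y) := (s :* x) :* y) refl (proj₁ x) (proj₁ s) _ ⟩
    (proj₁ s * proj₁ x) * proj₁ (σ i y)        ∎)

  δ₀-▷ : ∀ s u i → proj₁ (δ₀ (s ▷ u) i) ≈ proj₁ s * proj₁ (δ₀ u i)
  δ₀-▷ s (x ⊗ y) i = *-assoc _ _ _
  δ₀-▷ s (u ⊕ v) i = trans (+-cong (δ₀-▷ s u i) (δ₀-▷ s v i)) (sym (distribˡ _ _ _))
  δ₀-▷ s (⊖ u)   i = trans (-‿cong (δ₀-▷ s u i)) (-‿distribʳ-* _ _)
  δ₀-▷ s 𝟎       i = sym (zeroʳ _)

  δ₀-linear : IsLeftModuleHomomorphism δ₀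
  δ₀-linear = record
    { +ᴹ-isGroupHomomorphism = record
      { isMonoidHomomorphism = record
        { isMagmaHomomorphism = record
          { isRelHomomorphism = record { cong = δ₀-cong }
          ; homo = λ _ _ _ → refl
          }
        ; ε-homo = λ _ → refl
        }
      ; ⁻¹-homo = λ _ _ → refl
      }
    ; *ₗ-homo = δ₀-▷
    }

  δ₀-Dedekind : IsDedekindMap δ₀
  δ₀-Dedekind = record
    { linear = δ₀-linear
    ; on-ζ   = λ k l k<r l<r i → begin
        proj₁ (ζᵀ 𝕋.^ k) * proj₁ (σ i (ζᵀ 𝕋.^ l))  ≈⟨ *-cong (reflexive (proj.proj-^ ζᵀ k)) (σ-ζ^ i l l<r) ⟩
        ζ ^ k * (ζ ^ rep i) ^ l                     ≈⟨ *-congˡ (^-assocʳ ζ (rep i) l) ⟩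
        ζ ^ k * ζ ^ (rep i ℕ.* l)                   ≈⟨ ^-homo-* ζ k (rep i ℕ.* l) ⟨
        ζ ^ (k ℕ.+ rep i ℕ.* l)                     ≡⟨ proj.proj-^ ζᵀ (k ℕ.+ rep i ℕ.* l) ⟨
        proj₁ (ζᵀ 𝕋.^ (k ℕ.+ rep i ℕ.* l))          ∎
    }

  ⊗-zeroʳ : ∀ x y → proj₁ y ≈ 0# → x ⊗ y ≋ 𝟎
  ⊗-zeroʳ x y y≈0 = M.≈ᴹ-trans (⊗-cong {x} {x} {y} {inclusion 0ℤ 𝕋.* y} refl (trans y≈0 (sym (zeroˡ _))))
    (M.≈ᴹ-trans (M.≈ᴹ-sym (⊗-balanced 0ℤ x y)) (M.≈ᴹ-trans
      (⊗-cong {inclusion 0ℤ 𝕋.* x} {𝕋.0# 𝕋.* x} {y} {y} refl refl) (M.*ₗ-zeroˡ (x ⊗ y))))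
    where 0ℤ = CommutativeRing.0# ℤ₍ₚ₎

  Graph⇒∈ : ∀ i {xy} → Graph i xy → Adjoin field-ring p ζ (proj₁ xy)
  Graph⇒∈ i (KK.gen (l , _ , p , _)) = Adjoin.resp (sym p) (O.ζ^∈ l)
  Graph⇒∈ i KK.zero          = O.Loc⊆T 0-closed
  Graph⇒∈ i (KK.add x∈ y∈)   = Adjoin.add (Graph⇒∈ i x∈) (Graph⇒∈ i y∈)
  Graph⇒∈ i (KK.scale s x∈)  = Adjoin.mul (O.Loc⊆T (proj₂ s)) (Graph⇒∈ i x∈)
  Graph⇒∈ i (KK.resp p x∈)   = Adjoin.resp (proj₁ p) (Graph⇒∈ i x∈)

  module _ (δ : ∣M∣ → ∣N∣) (δ-Dedekind : IsDedekindMap δ) where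
    open IsDedekindMap δ-Dedekind
    private module δ = IsLeftModuleHomomorphism linear

    -- A Dedekind map is prescribed on powers of ζ only; recursion along the graph extends this to
    -- all 1 ⊗ x. The membership proof of x may be arbitrary because ⊗ respects equality in K.
    δ-1⊗ : ∀ i {xy} → Graph i xy → (x∈ : Adjoin field-ring p ζ (proj₁ xy)) →
           proj₁ (δ (𝕋.1# ⊗ (proj₁ xy , x∈)) i) ≈ proj₂ xy
    δ-1⊗ i (KK.gen {x , y} (l , l<r , x≈ , y≈)) x∈ = begin
      proj₁ (δ (𝕋.1# ⊗ (x , x∈)) i)
        ≈⟨ δ.⟦⟧-cong (⊗-cong {𝕋.1#} {𝕋.1#} {x , x∈} {ζᵀ 𝕋.^ l} refl (trans x≈ (reflexive (≡.sym (proj.proj-^ ζᵀ l))))) i ⟩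
      proj₁ (δ ((ζᵀ 𝕋.^ 0) ⊗ (ζᵀ 𝕋.^ l)) i)
        ≈⟨ on-ζ 0 l (ℕ.≤-<-trans z≤n l<r) l<r i ⟩
      proj₁ (ζᵀ 𝕋.^ (rep i ℕ.* l))
        ≡⟨ proj.proj-^ ζᵀ (rep i ℕ.* l) ⟩
      ζ ^ (rep i ℕ.* l)
        ≈⟨ ^-assocʳ ζ (rep i) l ⟨
      (ζ ^ rep i) ^ l
        ≈⟨ y≈ ⟨
      y ∎
    δ-1⊗ i KK.zero x∈ = trans (δ.⟦⟧-cong (⊗-zeroʳ 𝕋.1# (0# , x∈) refl) i) (δ.0ᴹ-homo i)
    δ-1⊗ i (KK.add {x , y} {x′ , y′} xy∈ xy′∈) x∈ = begin
      proj₁ (δ (𝕋.1# ⊗ (x + x′ , x∈)) i)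
        ≈⟨ δ.⟦⟧-cong (M.≈ᴹ-trans (⊗-cong {𝕋.1#} {𝕋.1#} {x + x′ , x∈} {a 𝕋.+ a′} refl refl) (⊗-distribˡ 𝕋.1# a a′)) i ⟩
      proj₁ (δ (𝕋.1# ⊗ a ⊕ 𝕋.1# ⊗ a′) i)
        ≈⟨ δ.+ᴹ-homo (𝕋.1# ⊗ a) (𝕋.1# ⊗ a′) i ⟩
      proj₁ (δ (𝕋.1# ⊗ a) i) + proj₁ (δ (𝕋.1# ⊗ a′) i)
        ≈⟨ +-cong (δ-1⊗ i xy∈ _) (δ-1⊗ i xy′∈ _) ⟩
      y + y′ ∎
      where
      a = x , Graph⇒∈ i xy∈
      a′ = x′ , Graph⇒∈ i xy′∈
    δ-1⊗ i (KK.scale {x , y} s xy∈) x∈ = begin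
      proj₁ (δ (𝕋.1# ⊗ (proj₁ s * x , x∈)) i)
        ≈⟨ δ.⟦⟧-cong (M.≈ᴹ-trans (⊗-cong {𝕋.1#} {𝕋.1#} {proj₁ s * x , x∈} {inclusion s 𝕋.* a} refl refl)
             (M.≈ᴹ-sym (⊗-balanced s 𝕋.1# a))) i ⟩
      proj₁ (δ (inclusion s ▷ (𝕋.1# ⊗ a)) i)
        ≈⟨ δ.*ₗ-homo (inclusion s) (𝕋.1# ⊗ a) i ⟩
      proj₁ s * proj₁ (δ (𝕋.1# ⊗ a) i)
        ≈⟨ *-congˡ (δ-1⊗ i xy∈ _) ⟩
      proj₁ s * y ∎
      where a = x , Graph⇒∈ i xy∈
    δ-1⊗ i (KK.resp {x , y} {x′ , y′} (p , q) xy∈) x∈ = begin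
      proj₁ (δ (𝕋.1# ⊗ (x′ , x∈)) i)  ≈⟨ δ.⟦⟧-cong (⊗-cong {𝕋.1#} {𝕋.1#} {x′ , x∈} {x , Graph⇒∈ i xy∈} refl (sym p)) i ⟩
      proj₁ (δ (𝕋.1# ⊗ (x , Graph⇒∈ i xy∈)) i) ≈⟨ δ-1⊗ i xy∈ _ ⟩
      y                                ≈⟨ q ⟩
      y′                               ∎

    δ-⊗ : ∀ x y i → proj₁ (δ (x ⊗ y) i) ≈ proj₁ x * proj₁ (σ i y)
    δ-⊗ x y i = begin
      proj₁ (δ (x ⊗ y) i)                 ≈⟨ δ.⟦⟧-cong (⊗-cong {x} {x 𝕋.* 𝕋.1#} {y} {y} (sym (*-identityʳ _)) refl) i ⟩
      proj₁ (δ (x ▷ (𝕋.1# ⊗ y)) i)        ≈⟨ δ.*ₗ-homo x (𝕋.1# ⊗ y) i ⟩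
      proj₁ x * proj₁ (δ (𝕋.1# ⊗ y) i)    ≈⟨ *-congˡ (δ-1⊗ i (σ-graph i y) (proj₂ y)) ⟩
      proj₁ x * proj₁ (σ i y)             ∎

  -- Multiplication by 1 ⊗ ζ and the Newton basis of T ⊗ T

  Θ : ∣M∣ → ∣M∣
  Θ (x ⊗ y) = x ⊗ (ζᵀ 𝕋.* y)
  Θ (u ⊕ v) = Θ u ⊕ Θ v
  Θ (⊖ u)   = ⊖ Θ u
  Θ 𝟎       = 𝟎

  Θ-cong : ∀ {u v} → u ≋ v → Θ u ≋ Θ v
  Θ-cong T⊗T.≋-refl            = T⊗T.≋-refl
  Θ-cong (T⊗T.≋-sym p)         = T⊗T.≋-sym (Θ-cong p)
  Θ-cong (T⊗T.≋-trans p q)     = T⊗T.≋-trans (Θ-cong p) (Θ-cong q)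
  Θ-cong (T⊗T.⊕-cong p q)      = T⊗T.⊕-cong (Θ-cong p) (Θ-cong q)
  Θ-cong (T⊗T.⊖-cong p)        = T⊗T.⊖-cong (Θ-cong p)
  Θ-cong (T⊗T.⊕-assoc u v w)   = T⊗T.⊕-assoc _ _ _
  Θ-cong (T⊗T.⊕-comm u v)      = T⊗T.⊕-comm _ _
  Θ-cong (T⊗T.⊕-identityˡ u)   = T⊗T.⊕-identityˡ _
  Θ-cong (T⊗T.⊕-inverseˡ u)    = T⊗T.⊕-inverseˡ _
  Θ-cong (⊗-cong p q)          = ⊗-cong p (*-congˡ q)
  Θ-cong (⊗-distribʳ x x′ y)   = ⊗-distribʳ _ _ _
  Θ-cong (⊗-distribˡ x y y′)   = T⊗T.≋-trans (⊗-cong {x} {x} {ζᵀ 𝕋.* (y 𝕋.+ y′)} {ζᵀ 𝕋.* y 𝕋.+ ζᵀ 𝕋.* y′} refl (distribˡ _ _ _)) (⊗-distribˡ _ _ _)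
  Θ-cong (⊗-balanced s x y)    = T⊗T.≋-trans (⊗-balanced s x (ζᵀ 𝕋.* y))
    (⊗-cong {x} {x} {inclusion s 𝕋.* (ζᵀ 𝕋.* y)} {ζᵀ 𝕋.* (inclusion s 𝕋.* y)} refl
      (solve 3 (λ s z y → s :* (z :* y) := z :* (s :* y)) refl (proj₁ s) ζ (proj₁ y)))

  Θ-▷ : ∀ s u → Θ (s ▷ u) ≋ s ▷ Θ u
  Θ-▷ s (x ⊗ y) = T⊗T.≋-refl
  Θ-▷ s (u ⊕ v) = T⊗T.⊕-cong (Θ-▷ s u) (Θ-▷ s v)
  Θ-▷ s (⊖ u)   = T⊗T.⊖-cong (Θ-▷ s u)
  Θ-▷ s 𝟎       = T⊗T.≋-refl

  Θ-linear : LeftModuleMorphisms.IsLeftModuleHomomorphism M.rawLeftModule M.rawLeftModule Θ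
  Θ-linear = record
    { +ᴹ-isGroupHomomorphism = record
      { isMonoidHomomorphism = record
        { isMagmaHomomorphism = record
          { isRelHomomorphism = record { cong = Θ-cong }
          ; homo = λ _ _ → T⊗T.≋-refl
          }
        ; ε-homo = T⊗T.≋-refl
        }
      ; ⁻¹-homo = λ _ → T⊗T.≋-refl
      }
    ; *ₗ-homo = Θ-▷
    }

  Θ^ : ℕ → ∣M∣
  Θ^ l = 𝕋.1# ⊗ (ζᵀ 𝕋.^ l)

  private Θ-Span = ML.Span (ML.Below Θ^ rank)

  KL-∈ : ∀ {y} → KL.Span (KL.Below (ζ ^_) rank) y → Adjoin field-ring p ζ y
  KL-∈ (KL.gen (l , _ , y≈)) = Adjoin.resp (sym y≈) (O.ζ^∈ l)
  KL-∈ KL.zero         = O.Loc⊆T 0-closed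
  KL-∈ (KL.add x∈ y∈)  = Adjoin.add (KL-∈ x∈) (KL-∈ y∈)
  KL-∈ (KL.scale s x∈) = Adjoin.mul (O.Loc⊆T (proj₂ s)) (KL-∈ x∈)
  KL-∈ (KL.resp p x∈)  = Adjoin.resp p (KL-∈ x∈)

  -- The ℤ₍ₚ₎-coefficients of y in the powers of ζ move to the left factor by balancedness.
  ⊗-spanned : ∀ x {y} → KL.Span (KL.Below (ζ ^_) rank) y → (y∈ : Adjoin field-ring p ζ y) → Θ-Span (x ⊗ (y , y∈))
  ⊗-spanned x (KL.gen {y} (l , l<r , y≈)) y∈ = ML.resp
    (⊗-cong {x 𝕋.* 𝕋.1#} {x} {ζᵀ 𝕋.^ l} {y , y∈} (*-identityʳ _) (trans (reflexive (proj.proj-^ ζᵀ l)) (sym y≈)))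
    (ML.scale x (ML.gen (l , l<r , T⊗T.≋-refl)))
  ⊗-spanned x KL.zero y∈ = ML.resp (T⊗T.≋-sym (⊗-zeroʳ x (0# , y∈) refl)) ML.zero
  ⊗-spanned x (KL.add {y} {y′} y∈S y′∈S) y∈ = ML.resp
    (T⊗T.≋-trans (T⊗T.≋-sym (⊗-distribˡ x a a′)) (⊗-cong {x} {x} {a 𝕋.+ a′} {y + y′ , y∈} refl refl))
    (ML.add (⊗-spanned x y∈S (proj₂ a)) (⊗-spanned x y′∈S (proj₂ a′)))
    where
    a a′ : ∣T∣
    a  = y , KL-∈ y∈S
    a′ = y′ , KL-∈ y′∈S
  ⊗-spanned x (KL.scale {y} s y∈S) y∈ = ML.resp
    (T⊗T.≋-trans (⊗-balanced s x a) (⊗-cong {x} {x} {inclusion s 𝕋.* a} {proj₁ s * y , y∈} refl refl))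
    (ML.scale (inclusion s) (⊗-spanned x y∈S (proj₂ a)))
    where
    a : ∣T∣
    a = y , KL-∈ y∈S
  ⊗-spanned x (KL.resp {y} {y′} p y∈S) y∈ = ML.resp
    (⊗-cong {x} {x} {y , KL-∈ y∈S} {y′ , y∈} refl p) (⊗-spanned x y∈S (KL-∈ y∈S))

  Θ^-spans : ∀ u → Θ-Span u
  Θ^-spans (x ⊗ (y , y∈)) = ⊗-spanned x (O.powers-span y∈) y∈
  Θ^-spans (u ⊕ v) = ML.add (Θ^-spans u) (Θ^-spans v)
  Θ^-spans (⊖ u)   = ML.resp (inverseˡ-unique _ _ (M.≈ᴹ-trans (M.+ᴹ-congˡ (M.≈ᴹ-sym (M.*ₗ-identityˡ u)))
      (M.≈ᴹ-trans (M.≈ᴹ-sym (M.*ₗ-distribʳ u (𝕋.- 𝕋.1#) 𝕋.1#)) (M.≈ᴹ-trans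
        (M.*ₗ-cong {x = 𝕋.- 𝕋.1# 𝕋.+ 𝕋.1#} {𝕋.0#} {u} {u} (-‿inverseˡ 1#) T⊗T.≋-refl) (M.*ₗ-zeroˡ u)))))
    (ML.scale (𝕋.- 𝕋.1#) (Θ^-spans u))
    where open AbelianGroupProperties T⊗T.⊕-abelianGroup using (inverseˡ-unique)
  Θ^-spans 𝟎       = ML.zero

  z : ℕ → ∣T∣
  z k = ζᵀ 𝕋.^ nth k

  z-z∼t^weight : ∀ {l k} → l ℕ.< k → k ℕ.< rank →
    ∃ λ u → 𝕋.Unit u × z k 𝕋.- z l 𝕋.≈ u 𝕋.* t 𝕋.^ weight m k l
  z-z∼t^weight {l} {k} l<k k<r =
    let a = nth k
        b = nth l
        b<a = nth-mono-< l<k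
        -- The difference is positive and below p^n, so its p-adic valuation is at most m, the level
        -- at which `weight m` stops.
        v , d , v≤m , p∤d , a∸b≡ = p-adic-factor (suc m) (a ∸ b) (ℕ.m<n⇒0<n∸m b<a)
                                     (ℕ.≤-<-trans (ℕ.m∸n≤m a b) (k<rank⇒nth<p^ m k k<r))
        u , u-unit , eq = O.Local.ζ^-ζ^∼t v d b (ℕ.s≤s⁻¹ v≤m) p∤d
        a≡ : b ℕ.+ p ℕ.^ v ℕ.* d ≡ a
        a≡ = ≡.trans (≡.cong (b ℕ.+_) (≡.sym a∸b≡)) (ℕ.m+[n∸m]≡n (ℕ.<⇒≤ b<a))
        w≡ : p ℕ.^ v ≡ weight m k l
        w≡ = ≡.trans (≡.sym (p-part-p^v*d m v d (ℕ.s≤s⁻¹ v≤m) p∤d)) (≡.cong (p-part m) (≡.sym a∸b≡))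
    in u , u-unit , ≡.subst₂ (λ a w → ζᵀ 𝕋.^ a 𝕋.- z l 𝕋.≈ u 𝕋.* t 𝕋.^ w) a≡ w≡ eq

  private
    module Newton = NewtonBasis T t O.Local.t-regular index index<rank point index-point point-index
      z (weight m) z-z∼t^weight

  module Newton-δ (δ : ∣M∣ → ∣N∣) (δ-Dedekind : IsDedekindMap δ) where
    open IsDedekindMap δ-Dedekind
    private module δ = IsLeftModuleHomomorphism linear

    δ-Θ : ∀ u i → proj₁ (δ (Θ u) i) ≈ proj₁ (z (index i)) * proj₁ (δ u i)
    δ-Θ (x ⊗ y) i = begin
      proj₁ (δ (x ⊗ (ζᵀ 𝕋.* y)) i)               ≈⟨ δ-⊗ δ δ-Dedekind x (ζᵀ 𝕋.* y) i ⟩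
      proj₁ x * proj₁ (σ i (ζᵀ 𝕋.* y))           ≈⟨ *-congˡ (σ-ζ* i y) ⟩
      proj₁ x * (ζ ^ rep i * proj₁ (σ i y))      ≈⟨ solve 3 (λ x z y → x :* (z :* y) := z :* (x :* y)) refl _ _ _ ⟩
      ζ ^ rep i * (proj₁ x * proj₁ (σ i y))      ≈⟨ *-cong (reflexive (≡.trans (≡.cong (ζ ^_) (≡.sym (nth-index i))) (≡.sym (proj.proj-^ ζᵀ (nth (index i))))))
                                                      (sym (δ-⊗ δ δ-Dedekind x y i)) ⟩
      proj₁ (z (index i)) * proj₁ (δ (x ⊗ y) i)  ∎
    δ-Θ (u ⊕ v) i = begin
      proj₁ (δ (Θ u ⊕ Θ v) i)                    ≈⟨ δ.+ᴹ-homo (Θ u) (Θ v) i ⟩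
      proj₁ (δ (Θ u) i) + proj₁ (δ (Θ v) i)      ≈⟨ +-cong (δ-Θ u i) (δ-Θ v i) ⟩
      zᵢ * proj₁ (δ u i) + zᵢ * proj₁ (δ v i)    ≈⟨ distribˡ _ _ _ ⟨
      zᵢ * (proj₁ (δ u i) + proj₁ (δ v i))       ≈⟨ *-congˡ (δ.+ᴹ-homo u v i) ⟨
      zᵢ * proj₁ (δ (u ⊕ v) i)                   ∎
      where zᵢ = proj₁ (z (index i))
    δ-Θ (⊖ u) i = begin
      proj₁ (δ (⊖ Θ u) i)                        ≈⟨ δ.-ᴹ-homo (Θ u) i ⟩
      - proj₁ (δ (Θ u) i)                        ≈⟨ -‿cong (δ-Θ u i) ⟩
      - (zᵢ * proj₁ (δ u i))                     ≈⟨ -‿distribʳ-* _ _ ⟩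
      zᵢ * - proj₁ (δ u i)                       ≈⟨ *-congˡ (δ.-ᴹ-homo u i) ⟨
      zᵢ * proj₁ (δ (⊖ u) i)                     ∎
      where zᵢ = proj₁ (z (index i))
    δ-Θ 𝟎 i = trans (δ.0ᴹ-homo i) (sym (trans (*-congˡ (δ.0ᴹ-homo i)) (zeroʳ _)))

    δ-1⊗1 : ∀ i → proj₁ (δ (𝕋.1# ⊗ 𝕋.1#) i) ≈ 1#
    δ-1⊗1 i = trans (on-ζ 0 0 0<rank 0<rank i) (reflexive (≡.cong (λ k → proj₁ (ζᵀ 𝕋.^ k)) (ℕ.*-zeroʳ (rep i))))
      where
      0<rank : 0 ℕ.< rank
      0<rank = ℕ.≤-<-trans z≤n (index<rank i)

    minimal : ∀ k l → k ℕ.≤ l → l ℕ.< rank → newtonExponent (weight m) k k ℕ.≤ newtonExponent (weight m) k l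
    minimal k l k≤l _ = newtonExponent-minimal m k l k≤l

    exponents : Fin rank → ℕ
    exponents k = newtonExponent (weight m) (toℕ k) (toℕ k)

    elementary-divisors : ElementaryDivisorExponents δ exponents
    elementary-divisors = Newton.elementary-divisors minimal Source δ linear Θ Θ-linear (𝕋.1# ⊗ 𝕋.1#) δ-1⊗1 δ-Θ
      Θ^ T⊗T.≋-refl (λ _ → T⊗T.≋-refl) Θ^-spans

    kernel : ∀ u → (∀ i → proj₁ (δ u i) ≈ 0#) → u ≋ 𝟎
    kernel = Newton.f-kernel minimal Source δ linear Θ Θ-linear (𝕋.1# ⊗ 𝕋.1#) δ-1⊗1 δ-Θ
      Θ^ T⊗T.≋-refl (λ _ → T⊗T.≋-refl) Θ^-spans

    monomorphism : IsLeftModuleMonomorphism δ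
    monomorphism = record
      { isLeftModuleHomomorphism = linear
      ; injective = λ {u} {v} δu≈δv → x∙y⁻¹≈ε⇒x≈y u v (kernel (u ⊕ ⊖ v) (λ i → begin
          proj₁ (δ (u ⊕ ⊖ v) i)                 ≈⟨ δ.+ᴹ-homo u (⊖ v) i ⟩
          proj₁ (δ u i) + proj₁ (δ (⊖ v) i)     ≈⟨ +-cong (δu≈δv i) (δ.-ᴹ-homo v i) ⟩
          proj₁ (δ v i) - proj₁ (δ v i)         ≈⟨ -‿inverseʳ _ ⟩
          0#                                    ∎))
      }
      where open AbelianGroupProperties T⊗T.⊕-abelianGroup using (x∙y⁻¹≈ε⇒x≈y)

    valuations : ∀ e → ElementaryDivisorExponents δ e →
      ∀ j → j ℕ.< p ℕ.^ suc m → p ∤ j → ∀ L a → IsExpansion p j L a →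
      ∃ λ (k : Fin rank) → (suc (toℕ k) ≡ N p j) × (+ (e k) ≡ valuation p L a)
    valuations e e-divisors j j<pⁿ p∤j L a expansion with nth-surjective j p∤j
    ... | k , ≡.refl = k′ , ≡.trans (≡.cong suc k′≡k) (≡.sym (N-nth k)) ,
      -- Any two exponent sequences bound each other, so e equals the Newton exponents, for which
      -- the digit formula is known.
      ≡.trans (≡.cong +_ (ℕ.≤-antisym (≤ e-divisors elementary-divisors k′) (≤ elementary-divisors e-divisors k′)))
        (≡.trans (≡.cong (λ k → + newtonExponent (weight m) k k) k′≡k) (newtonExponent-valuation m k j<pⁿ L a expansion))
      where
      ≤ : ∀ {e e′ : Fin rank → ℕ} → ElementaryDivisorExponents δ e → ElementaryDivisorExponents δ e′ → ∀ k → e k ℕ.≤ e′ k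
      ≤ = LocalRing.elementary-divisors-≤ T t O.Local.t-regular O.Local.t-nonunit O.Local.t∣⊎unit Source Target δ linear
      k<rank = nth<p^⇒k<rank m k j<pⁿ
      k′ = fromℕ< k<rank
      k′≡k : toℕ k′ ≡ k
      k′≡k = Fin.toℕ-fromℕ< k<rank

open import Data.Nat.Base using (_≤_; _<_; _^_)

theorem2p7 : ∀ {c ℓ₁ ℓ₂} (K : HeytingField c ℓ₁ ℓ₂) → CharZero K →
    ∀ {p} (p-prime : Prime p) n → 1 ≤ n →
    ∀ ζ → let open Cyclotomic K p-prime n ζ in
    IsPrimitiveRoot field-ring (p ^ n) ζ →
    (∃ λ δ → IsDedekindMap δ × IsLeftModuleMonomorphism δ) ×
    (∀ δ → IsDedekindMap δ →
    (∃ λ e → ElementaryDivisorExponents δ e) ×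
    (∀ e → ElementaryDivisorExponents δ e →
    ∀ j → j < p ^ n → p ∤ j →
    ∀ L a → IsExpansion p j L a →
    ∃ λ (k : Fin rank) → (suc (toℕ k) ≡ N p j) × (+ (e k) ≡ valuation p L a)))
theorem2p7 K char0 p-prime (suc m) 1≤n ζ ζ-primitive =
  (δ₀ , δ₀-Dedekind , Newton-δ.monomorphism δ₀ δ₀-Dedekind) ,
  λ δ δ-Dedekind → (_ , Newton-δ.elementary-divisors δ δ-Dedekind) , Newton-δ.valuations δ δ-Dedekind
  where open Dedekind K char0 p-prime m ζ ζ-primitive
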